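{- It holds that $$2-\sqrt2\;\leq\; \pi_{\mathrm{cyc}}(K_3)\;\leq\;\frac35 .$$ More generally, for every integer $t\geq 3$, $$\pi_{\mathrm{cyc}}(K_t)\;\geq\; t-1-\sqrt{(t-2)^2+1}\;=\;1-\frac1{2(t-2)}+\frac1{8(t-2)^3}-O\left((t-2)^{ -5}\right).$$ In particular, for every $t\geq 3$, for all sufficiently large $k$ and all $n$ sufficiently large in terms of $k$, there is a $K_t$-free subgraph of $C_n^k$ with average degree strictly larger than $\left(2-\frac1{t-2}\right)k+1$ (the minimum degree above which every subgraph of $C_n^k$ must contain $K_t$).
   Context: $C_n^k$ is the $k$th power of the cycle $C_n$ on $n$ vertices: two distinct vertices of $C_n$ are adjacent in $C_n^k$ if and only if their distance in $C_n$ is at most $k$. For graphs $F$ and $G$, the extremal number $\mathrm{ex}(G,F)$ is the maximum number of edges in an $F$-free subgraph of $G$, and $e(G)$ is the number of edges of $G$. The extremal density of $F$ in powers of cycles is $$\pi_{\mathrm{cyc}}(F)=\limsup_{k\to\infty}\limsup_{n\to\infty}\frac{\mathrm{ex}(C_n^k,F)}{e(C_n^k)}.$$ -}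

module Defs where

open import Level using (0ℓ)
open import Algebra.Properties.Group using (⁻¹-involutive)
open import Data.Empty using (⊥-elim)
open import Data.Fin using (Fin; toℕ; fromℕ<; combine; finToFun; funToFin)
import Data.Fin as Fin
import Data.Fin.Properties as Fin
open import Data.Fin.Subset using (Subset; inside)
open import Data.Fin.Subset.Properties using (anySubset?)
open import Data.Integer using (+_)
open import Data.List using (List; []; _∷_; length; filter; map; allFin; cartesianProduct)
open import Data.List.Properties
  using (length-++; length-map; length-tabulate; length-filter; filter-≐)
open import Data.Bool using (true)
import Data.Bool as Bool
open import Data.Nat using (ℕ; zero; suc; z≤n; s≤s)
import Data.Nat as ℕ
import Data.Nat.Properties as ℕ
open import Data.Product using (Σ; ∃; ∃-syntax; Σ-syntax; _×_; _,_; proj₁; proj₂; swap)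
open import Data.Rational using (ℚ; 0ℚ; _<_; _≤_; _+_; _*_; -_; _/_)
import Data.Rational.Properties as ℚ
open import Data.Sum using (_⊎_; inj₁; inj₂)
import Data.Sum as Sum
open import Data.Vec using (lookup; tabulate)
open import Data.Vec.Properties using (lookup∘tabulate)
open import Function using (_∘_; id; _⇔_; mk⇔; Equivalence)
open import Function.Definitions using (Injective)
open import Relation.Binary using (Rel; Symmetric; Irreflexive; Decidable)
open import Relation.Binary.PropositionalEquality
  using (_≡_; _≢_; refl; sym; trans; cong; cong₂; subst; subst₂; module ≡-Reasoning)
open import Relation.Nullary using (¬_; Dec; yes; no; does)
open import Relation.Nullary.Decidable using (_×-dec_; _⊎-dec_; _→-dec_; ¬?; map′)
import Relation.Nullary.Decidable as Dec

record Graph (n : ℕ) : Set₁ where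
  field
    Adj    : Rel (Fin n) 0ℓ
    adj?   : Decidable Adj
    adj-sym : Symmetric Adj
    irrefl : Irreflexive _≡_ Adj

open Graph public

private
  variable
    m n p : ℕ

-- Each edge is listed once, as a pair (u , v) with u < v.

Edge : Graph n → Fin n × Fin n → Set
Edge G (u , v) = u Fin.< v × Adj G u v

edge? : (G : Graph n) → ∀ uv → Dec (Edge G uv)
edge? G (u , v) = (u Fin.<? v) ×-dec adj? G u v

edges : Graph n → List (Fin n × Fin n)
edges {n} G = filter (edge? G) (cartesianProduct (allFin n) (allFin n))

e : Graph n → ℕ
e G = length (edges G)

degree : Graph n → Fin n → ℕ
degree {n} G v = length (filter (adj? G v) (allFin n))

-- F ⊑ G: G has a (not necessarily induced) subgraph isomorphic to F.
-- Thus, up to isomorphism, the subgraphs of G are the graphs H with H ⊑ G,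
-- and "F-free" is ¬ (F ⊑_).

_⊑_ : Graph p → Graph n → Set
_⊑_ {p} {n} F G =
  Σ[ f ∈ (Fin p → Fin n) ]
    Injective _≡_ _≡_ f × (∀ u v → Adj F u v → Adj G (f u) (f v))

infix 4 _⊑_

K : (t : ℕ) → Graph t
K t .Adj u v      = u ≢ v
K t .adj? u v     = ¬? (u Fin.≟ v)
K t .adj-sym u≢v  = u≢v ∘ sym
K t .irrefl eq ne = ne eq

-- Next u v: v is the successor of u in the cyclic order 0, 1, …, n - 1, 0.

Next : Rel (Fin n) 0ℓ
Next {n} u v = toℕ v ≡ suc (toℕ u) ⊎ (suc (toℕ u) ≡ n × toℕ v ≡ 0)

next? : Decidable (Next {n})
next? {n} u v = (toℕ v ℕ.≟ suc (toℕ u)) ⊎-dec ((suc (toℕ u) ℕ.≟ n) ×-dec (toℕ v ℕ.≟ 0))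

Cycle : (n : ℕ) → Graph n
Cycle n .Adj u v               = u ≢ v × (Next u v ⊎ Next v u)
Cycle n .adj? u v              = ¬? (u Fin.≟ v) ×-dec (next? u v ⊎-dec next? v u)
Cycle n .adj-sym (u≢v , next)  = u≢v ∘ sym , Sum.swap next
Cycle n .irrefl eq (u≢v , _)   = u≢v eq

-- DistanceAtMost G k u v: G contains a walk from u to v of length at most k.

DistanceAtMost : Graph n → ℕ → Rel (Fin n) 0ℓ
DistanceAtMost G zero    u v = u ≡ v
DistanceAtMost G (suc k) u v =
  DistanceAtMost G k u v ⊎ (∃[ w ] DistanceAtMost G k u w × Adj G w v)

distanceAtMost? : (G : Graph n) (k : ℕ) → Decidable (DistanceAtMost G k)
distanceAtMost? G zero    u v = u Fin.≟ v
distanceAtMost? G (suc k) u v =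
  distanceAtMost? G k u v ⊎-dec Fin.any? (λ w → distanceAtMost? G k u w ×-dec adj? G w v)

distance-cons : (G : Graph n) (k : ℕ) → ∀ {u v w} →
                Adj G u v → DistanceAtMost G k v w → DistanceAtMost G (suc k) u w
distance-cons G zero    uv refl             = inj₂ (_ , refl , uv)
distance-cons G (suc k) uv (inj₁ d)         = inj₁ (distance-cons G k uv d)
distance-cons G (suc k) uv (inj₂ (x , d , a)) = inj₂ (x , distance-cons G k uv d , a)

distance-sym : (G : Graph n) (k : ℕ) → Symmetric (DistanceAtMost G k)
distance-sym G zero    eq               = sym eq
distance-sym G (suc k) (inj₁ d)         = inj₁ (distance-sym G k d)
distance-sym G (suc k) (inj₂ (w , d , a)) =
  distance-cons G k (adj-sym G a) (distance-sym G k d)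

power : Graph n → ℕ → Graph n
power G k .Adj u v             = u ≢ v × DistanceAtMost G k u v
power G k .adj? u v            = ¬? (u Fin.≟ v) ×-dec distanceAtMost? G k u v
power G k .adj-sym (u≢v , d)   = u≢v ∘ sym , distance-sym G k d
power G k .irrefl eq (u≢v , _) = u≢v eq

CyclePower : (n k : ℕ) → Graph n
CyclePower n k = power (Cycle n) k

-- Attainable G F x: some F-free subgraph of G has exactly x edges.

Attainable : Graph n → Graph p → ℕ → Set₁
Attainable G F x = ∃[ m ] Σ[ H ∈ Graph m ] H ⊑ G × ¬ (F ⊑ H) × e H ≡ x

-- Decidability of Attainable is what allows its maximum to be computed; the
-- lemmas from here to ex serve only that purpose.

⊑-trans : {F : Graph m} {G : Graph n} {H : Graph p} → F ⊑ G → G ⊑ H → F ⊑ H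
⊑-trans (f , f-inj , f-hom) (g , g-inj , g-hom) =
  g ∘ f , f-inj ∘ g-inj , λ u v → g-hom (f u) (f v) ∘ f-hom u v

⊑⇒≤ : {F : Graph m} {G : Graph n} → F ⊑ G → m ℕ.≤ n
⊑⇒≤ (f , f-inj , _) = Fin.injective⇒≤ f-inj

_⊑?_ : (F : Graph p) (G : Graph n) → Dec (F ⊑ G)
_⊑?_ {p} {n} F G = map′ to from (Fin.any? (embedding? ∘ finToFun))
  where
  Embedding : (Fin p → Fin n) → Set
  Embedding f = (∀ u v → f u ≡ f v → u ≡ v) × (∀ u v → Adj F u v → Adj G (f u) (f v))

  embedding? : ∀ f → Dec (Embedding f)
  embedding? f =
    Fin.all? (λ u → Fin.all? λ v → (f u Fin.≟ f v) →-dec (u Fin.≟ v))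
      ×-dec Fin.all? (λ u → Fin.all? λ v → adj? F u v →-dec adj? G (f u) (f v))

  to : (∃[ i ] Embedding (finToFun i)) → F ⊑ G
  to (i , inj , hom) = finToFun i , (λ {u} {v} → inj u v) , hom

  from : F ⊑ G → ∃[ i ] Embedding (finToFun i)
  from (f , inj , hom) =
    funToFin f ,
    (λ u v eq → inj (trans (sym (same u)) (trans eq (same v)))) ,
    (λ u v a → subst₂ (Adj G) (sym (same u)) (sym (same v)) (hom u v a))
    where
    same : ∀ u → finToFun (funToFin f) u ≡ f u
    same = Fin.finToFun-funToFin f

e-cong : (G H : Graph n) → (∀ u v → Adj G u v ⇔ Adj H u v) → e G ≡ e H
e-cong {n} G H G⇔H = cong length (filter-≐ (edge? G) (edge? H)
  ( (λ (lt , a) → lt , Equivalence.to (G⇔H _ _) a)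
  , (λ (lt , a) → lt , Equivalence.from (G⇔H _ _) a))
  (cartesianProduct (allFin n) (allFin n)))

length-cartesianProduct : ∀ {A B : Set} (xs : List A) (ys : List B) →
                          length (cartesianProduct xs ys) ≡ length xs ℕ.* length ys
length-cartesianProduct []       ys = refl
length-cartesianProduct (x ∷ xs) ys =
  trans (length-++ (map (x ,_) ys))
        (cong₂ ℕ._+_ (length-map (x ,_) ys) (length-cartesianProduct xs ys))

e≤n*n : (G : Graph n) → e G ℕ.≤ n ℕ.* n
e≤n*n {n} G = ℕ.≤-trans
  (length-filter (edge? G) (cartesianProduct (allFin n) (allFin n)))
  (ℕ.≤-reflexive (trans (length-cartesianProduct (allFin n) (allFin n))
                        (cong₂ ℕ._*_ (length-tabulate {n = n} id) (length-tabulate {n = n} id))))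

decode : Subset (n ℕ.* n) → Graph n
decode {n} S = record
  { Adj     = λ u v → u ≢ v × (Coded u v ⊎ Coded v u)
  ; adj?    = λ u v → ¬? (u Fin.≟ v) ×-dec (coded? u v ⊎-dec coded? v u)
  ; adj-sym = λ (u≢v , c) → u≢v ∘ sym , Sum.swap c
  ; irrefl  = λ eq (u≢v , _) → u≢v eq
  }
  where
  Coded : Rel (Fin n) 0ℓ
  Coded u v = lookup S (combine u v) ≡ inside

  coded? : Decidable Coded
  coded? u v = lookup S (combine u v) Bool.≟ inside

encode : Graph n → Subset (n ℕ.* n)
encode {n} G = tabulate λ i → let (u , v) = Fin.remQuot {n} n i in does (adj? G u v)

decode-encode : (G : Graph n) → ∀ u v → Adj G u v ⇔ Adj (decode (encode G)) u v
decode-encode {n} G u v = mk⇔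
  (λ a → (λ eq → irrefl G eq a) , inj₁ (trans (lookup-encode u v) (Dec.dec-true (adj? G u v) a)))
  (λ { (_ , inj₁ c) → sound u v c ; (_ , inj₂ c) → adj-sym G (sound v u c) })
  where
  lookup-encode : ∀ u v → lookup (encode G) (combine u v) ≡ does (adj? G u v)
  lookup-encode u v = trans (lookup∘tabulate _ (combine u v))
    (cong (λ (x , y) → does (adj? G x y)) (Fin.remQuot-combine u v))

  does-sound : ∀ {P : Set} (d : Dec P) → does d ≡ true → P
  does-sound (yes x) refl = x

  sound : ∀ u v → lookup (encode G) (combine u v) ≡ inside → Adj G u v
  sound u v c = does-sound (adj? G u v) (trans (sym (lookup-encode u v)) c)

attainable? : (G : Graph n) (F : Graph p) → ∀ x → Dec (Attainable G F x)
attainable? {n} {p} G F x = map′ to from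
  (Fin.any? λ (i : Fin (suc n)) → anySubset? λ S → good? (decode {toℕ i} S))
  where
  Good : ∀ {m} → Graph m → Set
  Good H = H ⊑ G × ¬ (F ⊑ H) × e H ≡ x

  good? : ∀ {m} (H : Graph m) → Dec (Good H)
  good? H = (H ⊑? G) ×-dec (¬? (F ⊑? H) ×-dec (e H ℕ.≟ x))

  Coded : ℕ → Set
  Coded m = ∃[ S ] Good (decode {m} S)

  to : (∃[ i ] Coded (toℕ {suc n} i)) → Attainable G F x
  to (i , S , good) = toℕ i , decode S , good

  from : Attainable G F x → ∃[ i ] Coded (toℕ {suc n} i)
  from (m , H , H⊑G , F⋢H , eH) =
    fromℕ< m<1+n , subst Coded (sym (Fin.toℕ-fromℕ< m<1+n))
      ( encode H
      , ⊑-trans {F = H′} {H} {G} H′⊑H H⊑G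
      , F⋢H ∘ (λ F⊑H′ → ⊑-trans {F = F} {H′} {H} F⊑H′ H′⊑H)
      , trans (sym (e-cong H H′ (decode-encode H))) eH)
    where
    m<1+n : m ℕ.< suc n
    m<1+n = s≤s (⊑⇒≤ {F = H} {G} H⊑G)

    H′ : Graph m
    H′ = decode (encode H)

    H′⊑H : H′ ⊑ H
    H′⊑H = id , id , λ u v → Equivalence.from (decode-encode H u v)

-- The greatest x ≤ b satisfying P, or 0 if there is none.

greatest : ∀ {ℓ} {P : ℕ → Set ℓ} → (∀ x → Dec (P x)) → ℕ → ℕ
greatest P? zero    = zero
greatest P? (suc b) with P? (suc b)
... | yes _ = suc b
... | no  _ = greatest P? b

greatest-upper : ∀ {ℓ} {P : ℕ → Set ℓ} (P? : ∀ x → Dec (P x)) →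
                 ∀ b {x} → x ℕ.≤ b → P x → x ℕ.≤ greatest P? b
greatest-upper P? zero    x≤b Px = x≤b
greatest-upper P? (suc b) x≤b Px with P? (suc b)
... | yes _  = x≤b
... | no ¬Pb with ℕ.m≤n⇒m<n∨m≡n x≤b
...   | inj₁ (s≤s x≤b′) = greatest-upper P? b x≤b′ Px
...   | inj₂ refl       = ⊥-elim (¬Pb Px)

greatest-attained : ∀ {ℓ} {P : ℕ → Set ℓ} (P? : ∀ x → Dec (P x)) →
                    ∀ b {x} → x ℕ.≤ b → P x → P (greatest P? b)
greatest-attained {P = P} P? zero x≤b Px = subst P (ℕ.n≤0⇒n≡0 x≤b) Px
greatest-attained P? (suc b) x≤b Px with P? (suc b)
... | yes Pb = Pb
... | no ¬Pb with ℕ.m≤n⇒m<n∨m≡n x≤b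
...   | inj₁ (s≤s x≤b′) = greatest-attained P? b x≤b′ Px
...   | inj₂ refl       = ⊥-elim (¬Pb Px)

-- ex is the maximum of Attainable G F, by ex-upper and ex-attained below.
-- The search bound n * n is never a restriction; the value is 0 in the
-- degenerate case where no graph is F-free (F without vertices).

ex : Graph n → Graph p → ℕ
ex {n} G F = greatest (attainable? G F) (n ℕ.* n)

attainable-bound : (G : Graph n) (F : Graph p) → ∀ {x} → Attainable G F x → x ℕ.≤ n ℕ.* n
attainable-bound G F (m , H , H⊑G , _ , refl) =
  ℕ.≤-trans (e≤n*n H) (ℕ.*-mono-≤ (⊑⇒≤ {F = H} {G} H⊑G) (⊑⇒≤ {F = H} {G} H⊑G))

ex-upper : (G : Graph n) (F : Graph p) → ∀ {x} → Attainable G F x → x ℕ.≤ ex G F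
ex-upper {n} G F a = greatest-upper (attainable? G F) (n ℕ.* n) (attainable-bound G F a) a

ex-attained : (G : Graph n) (F : Graph p) → ∀ {x} → Attainable G F x → Attainable G F (ex G F)
ex-attained {n} G F a = greatest-attained (attainable? G F) (n ℕ.* n) (attainable-bound G F a) a

-- A number x is given by lower = { q | q < x } and upper = { q | x < q }.
-- Inhabitedness is not required, so ±∞ are included and every sequence has a
-- limsup.  Locatedness is not required either, since it is not constructively
-- provable for a limsup.  Classically rational cuts and √ n are located, and
-- limsups of located cuts, negations, and sums of finite located cuts are
-- located again, so these are the usual (extended) real numbers.

record Cut : Set₁ where
  field
    lower        : ℚ → Set
    upper        : ℚ → Set
    lower-closed : ∀ {p q} → p < q → lower q → lower p
    lower-open   : ∀ {p} → lower p → ∃[ q ] p < q × lower q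
    upper-closed : ∀ {p q} → p < q → upper p → upper q
    upper-open   : ∀ {q} → upper q → ∃[ p ] p < q × upper p
    separated    : ∀ {p q} → lower p → upper q → p < q

open Cut public

_≤ᶜ_ : Cut → Cut → Set
x ≤ᶜ y = (∀ q → lower x q → lower y q) × (∀ q → upper y q → upper x q)

infix 4 _≤ᶜ_

private
  neg-involutive : ∀ q → - (- q) ≡ q
  neg-involutive = ⁻¹-involutive ℚ.+-0-group

  flip-neg : ∀ {p q} → p < - q → q < - p
  flip-neg {p} {q} lt = subst (_< - p) (neg-involutive q) (ℚ.neg-antimono-< lt)

  flip-neg′ : ∀ {p q} → - q < p → - p < q
  flip-neg′ {p} {q} lt = subst (- p <_) (neg-involutive q) (ℚ.neg-antimono-< lt)

  square-cancel : ∀ {r s} → 0ℚ ≤ s → r * r ≤ s * s → r ≤ s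
  square-cancel {r} {s} 0≤s rr≤ss with r ℚ.≤? s
  ... | yes r≤s = r≤s
  ... | no  r≰s = ⊥-elim (ℚ.<-irrefl refl (ℚ.<-≤-trans
          (ℚ.≤-<-trans (ℚ.*-monoˡ-≤-nonNeg s {{Data.Rational.nonNegative 0≤s}} (ℚ.<⇒≤ s<r))
                       (ℚ.*-monoˡ-<-pos r {{Data.Rational.positive (ℚ.≤-<-trans 0≤s s<r)}} s<r))
          rr≤ss))
    where s<r = ℚ.≰⇒> r≰s

⟦_⟧ : ℚ → Cut
⟦ r ⟧ = record
  { lower        = _< r
  ; upper        = r <_
  ; lower-closed = ℚ.<-trans
  ; lower-open   = ℚ.<-dense
  ; upper-closed = λ p<q r<p → ℚ.<-trans r<p p<q
  ; upper-open   = λ r<q → let (s , r<s , s<q) = ℚ.<-dense r<q in s , s<q , r<s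
  ; separated    = ℚ.<-trans
  }

-ᶜ_ : Cut → Cut
-ᶜ x = record
  { lower        = λ q → upper x (- q)
  ; upper        = λ q → lower x (- q)
  ; lower-closed = λ p<q → upper-closed x (ℚ.neg-antimono-< p<q)
  ; lower-open   = λ u → let (r , lt , ur) = upper-open x u in
                     - r , flip-neg lt , subst (upper x) (sym (neg-involutive r)) ur
  ; upper-closed = λ p<q → lower-closed x (ℚ.neg-antimono-< p<q)
  ; upper-open   = λ l → let (r , lt , lr) = lower-open x l in
                     - r , flip-neg′ lt , subst (lower x) (sym (neg-involutive r)) lr
  ; separated    = λ {p} {q} u l → subst₂ _<_ (neg-involutive p) (neg-involutive q)
                     (ℚ.neg-antimono-< (separated x l u))
  }

_+ᶜ_ : Cut → Cut → Cut
x +ᶜ y = record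
  { lower        = λ q → ∃[ a ] ∃[ b ] lower x a × lower y b × q < a + b
  ; upper        = λ q → ∃[ a ] ∃[ b ] upper x a × upper y b × a + b < q
  ; lower-closed = λ p<q (a , b , la , lb , lt) → a , b , la , lb , ℚ.<-trans p<q lt
  ; lower-open   = λ (a , b , la , lb , lt) →
                     let (r , p<r , r<ab) = ℚ.<-dense lt in r , p<r , a , b , la , lb , r<ab
  ; upper-closed = λ p<q (a , b , ua , ub , lt) → a , b , ua , ub , ℚ.<-trans lt p<q
  ; upper-open   = λ (a , b , ua , ub , lt) →
                     let (r , ab<r , r<q) = ℚ.<-dense lt in r , r<q , a , b , ua , ub , ab<r
  ; separated    = λ (a , b , la , lb , lt) (c , d , uc , ud , gt) →
                     ℚ.<-trans lt (ℚ.<-trans (ℚ.+-mono-< (separated x la uc) (separated y lb ud)) gt)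
  }

_-ᶜ_ : Cut → Cut → Cut
x -ᶜ y = x +ᶜ (-ᶜ y)

infix  8 -ᶜ_
infixl 6 _+ᶜ_ _-ᶜ_

fromℕ : ℕ → ℚ
fromℕ n = + n / 1

√ : ℕ → Cut
√ n = record
  { lower        = λ q → ∃[ r ] q < r × r * r ≤ fromℕ n
  ; upper        = λ q → ∃[ r ] r < q × 0ℚ ≤ r × fromℕ n ≤ r * r
  ; lower-closed = λ p<q (r , q<r , sq) → r , ℚ.<-trans p<q q<r , sq
  ; lower-open   = λ (r , p<r , sq) → let (s , p<s , s<r) = ℚ.<-dense p<r in s , p<s , r , s<r , sq
  ; upper-closed = λ p<q (r , r<p , sq) → r , ℚ.<-trans r<p p<q , sq
  ; upper-open   = λ (r , r<q , sq) → let (s , r<s , s<q) = ℚ.<-dense r<q in s , s<q , r , r<s , sq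
  ; separated    = λ (r , p<r , rr≤n) (s , s<q , 0≤s , n≤ss) →
                     ℚ.<-trans (ℚ.<-≤-trans p<r (square-cancel 0≤s (ℚ.≤-trans rr≤n n≤ss))) s<q
  }

-- q < limsup x  iff  x n > q′ infinitely often, for some q′ > q;
-- limsup x < q  iff  x n < q′ eventually,       for some q′ < q.

limsup : (ℕ → Cut) → Cut
limsup x = record
  { lower        = λ q → ∃[ q′ ] q < q′ × (∀ N → ∃[ n ] N ℕ.≤ n × lower (x n) q′)
  ; upper        = λ q → ∃[ q′ ] q′ < q × (∃[ N ] ∀ n → N ℕ.≤ n → upper (x n) q′)
  ; lower-closed = λ p<q (r , q<r , often) → r , ℚ.<-trans p<q q<r , often
  ; lower-open   = λ (r , p<r , often) → let (s , p<s , s<r) = ℚ.<-dense p<r in s , p<s , r , s<r , often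
  ; upper-closed = λ p<q (r , r<p , ev) → r , ℚ.<-trans r<p p<q , ev
  ; upper-open   = λ (r , r<q , ev) → let (s , r<s , s<q) = ℚ.<-dense r<q in s , s<q , r , r<s , ev
  ; separated    = λ (r , p<r , often) (s , s<q , N , ev) →
                     let (n , N≤n , l) = often N in
                     ℚ.<-trans p<r (ℚ.<-trans (separated (x n) l (ev n N≤n)) s<q)
  }

-- The quotient a / b; the value at b = 0 is a convention.

_÷_ : ℕ → ℕ → ℚ
a ÷ zero  = 0ℚ
a ÷ suc b = + a / suc b

infixl 7 _÷_

-- The convention for ÷ matters only for n ≤ 1 or k = 0, where C_n^k has no edges.

πcyc : Graph p → Cut
πcyc F = limsup λ k → limsup λ n → ⟦ ex (CyclePower n k) F ÷ e (CyclePower n k) ⟧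

averageDegree : Graph n → ℚ
averageDegree {n} G = (2 ℕ.* e G) ÷ n

{-# OPTIONS --safe #-}
-- Write s = t − 2.  Colouring blocks of b consecutive vertices cyclically with s + 1 colours
-- and keeping the bichromatic edges of C_n^k gives a K_t-free graph.  Its density tends to
-- s + 1 − √(s² + 1) for b ≈ k / √(s² + 1), and with b slightly below k / s its average
-- degree already exceeds (2 − 1/s) k + 1.
--
-- For the bound 3/5, every triple x < y < z ≤ x + k of a triangle-free graph spans at most
-- two edges.  Summing suitable consequences over all triples and sorting the pairs of edges
-- by their common vertex v leaves a quadratic functional of the neighbourhood of v.
-- Slide a window of k + 1 vertices across v: the number of neighbours of v in the window is
-- the height of a walk with steps 0 and ±1, and the functional weights the steps where both,
-- exactly one, or none of the exchanged vertices are neighbours by 4, 1 and −2 times the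
-- height.  Steps of the first kind cannot be much lower than steps of the last kind, since
-- the walk needs time to move between them, and this gives degree at most 6k/5 on average.
--
-- For the minimum degree, every vertex misses fewer than k / s positions within distance k.
-- Starting from a shortest edge, repeatedly add a common neighbour nearest to the hull of the
-- current clique: all positions passed over are missed, which keeps the hull short.
module Submission where

open import Defs
import Algebra.Solver.Ring as Ring-Solver
open import Algebra.Solver.Ring.AlmostCommutativeRing using (fromCommutativeRing; _-Raw-AlmostCommutative⟶_)
open import Data.Empty using (⊥-elim)
open import Data.Fin using (Fin; toℕ; zero; suc)
import Data.Fin as Fin
import Data.Fin.Properties as Fin
import Data.Integer as ℤ
open import Data.Integer using (ℤ; +_; 0ℤ; 1ℤ)
import Data.Integer.Properties as ℤ
import Data.Integer.Tactic.RingSolver as ℤ-Solver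
open import Data.List using ([]; _∷_; length; filter; map; allFin; cartesianProduct; tabulate; applyUpTo)
open import Data.List.Properties using (filter-++; length-++; map-applyUpTo)
open import Data.Maybe using (Maybe; just; nothing)
open import Data.Nat as ℕ using (ℕ; zero; suc; _∸_; _^_; z≤n; s≤s; NonZero)
open import Data.Nat.DivMod hiding (_/_; _%_)
open import Data.Nat.Divisibility using (n∣m*n)
import Data.Nat.Properties as ℕ
open import Data.Nat.Tactic.RingSolver using () renaming (solve-∀ to solve-ℕ)
open import Data.Product using (∃-syntax; Σ-syntax; _×_; _,_; proj₁; proj₂)
open import Data.Rational using (ℚ; 0ℚ; 1ℚ; ↥_; ↧_; ↧ₙ_; mkℚ; toℚᵘ)
import Data.Rational as ℚ
import Data.Rational.Properties as ℚ
open import Data.Rational.Unnormalised using (mkℚᵘ; *≡*; *<*; *≤*)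
import Data.Rational.Unnormalised as ℚᵘ
import Data.Rational.Unnormalised.Properties as ℚᵘ
open import Data.Sum using (_⊎_; inj₁; inj₂)
open import Function using (_∘_; id)
open import Function.Definitions using (Injective)
open import Relation.Binary.PropositionalEquality
open import Relation.Nullary using (Dec; yes; no; ¬_)
open import Relation.Nullary.Decidable using (_×-dec_; _⊎-dec_; ¬?; decidable-stable)

-- Two features of the definitions shape the proof. A subgraph is an embedded graph on a vertex set
-- of its own, so it is first transported along its embedding to the vertices of the cycle, where
-- positions make sense. Vertices outside the image are isolated there, which is why degree
-- hypotheses are imposed only on vertices that have a neighbour. And a vertex of the cycle is
-- represented by every natural number in its residue class, so that left, right, hulls and windows
-- are available; translating by multiples of `n` keeps all positions non-negative. The limits are
-- taken only at the end, so every estimate before carries its lower-order terms explicitly. The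
-- constant 6/5 belongs to walks whose steps 00, 01, 10, 11 occur in the proportion 0 : 2 : 2 : 1,
-- where 5 steps meet 6 neighbours. With the weights 3, 3, 2 on the edges xy, yz, xz of a triple,
-- this is the only proportion at which the quadratic estimate is tight.

module Counting where
  open import Data.Nat using (_/_; _%_)
  open import Data.Integer using (_+_; _*_; _-_; -_; _≤_; _<_)
  open ℤ-Solver using (solve-∀)

  -- Integer inequalities and finite sums

  ≤-by : ∀ {a b d} → 0ℤ ≤ d → b ≡ a + d → a ≤ b
  ≤-by {a} 0≤d refl = ℤ.≤-trans (ℤ.≤-reflexive (sym (ℤ.+-identityʳ a))) (ℤ.+-monoʳ-≤ a 0≤d)

  0≤-diff : ∀ {a b} → a ≤ b → 0ℤ ≤ b - a
  0≤-diff = ℤ.i≤j⇒0≤j-i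

  0≤+ : ∀ {a b} → 0ℤ ≤ a → 0ℤ ≤ b → 0ℤ ≤ a + b
  0≤+ = ℤ.+-mono-≤

  0≤* : ∀ {a b} → 0ℤ ≤ a → 0ℤ ≤ b → 0ℤ ≤ a * b
  0≤* {+ m} {+ n} _ _ = ℤ.≤-trans (ℤ.+≤+ z≤n) (ℤ.≤-reflexive (ℤ.pos-* m n))

  0≤+n : ∀ {n} → 0ℤ ≤ + n
  0≤+n = ℤ.+≤+ z≤n

  0≤square : ∀ a → 0ℤ ≤ a * a
  0≤square (+ n) = 0≤* {+ n} {+ n} 0≤+n 0≤+n
  0≤square ℤ.-[1+ n ] = ℤ.+≤+ z≤n

  -- An inequality is certified by writing its difference as a sum of products of non-negative
  -- expressions; with these operators the positivity proof follows the shape of that sum.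
  infixr 6 _⊕_
  infixr 7 _⊛_
  _⊕_ = 0≤+
  _⊛_ = 0≤*

  ∑ : ℕ → (ℕ → ℤ) → ℤ
  ∑ zero    f = 0ℤ
  ∑ (suc n) f = ∑ n f + f n

  ∑-cong : ∀ n {f g} → (∀ i → i ℕ.< n → f i ≡ g i) → ∑ n f ≡ ∑ n g
  ∑-cong zero    eq = refl
  ∑-cong (suc n) eq = cong₂ _+_ (∑-cong n λ i → eq i ∘ ℕ.m≤n⇒m≤1+n) (eq n ℕ.≤-refl)

  ∑-cong′ : ∀ n {f g} → (∀ i → f i ≡ g i) → ∑ n f ≡ ∑ n g
  ∑-cong′ n eq = ∑-cong n λ i _ → eq i

  ∑-mono : ∀ n {f g} → (∀ i → i ℕ.< n → f i ≤ g i) → ∑ n f ≤ ∑ n g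
  ∑-mono zero    le = ℤ.≤-refl
  ∑-mono (suc n) le = ℤ.+-mono-≤ (∑-mono n λ i → le i ∘ ℕ.m≤n⇒m≤1+n) (le n ℕ.≤-refl)

  ∑-const : ∀ n c → ∑ n (λ _ → c) ≡ + n * c
  ∑-const zero    c = sym (ℤ.*-zeroˡ c)
  ∑-const (suc n) c = trans (cong (_+ c) (∑-const n c)) (identity (+ n) c)
    where
    identity : ∀ n c → n * c + c ≡ (1ℤ + n) * c
    identity = solve-∀

  0≤∑ : ∀ n {f} → (∀ i → i ℕ.< n → 0ℤ ≤ f i) → 0ℤ ≤ ∑ n f
  0≤∑ n le = ℤ.≤-trans (ℤ.≤-reflexive (sym (trans (∑-const n 0ℤ) (ℤ.*-zeroʳ (+ n))))) (∑-mono n le)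

  ∑-+ : ∀ n f g → ∑ n (λ i → f i + g i) ≡ ∑ n f + ∑ n g
  ∑-+ zero    f g = refl
  ∑-+ (suc n) f g = trans (cong (_+ (f n + g n)) (∑-+ n f g)) (identity (∑ n f) (∑ n g) (f n) (g n))
    where
    identity : ∀ a b c d → a + b + (c + d) ≡ a + c + (b + d)
    identity = solve-∀

  ∑-* : ∀ n c f → ∑ n (λ i → c * f i) ≡ c * ∑ n f
  ∑-* zero    c f = sym (ℤ.*-zeroʳ c)
  ∑-* (suc n) c f = trans (cong (_+ c * f n) (∑-* n c f)) (sym (ℤ.*-distribˡ-+ c (∑ n f) (f n)))

  ∑-*ʳ : ∀ n c f → ∑ n (λ i → f i * c) ≡ ∑ n f * c
  ∑-*ʳ n c f = trans (∑-cong′ n λ i → ℤ.*-comm (f i) c) (trans (∑-* n c f) (ℤ.*-comm c _))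

  ∑-swap : ∀ m n (F : ℕ → ℕ → ℤ) → ∑ m (λ i → ∑ n (F i)) ≡ ∑ n (λ j → ∑ m λ i → F i j)
  ∑-swap zero    n F = sym (trans (∑-const n 0ℤ) (ℤ.*-zeroʳ (+ n)))
  ∑-swap (suc m) n F = trans (cong (_+ ∑ n (F m)) (∑-swap m n F)) (sym (∑-+ n _ (F m)))

  ∑-append : ∀ m n f → ∑ (m ℕ.+ n) f ≡ ∑ m f + ∑ n (λ i → f (m ℕ.+ i))
  ∑-append m zero    f = trans (cong (λ a → ∑ a f) (ℕ.+-identityʳ m)) (sym (ℤ.+-identityʳ _))
  ∑-append m (suc n) f = begin
    ∑ (m ℕ.+ suc n) f                                  ≡⟨ cong (λ a → ∑ a f) (ℕ.+-suc m n) ⟩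
    ∑ (m ℕ.+ n) f + f (m ℕ.+ n)                        ≡⟨ cong (_+ f (m ℕ.+ n)) (∑-append m n f) ⟩
    ∑ m f + ∑ n (λ i → f (m ℕ.+ i)) + f (m ℕ.+ n)      ≡⟨ ℤ.+-assoc (∑ m f) _ _ ⟩
    ∑ m f + ∑ (suc n) (λ i → f (m ℕ.+ i))              ∎
    where open ≡-Reasoning

  ∑-head : ∀ n f → ∑ (suc n) f ≡ f 0 + ∑ n (f ∘ suc)
  ∑-head n f = trans (∑-append 1 n f) (cong (_+ ∑ n (f ∘ suc)) (ℤ.+-identityˡ (f 0)))

  ∑-rev : ∀ n f → ∑ n f ≡ ∑ n (λ i → f (n ∸ suc i))
  ∑-rev zero    f = refl
  ∑-rev (suc n) f = begin
    ∑ n f + f n                              ≡⟨ ℤ.+-comm (∑ n f) (f n) ⟩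
    f n + ∑ n f                              ≡⟨ cong (λ a → f n + a) (∑-rev n f) ⟩
    f n + ∑ n (λ i → f (n ∸ suc i))          ≡⟨ ∑-head n (λ i → f (n ∸ i)) ⟨
    ∑ (suc n) (λ i → f (n ∸ i))              ∎
    where open ≡-Reasoning

  ∑-triangle : ∀ k (G : ℕ → ℕ → ℤ) →
    ∑ k (λ q → ∑ q λ p → G p q) ≡ ∑ k (λ p → ∑ (k ∸ suc p) λ j → G p (suc (p ℕ.+ j)))
  ∑-triangle zero    G = refl
  ∑-triangle (suc k) G = begin
    ∑ k (λ q → ∑ q λ p → G p q) + ∑ k (λ p → G p k)
      ≡⟨ cong (_+ ∑ k (λ p → G p k)) (∑-triangle k G) ⟩
    ∑ k (λ p → row (k ∸ suc p) p) + ∑ k (λ p → G p k)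
      ≡⟨ ∑-+ k (λ p → row (k ∸ suc p) p) (λ p → G p k) ⟨
    ∑ k (λ p → row (k ∸ suc p) p + G p k)
      ≡⟨ ∑-cong k extend ⟩
    ∑ k (λ p → row (k ∸ p) p)
      ≡⟨ ℤ.+-identityʳ _ ⟨
    ∑ k (λ p → row (k ∸ p) p) + 0ℤ
      ≡⟨ cong (λ a → ∑ k (λ p → row (k ∸ p) p) + row a k) (ℕ.n∸n≡0 k) ⟨
    ∑ (suc k) (λ p → row (k ∸ p) p) ∎
    where
    open ≡-Reasoning
    row : ℕ → ℕ → ℤ
    row a p = ∑ a λ j → G p (suc (p ℕ.+ j))
    extend : ∀ p → p ℕ.< k → row (k ∸ suc p) p + G p k ≡ row (k ∸ p) p
    extend p p<k = trans (cong (λ a → row (k ∸ suc p) p + G p a) (sym (ℕ.m+[n∸m]≡n p<k)))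
                         (cong (λ a → row a p) (sym (ℕ.+-∸-assoc 1 p<k)))

  -- Moving the window of summation by one trades `f d` for `f (d + n)`, and the two are equal.
  ∑-shift : ∀ n {f} → (∀ i → f (i ℕ.+ n) ≡ f i) → ∀ d → ∑ n (λ i → f (i ℕ.+ d)) ≡ ∑ n f
  ∑-shift n {f} per zero    = ∑-cong′ n λ i → cong f (ℕ.+-identityʳ i)
  ∑-shift n {f} per (suc d) = trans step (∑-shift n {f} per d)
    where
    g : ℕ → ℤ
    g i = f (i ℕ.+ d)
    g-per : g n ≡ g 0
    g-per = trans (cong f (ℕ.+-comm n d)) (per d)
    rearrange : ∀ a b c → a + b ≡ b + c → c ≡ a
    rearrange a b c eq = trans (peel b c) (trans (cong (_- b) (sym eq)) (unpeel a b))
      where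
      peel : ∀ b c → c ≡ b + c - b
      peel = solve-∀
      unpeel : ∀ a b → a + b - b ≡ a
      unpeel = solve-∀
    step : ∑ n (λ i → f (i ℕ.+ suc d)) ≡ ∑ n g
    step = trans (∑-cong′ n λ i → cong f (ℕ.+-suc i d))
      (rearrange (∑ n g) (g 0) (∑ n (g ∘ suc)) (trans (cong (λ a → ∑ n g + a) (sym g-per)) (∑-head n g)))

  -- Indicators of decidable propositions

  𝟙 : ∀ {ℓ} {P : Set ℓ} → Dec P → ℤ
  𝟙 (yes _) = 1ℤ
  𝟙 (no  _) = 0ℤ

  0≤𝟙 : ∀ {ℓ} {P : Set ℓ} (d : Dec P) → 0ℤ ≤ 𝟙 d
  0≤𝟙 (yes _) = 0≤+n
  0≤𝟙 (no  _) = 0≤+n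

  𝟙≤1 : ∀ {ℓ} {P : Set ℓ} (d : Dec P) → 𝟙 d ≤ 1ℤ
  𝟙≤1 (yes _) = ℤ.≤-refl
  𝟙≤1 (no  _) = 0≤+n

  𝟙-yes : ∀ {ℓ} {P : Set ℓ} (d : Dec P) → P → 𝟙 d ≡ 1ℤ
  𝟙-yes (yes _) _ = refl
  𝟙-yes (no ¬p) p = ⊥-elim (¬p p)

  𝟙-no : ∀ {ℓ} {P : Set ℓ} (d : Dec P) → ¬ P → 𝟙 d ≡ 0ℤ
  𝟙-no (yes p) ¬p = ⊥-elim (¬p p)
  𝟙-no (no _)  _  = refl

  𝟙-mono : ∀ {ℓ ℓ′} {P : Set ℓ} {Q : Set ℓ′} (d : Dec P) (d′ : Dec Q) → (P → Q) → 𝟙 d ≤ 𝟙 d′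
  𝟙-mono (yes p) d′ imp = ℤ.≤-reflexive (sym (𝟙-yes d′ (imp p)))
  𝟙-mono (no _)  d′ _   = 0≤𝟙 d′

  𝟙-cong : ∀ {ℓ ℓ′} {P : Set ℓ} {Q : Set ℓ′} (d : Dec P) (d′ : Dec Q) → (P → Q) → (Q → P) → 𝟙 d ≡ 𝟙 d′
  𝟙-cong d d′ to from = ℤ.≤-antisym (𝟙-mono d d′ to) (𝟙-mono d′ d from)

  𝟙-bit : ∀ {ℓ} {P : Set ℓ} (d : Dec P) → 𝟙 d ≡ 0ℤ ⊎ 𝟙 d ≡ 1ℤ
  𝟙-bit (yes _) = inj₂ refl
  𝟙-bit (no  _) = inj₁ refl

  -- Words over the pairs of bits

  Bit : ℤ → Set
  Bit a = a ≡ 0ℤ ⊎ a ≡ 1ℤ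

  -- The contribution of a pair p < q of steps of a window sliding past a vertex v: α tells
  -- whether the vertex entering the window is adjacent to v, β the same for the vertex leaving it.
  cell : ℤ → ℤ → ℤ → ℤ → ℤ
  cell a b a′ b′ =
    + 3 * a + + 3 * b′ - + 6 * (a * b′) + b + a′ - + 5 * (b * b′) - + 5 * (a * a′)

  cells : (α β : ℕ → ℤ) → ℕ → ℤ
  cells α β k = ∑ k λ q → ∑ q λ p → cell (α p) (β p) (α q) (β q)

  row : ℤ → ℤ → ℤ → ℤ → ℤ → ℤ
  row q A B a b =
    + 3 * A + + 3 * (q * b) - + 6 * (A * b) + B + q * a - + 5 * (B * b) - + 5 * (A * a)

  ∑-cell : ∀ (α β : ℕ → ℤ) a b q → ∑ q (λ p → cell (α p) (β p) a b) ≡ row (+ q) (∑ q α) (∑ q β) a b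
  ∑-cell α β a b zero = identity a b
    where
    identity : ∀ a b → 0ℤ ≡ + 3 * 0ℤ + + 3 * (0ℤ * b) - + 6 * (0ℤ * b) + 0ℤ + 0ℤ * a - + 5 * (0ℤ * b) - + 5 * (0ℤ * a)
    identity = solve-∀
  ∑-cell α β a b (suc q) =
    trans (cong (_+ cell (α q) (β q) a b) (∑-cell α β a b q))
          (identity (+ q) (∑ q α) (∑ q β) (α q) (β q) a b)
    where
    identity : ∀ q A B x y a b →
      (+ 3 * A + + 3 * (q * b) - + 6 * (A * b) + B + q * a - + 5 * (B * b) - + 5 * (A * a))
      + (+ 3 * x + + 3 * b - + 6 * (x * b) + y + a - + 5 * (y * b) - + 5 * (x * a))
      ≡ + 3 * (A + x) + + 3 * ((1ℤ + q) * b) - + 6 * ((A + x) * b) + (B + y) + (1ℤ + q) * a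
        - + 5 * ((B + y) * b) - + 5 * ((A + x) * a)
    identity = solve-∀

  -- The order of the letters enters twice `cells` in two ways only. One is the height before the
  -- letters 00 and 11, replaced here by `M` and `c`. The other is the pairs of a 01 and a 10, which
  -- contribute 4 if the 01 comes first and 0 otherwise; `u * f` counts all of them at 4.
  bound : ℤ → ℤ → ℤ → ℤ → ℤ → ℤ → ℤ
  bound o f u t c M =
    + 2 * (o * u) + + 6 * (o * f) + + 8 * (o * t) - + 8 * (f * t) - + 8 * (t * t) + + 4 * (u * f)
    - u * u - f * f + + 8 * t + u + f + + 4 * (o * M) - + 8 * (t * c)

  -- o, f, u, t count the letters 00, 01, 10, 11 among the pairs (α q, β q), q < k.
  -- The height u − f of a prefix is at least c before every letter 11 and at most M before
  -- every letter 00, and reaching one from the other takes M − c letters 10 or M − c letters 01.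
  record Profile (α β : ℕ → ℤ) (k : ℕ) : Set where
    field
      {o f u t c M} : ℤ
      0≤o  : 0ℤ ≤ o
      0≤f  : 0ℤ ≤ f
      0≤u  : 0ℤ ≤ u
      0≤t  : 0ℤ ≤ t
      size : + k ≡ o + f + u + t
      ∑α   : ∑ k α ≡ u + t
      ∑β   : ∑ k β ≡ f + t
      low  : 0ℤ ≤ c + f
      high : 0ℤ ≤ u - M
      gap  : 0ℤ ≤ u - (M - c) ⊎ 0ℤ ≤ f - (M - c)
      cells≤ : + 2 * cells α β k ≤ bound o f u t c M

  module _ (α β : ℕ → ℤ) (α-bit : ∀ i → Bit (α i)) (β-bit : ∀ i → Bit (β i)) where

    private
      cells-suc : ∀ k {a b} (pr : Profile α β k) → α k ≡ a → β k ≡ b → let open Profile pr in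
        cells α β (suc k) ≡ cells α β k + row (o + f + u + t) (u + t) (f + t) a b
      cells-suc k pr refl refl = cong (λ r → cells α β k + r)
        (trans (∑-cell α β (α k) (β k) k)
        (trans (cong (λ A → row (+ k) A (∑ k β) _ _) ∑α)
        (trans (cong (λ B → row (+ k) (u + t) B _ _) ∑β)
               (cong (λ q → row q (u + t) (f + t) _ _) size))))
        where open Profile pr

      sum-suc : ∀ k {γ : ℕ → ℤ} {A B a} → γ k ≡ a → ∑ k γ ≡ A → A + a ≡ B → ∑ (suc k) γ ≡ B
      sum-suc k refl refl eq = eq

      size-suc : ∀ k {n m} → + k ≡ n → 1ℤ + n ≡ m → + suc k ≡ m
      size-suc k refl eq = eq

      double≤ : ∀ {x y d b} → x ≡ y → 0ℤ ≤ d → b ≡ + 2 * y + d → + 2 * x ≤ b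
      double≤ refl = ≤-by

      step-O : ∀ {k} → Profile α β k → α k ≡ 0ℤ → β k ≡ 0ℤ → Profile α β (suc k)
      step-O {k} pr αk βk = choose (ℤ.≤-total (u - f) M)
        where
        open Profile pr
        identity : ∀ Q o f u t c M M′ → + 2 * ((o + 1ℤ) * u) + + 6 * ((o + 1ℤ) * f) + + 8 * ((o + 1ℤ) * t) - + 8 * (f * t) - + 8 * (t * t) + + 4 * (u * f) - u * u - f * f + + 8 * t + u + f + + 4 * ((o + 1ℤ) * M′) - + 8 * (t * c)
            ≡ + 2 * (Q + (+ 3 * (u + t) + + 3 * ((o + f + u + t) * 0ℤ) - + 6 * ((u + t) * 0ℤ) + (f + t) + (o + f + u + t) * 0ℤ - + 5 * ((f + t) * 0ℤ) - + 5 * ((u + t) * 0ℤ)))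
            + ((+ 2 * (o * u) + + 6 * (o * f) + + 8 * (o * t) - + 8 * (f * t) - + 8 * (t * t) + + 4 * (u * f) - u * u - f * f + + 8 * t + u + f + + 4 * (o * M) - + 8 * (t * c) - + 2 * Q) + (+ 4 * (o * (M′ - M)) + + 4 * (M′ - (u - f))))
        identity = solve-∀
        0≤1+o : 0ℤ ≤ o + 1ℤ
        0≤1+o = 0≤o ⊕ 0≤+n
        size′ : + suc k ≡ o + 1ℤ + f + u + t
        size′ = size-suc k size (eq o f u t)
          where
          eq : ∀ o f u t → 1ℤ + (o + f + u + t) ≡ o + 1ℤ + f + u + t
          eq = solve-∀
        build : ∀ M′ → 0ℤ ≤ M′ - M → 0ℤ ≤ M′ - (u - f) → 0ℤ ≤ u - M′ →
                0ℤ ≤ u - (M′ - c) ⊎ 0ℤ ≤ f - (M′ - c) → Profile α β (suc k)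
        build M′ M≤M′ h≤M′ high′ gap′ = record
          { 0≤o = 0≤1+o ; 0≤f = 0≤f ; 0≤u = 0≤u ; 0≤t = 0≤t ; size = size′
          ; ∑α = sum-suc k αk ∑α (ℤ.+-identityʳ _) ; ∑β = sum-suc k βk ∑β (ℤ.+-identityʳ _)
          ; low = low ; high = high′ ; gap = gap′
          ; cells≤ = double≤ (cells-suc k pr αk βk)
              (0≤-diff cells≤ ⊕ 0≤+n {4} ⊛ 0≤o ⊛ M≤M′ ⊕ 0≤+n {4} ⊛ h≤M′) (identity (cells α β k) o f u t c M M′) }
        choose : u - f ≤ M ⊎ M ≤ u - f → Profile α β (suc k)
        choose (inj₁ h≤M) = build M (ℤ.≤-reflexive (sym (ℤ.+-inverseʳ M))) (0≤-diff h≤M) high gap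
        -- The new maximum lies after the point of height `c`, and the climb in between costs
        -- letters 10: with `u - f` in place of `M` the gap condition reduces to `low`.
        choose (inj₂ M≤h) = build (u - f) (0≤-diff M≤h) (ℤ.≤-reflexive (sym (ℤ.+-inverseʳ (u - f))))
          (ℤ.≤-trans 0≤f (ℤ.≤-reflexive (eq₁ u f)))
          (inj₁ (ℤ.≤-trans low (ℤ.≤-reflexive (eq₂ u f c))))
          where
          eq₁ : ∀ u f → f ≡ u - (u - f)
          eq₁ = solve-∀
          eq₂ : ∀ u f c → c + f ≡ u - (u - f - c)
          eq₂ = solve-∀

      step-A : ∀ {k} → Profile α β k → α k ≡ 1ℤ → β k ≡ 0ℤ → Profile α β (suc k)
      step-A {k} pr αk βk = record
          { 0≤o = 0≤o ; 0≤f = 0≤f ; 0≤u = 0≤u ⊕ 0≤+n {1} ; 0≤t = 0≤t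
          ; size = size-suc k size (eq₁ o f u t)
          ; ∑α = sum-suc k αk ∑α (eq₂ u t) ; ∑β = sum-suc k βk ∑β (ℤ.+-identityʳ _)
          ; low = low ; high = ℤ.≤-trans (high ⊕ 0≤+n {1}) (ℤ.≤-reflexive (eq₃ u M)) ; gap = gap′ gap
          ; cells≤ = double≤ (cells-suc k pr αk βk)
              (0≤-diff cells≤) (identity (cells α β k) o f u t c M) }
        where
        open Profile pr
        identity : ∀ Q o f u t c M → + 2 * (o * (u + 1ℤ)) + + 6 * (o * f) + + 8 * (o * t) - + 8 * (f * t) - + 8 * (t * t) + + 4 * ((u + 1ℤ) * f) - (u + 1ℤ) * (u + 1ℤ) - f * f + + 8 * t + (u + 1ℤ) + f + + 4 * (o * M) - + 8 * (t * c)
            ≡ + 2 * (Q + (+ 3 * (u + t) + + 3 * ((o + f + u + t) * 0ℤ) - + 6 * ((u + t) * 0ℤ) + (f + t) + (o + f + u + t) * 1ℤ - + 5 * ((f + t) * 0ℤ) - + 5 * ((u + t) * 1ℤ)))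
            + (+ 2 * (o * u) + + 6 * (o * f) + + 8 * (o * t) - + 8 * (f * t) - + 8 * (t * t) + + 4 * (u * f) - u * u - f * f + + 8 * t + u + f + + 4 * (o * M) - + 8 * (t * c) - + 2 * Q)
        identity = solve-∀
        eq₁ : ∀ o f u t → 1ℤ + (o + f + u + t) ≡ o + f + (u + 1ℤ) + t
        eq₁ = solve-∀
        eq₂ : ∀ u t → u + t + 1ℤ ≡ u + 1ℤ + t
        eq₂ = solve-∀
        eq₃ : ∀ u M → u - M + 1ℤ ≡ u + 1ℤ - M
        eq₃ = solve-∀
        gap′ : 0ℤ ≤ u - (M - c) ⊎ 0ℤ ≤ f - (M - c) → 0ℤ ≤ u + 1ℤ - (M - c) ⊎ 0ℤ ≤ f - (M - c)
        gap′ (inj₁ g) = inj₁ (ℤ.≤-trans (g ⊕ 0≤+n {1}) (ℤ.≤-reflexive (eq₃ u (M - c))))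
        gap′ (inj₂ g) = inj₂ g

      step-B : ∀ {k} → Profile α β k → α k ≡ 0ℤ → β k ≡ 1ℤ → Profile α β (suc k)
      step-B {k} pr αk βk = record
          { 0≤o = 0≤o ; 0≤f = 0≤f ⊕ 0≤+n {1} ; 0≤u = 0≤u ; 0≤t = 0≤t
          ; size = size-suc k size (eq₁ o f u t)
          ; ∑α = sum-suc k αk ∑α (ℤ.+-identityʳ _) ; ∑β = sum-suc k βk ∑β (eq₂ f t)
          ; low = ℤ.≤-trans (low ⊕ 0≤+n {1}) (ℤ.≤-reflexive (ℤ.+-assoc c f 1ℤ)) ; high = high ; gap = gap′ gap
          ; cells≤ = double≤ (cells-suc k pr αk βk)
              (0≤-diff cells≤ ⊕ 0≤+n {4} ⊛ 0≤u) (identity (cells α β k) o f u t c M) }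
        where
        open Profile pr
        identity : ∀ Q o f u t c M → + 2 * (o * u) + + 6 * (o * (f + 1ℤ)) + + 8 * (o * t) - + 8 * ((f + 1ℤ) * t) - + 8 * (t * t) + + 4 * (u * (f + 1ℤ)) - u * u - (f + 1ℤ) * (f + 1ℤ) + + 8 * t + u + (f + 1ℤ) + + 4 * (o * M) - + 8 * (t * c)
            ≡ + 2 * (Q + (+ 3 * (u + t) + + 3 * ((o + f + u + t) * 1ℤ) - + 6 * ((u + t) * 1ℤ) + (f + t) + (o + f + u + t) * 0ℤ - + 5 * ((f + t) * 1ℤ) - + 5 * ((u + t) * 0ℤ)))
            + ((+ 2 * (o * u) + + 6 * (o * f) + + 8 * (o * t) - + 8 * (f * t) - + 8 * (t * t) + + 4 * (u * f) - u * u - f * f + + 8 * t + u + f + + 4 * (o * M) - + 8 * (t * c) - + 2 * Q) + + 4 * u)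
        identity = solve-∀
        eq₁ : ∀ o f u t → 1ℤ + (o + f + u + t) ≡ o + (f + 1ℤ) + u + t
        eq₁ = solve-∀
        eq₂ : ∀ u t → u + t + 1ℤ ≡ u + 1ℤ + t
        eq₂ = solve-∀
        eq₃ : ∀ u M → u - M + 1ℤ ≡ u + 1ℤ - M
        eq₃ = solve-∀
        gap′ : 0ℤ ≤ u - (M - c) ⊎ 0ℤ ≤ f - (M - c) → 0ℤ ≤ u - (M - c) ⊎ 0ℤ ≤ f + 1ℤ - (M - c)
        gap′ (inj₁ g) = inj₁ g
        gap′ (inj₂ g) = inj₂ (ℤ.≤-trans (g ⊕ 0≤+n {1}) (ℤ.≤-reflexive (eq₃ f (M - c))))

      step-T : ∀ {k} → Profile α β k → α k ≡ 1ℤ → β k ≡ 1ℤ → Profile α β (suc k)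
      step-T {k} pr αk βk = choose (ℤ.≤-total (u - f) c)
        where
        open Profile pr
        identity : ∀ Q o f u t c c′ M → + 2 * (o * u) + + 6 * (o * f) + + 8 * (o * (t + 1ℤ)) - + 8 * (f * (t + 1ℤ)) - + 8 * ((t + 1ℤ) * (t + 1ℤ)) + + 4 * (u * f) - u * u - f * f + + 8 * (t + 1ℤ) + u + f + + 4 * (o * M) - + 8 * ((t + 1ℤ) * c′)
            ≡ + 2 * (Q + (+ 3 * (u + t) + + 3 * ((o + f + u + t) * 1ℤ) - + 6 * ((u + t) * 1ℤ) + (f + t) + (o + f + u + t) * 1ℤ - + 5 * ((f + t) * 1ℤ) - + 5 * ((u + t) * 1ℤ)))
            + ((+ 2 * (o * u) + + 6 * (o * f) + + 8 * (o * t) - + 8 * (f * t) - + 8 * (t * t) + + 4 * (u * f) - u * u - f * f + + 8 * t + u + f + + 4 * (o * M) - + 8 * (t * c) - + 2 * Q) + (+ 8 * (t * (c - c′)) + + 8 * ((u - f) - c′)))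
        identity = solve-∀
        eq₁ : ∀ o f u t → 1ℤ + (o + f + u + t) ≡ o + f + u + (t + 1ℤ)
        eq₁ = solve-∀
        build : ∀ c′ → 0ℤ ≤ c - c′ → 0ℤ ≤ u - f - c′ → 0ℤ ≤ c′ + f →
                0ℤ ≤ u - (M - c′) ⊎ 0ℤ ≤ f - (M - c′) → Profile α β (suc k)
        build c′ c′≤c c′≤h low′ gap′ = record
          { 0≤o = 0≤o ; 0≤f = 0≤f ; 0≤u = 0≤u ; 0≤t = 0≤t ⊕ 0≤+n {1}
          ; size = size-suc k size (eq₁ o f u t)
          ; ∑α = sum-suc k αk ∑α (ℤ.+-assoc u t 1ℤ) ; ∑β = sum-suc k βk ∑β (ℤ.+-assoc f t 1ℤ)
          ; low = low′ ; high = high ; gap = gap′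
          ; cells≤ = double≤ (cells-suc k pr αk βk)
              (0≤-diff cells≤ ⊕ 0≤+n {8} ⊛ 0≤t ⊛ c′≤c ⊕ 0≤+n {8} ⊛ c′≤h) (identity (cells α β k) o f u t c c′ M) }
        choose : u - f ≤ c ⊎ c ≤ u - f → Profile α β (suc k)
        choose (inj₂ c≤h) = build c (ℤ.≤-reflexive (sym (ℤ.+-inverseʳ c))) (0≤-diff c≤h) low gap
        -- Dually, the new minimum lies after the point of height `M`, the descent costs letters 01,
        -- and the gap condition reduces to `high`.
        choose (inj₁ h≤c) = build (u - f) (0≤-diff h≤c) (ℤ.≤-reflexive (sym (ℤ.+-inverseʳ (u - f))))
          (ℤ.≤-trans 0≤u (ℤ.≤-reflexive (eq₂ u f)))
          (inj₂ (ℤ.≤-trans high (ℤ.≤-reflexive (eq₃ u f M))))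
          where
          eq₂ : ∀ u f → u ≡ u - f + f
          eq₂ = solve-∀
          eq₃ : ∀ u f M → u - M ≡ f - (M - (u - f))
          eq₃ = solve-∀

    profile : ∀ k → Profile α β k
    profile zero = record
      { o = 0ℤ ; f = 0ℤ ; u = 0ℤ ; t = 0ℤ ; c = 0ℤ ; M = 0ℤ
      ; 0≤o = 0≤+n ; 0≤f = 0≤+n ; 0≤u = 0≤+n ; 0≤t = 0≤+n ; size = refl ; ∑α = refl ; ∑β = refl
      ; low = 0≤+n ; high = 0≤+n ; gap = inj₁ 0≤+n ; cells≤ = 0≤+n }
    profile (suc k) with profile k | α-bit k | β-bit k
    ... | pr | inj₁ αk | inj₁ βk = step-O pr αk βk
    ... | pr | inj₂ αk | inj₁ βk = step-A pr αk βk
    ... | pr | inj₁ αk | inj₂ βk = step-B pr αk βk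
    ... | pr | inj₂ αk | inj₂ βk = step-T pr αk βk

  -- The quadratic inequality for letter counts and heights

  private
    -- Sums of squares for the two cases o ≤ 2t and 2t ≤ o; equality holds at
    -- (o , x , y , t) = (0 , 2 , 2 , 1) up to linear terms.
    six-fold : ∀ o x y t c M →
      + 6 * (+ 24 * ((o + x + y + t) * (o + x + y + t)) + + 40 * (o + x + y + t)) ≡
      + 6 * (+ 5 * (+ 2 * (o * (x + y)) + + 4 * (o * t) + + 4 * (x * y) - x * x - y * y + + 8 * t + x + y
                    + + 4 * (o * M) - + 8 * (t * c))
             + + 20 * ((o + x + y + t) * (x + y + + 2 * t)))
      + ((+ 12 * t - + 8 * o - + 3 * x - + 3 * y) * (+ 12 * t - + 8 * o - + 3 * x - + 3 * y)
         + (+ 5 * ((+ 2 * o - + 3 * x + + 3 * y) * (+ 2 * o - + 3 * x + + 3 * y)) + (+ 60 * (o * o)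
         + (+ 120 * ((+ 2 * t - o) * (c - t)) + (+ 120 * (o * (x - (M - c)))
         + (+ 240 * o + (+ 210 * x + + 210 * y)))))))
    six-fold = solve-∀

    nine-fold : ∀ o x y t c M →
      + 9 * (+ 24 * ((o + x + y + t) * (o + x + y + t)) + + 40 * (o + x + y + t)) ≡
      + 9 * (+ 5 * (+ 2 * (o * (x + y)) + + 4 * (o * t) + + 4 * (x * y) - x * x - y * y + + 8 * t + x + y
                    + + 4 * (o * M) - + 8 * (t * c))
             + + 20 * ((o + x + y + t) * (x + y + + 2 * t)))
      + ((+ 9 * x - + 6 * y - + 8 * t - (o - + 2 * t)) * (+ 9 * x - + 6 * y - + 8 * t - (o - + 2 * t))
         + (+ 5 * ((+ 3 * y - (o - + 2 * t)) * (+ 3 * y - (o - + 2 * t)))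
         + (+ 210 * ((o - + 2 * t) * (o - + 2 * t)) + (+ 440 * (t * t) + (+ 120 * (y * t)
         + (+ 560 * ((o - + 2 * t) * t)
         + (+ 180 * ((o - + 2 * t) * (x + y + t - M)) + (+ 360 * (t * (x - (M - c)))
         + (+ 360 * o + (+ 315 * x + + 315 * y))))))))))
    nine-fold = solve-∀

  -- Here `c` and `M` are actual numbers of neighbours in the window, which holds `f + t` of them at
  -- the start; hence the shift by `f + t` in `cells-bound`. In these terms the estimate is
  -- symmetric in the numbers `x` and `y` of letters 10 and 01, so one gap condition suffices. Once
  -- `M - c ≤ x` is used, the terms with `M` and `c` depend on one remaining height, with
  -- coefficient a multiple of `o - 2t`. So the worst case has `c = t` when `o ≤ 2t`, and
  -- `M = x + y + t` when `2t ≤ o`.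
  profile-bound : ∀ {o x y t c M} → 0ℤ ≤ o → 0ℤ ≤ x → 0ℤ ≤ y → 0ℤ ≤ t →
    0ℤ ≤ c - t → 0ℤ ≤ x + y + t - M → 0ℤ ≤ x - (M - c) →
    + 5 * (+ 2 * (o * (x + y)) + + 4 * (o * t) + + 4 * (x * y) - x * x - y * y + + 8 * t + x + y
           + + 4 * (o * M) - + 8 * (t * c))
      + + 20 * ((o + x + y + t) * (x + y + + 2 * t))
    ≤ + 24 * ((o + x + y + t) * (o + x + y + t)) + + 40 * (o + x + y + t)
  profile-bound {o} {x} {y} {t} {c} {M} 0≤o 0≤x 0≤y 0≤t low high gap with ℤ.≤-total o (+ 2 * t)
  ... | inj₁ o≤2t = ℤ.*-cancelˡ-≤-pos _ _ (+ 6)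
    (≤-by (0≤square (+ 12 * t - + 8 * o - + 3 * x - + 3 * y)
           ⊕ 0≤+n {5} ⊛ 0≤square (+ 2 * o - + 3 * x + + 3 * y) ⊕ 0≤+n {60} ⊛ 0≤o ⊛ 0≤o
           ⊕ 0≤+n {120} ⊛ 0≤-diff o≤2t ⊛ low ⊕ 0≤+n {120} ⊛ 0≤o ⊛ gap
           ⊕ 0≤+n {240} ⊛ 0≤o ⊕ 0≤+n {210} ⊛ 0≤x ⊕ 0≤+n {210} ⊛ 0≤y)
          (six-fold o x y t c M))
  ... | inj₂ 2t≤o = ℤ.*-cancelˡ-≤-pos _ _ (+ 9)
    (≤-by (0≤square (+ 9 * x - + 6 * y - + 8 * t - (o - + 2 * t))
           ⊕ 0≤+n {5} ⊛ 0≤square (+ 3 * y - (o - + 2 * t)) ⊕ 0≤+n {210} ⊛ 0≤square (o - + 2 * t) ⊕ 0≤+n {440} ⊛ 0≤t ⊛ 0≤t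
           ⊕ 0≤+n {120} ⊛ 0≤y ⊛ 0≤t ⊕ 0≤+n {560} ⊛ 0≤-diff 2t≤o ⊛ 0≤t
           ⊕ 0≤+n {180} ⊛ 0≤-diff 2t≤o ⊛ high ⊕ 0≤+n {360} ⊛ 0≤t ⊛ gap
           ⊕ 0≤+n {360} ⊛ 0≤o ⊕ 0≤+n {315} ⊛ 0≤x ⊕ 0≤+n {315} ⊛ 0≤y)
          (nine-fold o x y t c M))

  -- Summed over all vertices, where the total of `cells` is non-negative, this bounds the average
  -- of the degrees `∑ k α + ∑ k β` by 6k/5 + 2.
  cells-bound : ∀ (α β : ℕ → ℤ) → (∀ i → Bit (α i)) → (∀ i → Bit (β i)) → ∀ k →
    + 5 * cells α β k + + 10 * (+ k * (∑ k α + ∑ k β)) ≤ + 12 * (+ k * + k) + + 20 * + k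
  cells-bound α β α-bit β-bit k = ℤ.*-cancelˡ-≤-pos _ _ (+ 2) (begin
    + 2 * (+ 5 * cells α β k + + 10 * (+ k * (∑ k α + ∑ k β)))
      ≡⟨ cong (λ s → + 2 * (+ 5 * cells α β k + + 10 * s)) (cong₂ (λ n s → n * s) size (cong₂ _+_ ∑α ∑β)) ⟩
    + 2 * (+ 5 * cells α β k + + 10 * ((o + f + u + t) * (u + t + (f + t))))
      ≡⟨ regroup (cells α β k) o f u t ⟩
    + 5 * (+ 2 * cells α β k) + + 20 * ((o + f + u + t) * (u + t + (f + t)))
      ≤⟨ ℤ.+-monoˡ-≤ (+ 20 * ((o + f + u + t) * (u + t + (f + t)))) (ℤ.*-monoˡ-≤-nonNeg (+ 5) cells≤) ⟩
    + 5 * bound o f u t c M + + 20 * ((o + f + u + t) * (u + t + (f + t)))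
      ≤⟨ final gap ⟩
    + 24 * ((o + f + u + t) * (o + f + u + t)) + + 40 * (o + f + u + t)
      ≡⟨ cong (λ n → + 24 * (n * n) + + 40 * n) size ⟨
    + 24 * (+ k * + k) + + 40 * + k
      ≡⟨ halve (+ k) ⟨
    + 2 * (+ 12 * (+ k * + k) + + 20 * + k) ∎)
    where
    open Profile (profile α β α-bit β-bit k)
    open ℤ.≤-Reasoning
    regroup : ∀ Q o f u t → + 2 * (+ 5 * Q + + 10 * ((o + f + u + t) * (u + t + (f + t)))) ≡
                            + 5 * (+ 2 * Q) + + 20 * ((o + f + u + t) * (u + t + (f + t)))
    regroup = solve-∀
    halve : ∀ k → + 2 * (+ 12 * (k * k) + + 20 * k) ≡ + 24 * (k * k) + + 40 * k
    halve = solve-∀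
    final : 0ℤ ≤ u - (M - c) ⊎ 0ℤ ≤ f - (M - c) →
      + 5 * bound o f u t c M + + 20 * ((o + f + u + t) * (u + t + (f + t)))
        ≤ + 24 * ((o + f + u + t) * (o + f + u + t)) + + 40 * (o + f + u + t)
    final (inj₁ gap-u) = ℤ.≤-trans (ℤ.≤-reflexive (lhs o f u t c M))
      (ℤ.≤-trans (profile-bound {c = c + f + t} {M = M + f + t} 0≤o 0≤u 0≤f 0≤t
                   (ℤ.≤-trans low (ℤ.≤-reflexive (low-eq c f t)))
                   (ℤ.≤-trans high (ℤ.≤-reflexive (high-eq u f t M)))
                   (ℤ.≤-trans gap-u (ℤ.≤-reflexive (gap-eq u f t c M))))
                 (ℤ.≤-reflexive (rhs o f u t)))
      where
      lhs : ∀ o f u t c M →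
        + 5 * (+ 2 * (o * u) + + 6 * (o * f) + + 8 * (o * t) - + 8 * (f * t) - + 8 * (t * t) + + 4 * (u * f)
               - u * u - f * f + + 8 * t + u + f + + 4 * (o * M) - + 8 * (t * c))
          + + 20 * ((o + f + u + t) * (u + t + (f + t))) ≡
        + 5 * (+ 2 * (o * (u + f)) + + 4 * (o * t) + + 4 * (u * f) - u * u - f * f + + 8 * t + u + f
               + + 4 * (o * (M + f + t)) - + 8 * (t * (c + f + t)))
          + + 20 * ((o + u + f + t) * (u + f + + 2 * t))
      lhs = solve-∀
      rhs : ∀ o f u t → + 24 * ((o + u + f + t) * (o + u + f + t)) + + 40 * (o + u + f + t) ≡
                        + 24 * ((o + f + u + t) * (o + f + u + t)) + + 40 * (o + f + u + t)
      rhs = solve-∀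
      low-eq : ∀ c f t → c + f ≡ c + f + t - t
      low-eq = solve-∀
      high-eq : ∀ u f t M → u - M ≡ u + f + t - (M + f + t)
      high-eq = solve-∀
      gap-eq : ∀ u f t c M → u - (M - c) ≡ u - (M + f + t - (c + f + t))
      gap-eq = solve-∀
    final (inj₂ gap-f) = ℤ.≤-trans (ℤ.≤-reflexive (lhs o f u t c M))
      (profile-bound {c = c + f + t} {M = M + f + t} 0≤o 0≤f 0≤u 0≤t
                   (ℤ.≤-trans low (ℤ.≤-reflexive (low-eq c f t)))
                   (ℤ.≤-trans high (ℤ.≤-reflexive (high-eq u f t M)))
                   (ℤ.≤-trans gap-f (ℤ.≤-reflexive (gap-eq f t c M))))
      where
      lhs : ∀ o f u t c M →
        + 5 * (+ 2 * (o * u) + + 6 * (o * f) + + 8 * (o * t) - + 8 * (f * t) - + 8 * (t * t) + + 4 * (u * f)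
               - u * u - f * f + + 8 * t + u + f + + 4 * (o * M) - + 8 * (t * c))
          + + 20 * ((o + f + u + t) * (u + t + (f + t))) ≡
        + 5 * (+ 2 * (o * (f + u)) + + 4 * (o * t) + + 4 * (f * u) - f * f - u * u + + 8 * t + f + u
               + + 4 * (o * (M + f + t)) - + 8 * (t * (c + f + t)))
          + + 20 * ((o + f + u + t) * (f + u + + 2 * t))
      lhs = solve-∀
      low-eq : ∀ c f t → c + f ≡ c + f + t - t
      low-eq = solve-∀
      high-eq : ∀ u f t M → u - M ≡ f + u + t - (M + f + t)
      high-eq = solve-∀
      gap-eq : ∀ f t c M → f - (M - c) ≡ f - (M + f + t - (c + f + t))
      gap-eq = solve-∀

  -- Powers of cycles, unrolled

  ∑-term : ∀ n {f} → (∀ i → 0ℤ ≤ f i) → ∀ {j} → j ℕ.< n → f j ≤ ∑ n f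
  ∑-term (suc n) {f} 0≤f {j} (s≤s j≤n) with ℕ.m≤n⇒m<n∨m≡n j≤n
  ... | inj₁ j<n  = ≤-by (0≤f n ⊕ 0≤-diff (∑-term n {f} 0≤f j<n)) (identity (∑ n f) (f n) (f j))
    where
    identity : ∀ s a b → s + a ≡ b + (a + (s - b))
    identity = solve-∀
  ... | inj₂ refl = ≤-by (0≤∑ n {f} λ i _ → 0≤f i) (ℤ.+-comm (∑ n f) (f n))

  ∑-unique≤1 : ∀ n {P : ℕ → Set} (P? : ∀ i → Dec (P i)) →
    (∀ i j → i ℕ.< n → j ℕ.< n → P i → P j → i ≡ j) → ∑ n (λ i → 𝟙 (P? i)) ≤ 1ℤ
  ∑-unique≤1 zero    P? unique = 0≤+n
  ∑-unique≤1 (suc n) P? unique with P? n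
  ... | no _   = ℤ.≤-trans (ℤ.≤-reflexive (ℤ.+-identityʳ _))
    (∑-unique≤1 n P? λ i j i<n j<n → unique i j (ℕ.m≤n⇒m≤1+n i<n) (ℕ.m≤n⇒m≤1+n j<n))
  ... | yes Pn = ℤ.≤-reflexive (cong (_+ 1ℤ) (trans
    (∑-cong n λ i i<n → 𝟙-no (P? i) λ Pi → ℕ.<-irrefl (unique i n (ℕ.m≤n⇒m≤1+n i<n) ℕ.≤-refl Pi Pn) i<n)
    (trans (∑-const n 0ℤ) (ℤ.*-zeroʳ (+ n)))))

  ∑-inject : ∀ m n (f : ℕ → ℕ) → (∀ i → i ℕ.< m → f i ℕ.< n) →
    (∀ i j → i ℕ.< m → j ℕ.< m → f i ≡ f j → i ≡ j) →
    ∀ {F} → (∀ x → 0ℤ ≤ F x) → ∑ m (F ∘ f) ≤ ∑ n F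
  ∑-inject m n f f<n f-inj {F} 0≤F = begin
    ∑ m (F ∘ f)
      ≤⟨ ∑-mono m pick ⟩
    ∑ m (λ i → ∑ n λ x → 𝟙 (f i ℕ.≟ x) * F x)
      ≡⟨ ∑-swap m n _ ⟩
    ∑ n (λ x → ∑ m λ i → 𝟙 (f i ℕ.≟ x) * F x)
      ≡⟨ ∑-cong′ n (λ x → ∑-*ʳ m (F x) _) ⟩
    ∑ n (λ x → ∑ m (λ i → 𝟙 (f i ℕ.≟ x)) * F x)
      ≤⟨ ∑-mono n (λ x _ → ℤ.*-monoʳ-≤-nonNeg (F x) {{ℤ.nonNegative (0≤F x)}}
           (∑-unique≤1 m (λ i → f i ℕ.≟ x) λ i j i<m j<m p q → f-inj i j i<m j<m (trans p (sym q)))) ⟩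
    ∑ n (λ x → 1ℤ * F x)
      ≡⟨ ∑-cong′ n (λ x → ℤ.*-identityˡ (F x)) ⟩
    ∑ n F ∎
    where
    open ℤ.≤-Reasoning
    pick : ∀ i → i ℕ.< m → F (f i) ≤ ∑ n (λ x → 𝟙 (f i ℕ.≟ x) * F x)
    pick i i<m = ℤ.≤-trans
      (ℤ.≤-reflexive (sym (trans (cong (_* F (f i)) (𝟙-yes (f i ℕ.≟ f i) refl)) (ℤ.*-identityˡ _))))
      (∑-term n {λ x → 𝟙 (f i ℕ.≟ x) * F x} (λ x → 0≤𝟙 (f i ℕ.≟ x) ⊛ 0≤F x) (f<n i i<m))

  module _ {A : Set} {P : A → Set} (P? : ∀ a → Dec (P a)) where

    length-filter-∷ : ∀ x xs → + length (filter P? (x ∷ xs)) ≡ 𝟙 (P? x) + + length (filter P? xs)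
    length-filter-∷ x xs with P? x
    ... | yes _ = refl
    ... | no  _ = sym (ℤ.+-identityˡ _)

    length-filter-applyUpTo : ∀ (g : ℕ → A) n → + length (filter P? (applyUpTo g n)) ≡ ∑ n (λ i → 𝟙 (P? (g i)))
    length-filter-applyUpTo g zero    = refl
    length-filter-applyUpTo g (suc n) = trans (length-filter-∷ (g 0) _)
      (trans (cong (λ r → 𝟙 (P? (g 0)) + r) (length-filter-applyUpTo (g ∘ suc) n))
             (sym (∑-head n (λ i → 𝟙 (P? (g i))))))

  length-filter-cartesianProduct : ∀ {A : Set} {P : A × A → Set} (P? : ∀ a → Dec (P a)) (g h : ℕ → A) m n →
    + length (filter P? (cartesianProduct (applyUpTo g m) (applyUpTo h n)))
      ≡ ∑ m (λ i → ∑ n λ j → 𝟙 (P? (g i , h j)))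
  length-filter-cartesianProduct P? g h zero    n = refl
  length-filter-cartesianProduct P? g h (suc m) n = begin
    + length (filter P? (map (g 0 ,_) (applyUpTo h n) Data.List.++ rest))
      ≡⟨ cong (λ xs → + length xs) (filter-++ P? (map (g 0 ,_) (applyUpTo h n)) rest) ⟩
    + length (filter P? (map (g 0 ,_) (applyUpTo h n)) Data.List.++ filter P? rest)
      ≡⟨ cong +_ (length-++ (filter P? (map (g 0 ,_) (applyUpTo h n)))) ⟩
    + length (filter P? (map (g 0 ,_) (applyUpTo h n))) + + length (filter P? rest)
      ≡⟨ cong₂ _+_
           (trans (cong (λ xs → + length (filter P? xs)) (map-applyUpTo h (g 0 ,_) n))
                  (length-filter-applyUpTo P? (λ j → g 0 , h j) n))
           (length-filter-cartesianProduct P? (g ∘ suc) h m n) ⟩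
    ∑ n (λ j → 𝟙 (P? (g 0 , h j))) + ∑ m (λ i → ∑ n λ j → 𝟙 (P? (g (suc i) , h j)))
      ≡⟨ ∑-head m (λ i → ∑ n λ j → 𝟙 (P? (g i , h j))) ⟨
    ∑ (suc m) (λ i → ∑ n λ j → 𝟙 (P? (g i , h j))) ∎
    where
    open ≡-Reasoning
    rest = cartesianProduct (applyUpTo (g ∘ suc) m) (applyUpTo h n)

  tabulate-applyUpTo : ∀ {A : Set} n (f : Fin n → A) g → (∀ i → f i ≡ g (toℕ i)) → tabulate f ≡ applyUpTo g n
  tabulate-applyUpTo zero    f g eq = refl
  tabulate-applyUpTo (suc n) f g eq = cong₂ _∷_ (eq zero) (tabulate-applyUpTo n (f ∘ suc) (g ∘ suc) (eq ∘ suc))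

  module Unrolled (n : ℕ) .{{_ : NonZero n}} where

    node : ℕ → Fin n
    node x = x mod n

    toℕ-node : ∀ x → toℕ (node x) ≡ x % n
    toℕ-node x = Fin.toℕ-fromℕ< (m%n<n x n)

    node-cong : ∀ {x y} → x % n ≡ y % n → node x ≡ node y
    node-cong {x} {y} eq = Fin.toℕ-injective (trans (toℕ-node x) (trans eq (sym (toℕ-node y))))

    node-% : ∀ {x y} → node x ≡ node y → x % n ≡ y % n
    node-% {x} {y} eq = trans (sym (toℕ-node x)) (trans (cong toℕ eq) (toℕ-node y))

    node-toℕ : ∀ u → node (toℕ u) ≡ u
    node-toℕ u = Fin.toℕ-injective (trans (toℕ-node (toℕ u)) (m<n⇒m%n≡m (Fin.toℕ<n u)))

    toℕ-node-< : ∀ {x} → x ℕ.< n → toℕ (node x) ≡ x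
    toℕ-node-< {x} x<n = trans (toℕ-node x) (m<n⇒m%n≡m x<n)

    node-+n : ∀ x → node (x ℕ.+ n) ≡ node x
    node-+n x = node-cong ([m+n]%n≡m%n x n)

    node-+ : ∀ {x y} d → node x ≡ node y → node (x ℕ.+ d) ≡ node (y ℕ.+ d)
    node-+ {x} {y} d eq = node-cong (begin
      (x ℕ.+ d) % n            ≡⟨ %-distribˡ-+ x d n ⟩
      (x % n ℕ.+ d % n) % n    ≡⟨ cong (λ r → (r ℕ.+ d % n) % n) (node-% eq) ⟩
      (y % n ℕ.+ d % n) % n    ≡⟨ %-distribˡ-+ y d n ⟨
      (y ℕ.+ d) % n            ∎)
      where open ≡-Reasoning

    node-suc : ∀ {x y} → node x ≡ node y → node (suc x) ≡ node (suc y)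
    node-suc {x} {y} eq = subst₂ (λ a b → node a ≡ node b) (ℕ.+-comm x 1) (ℕ.+-comm y 1) (node-+ 1 eq)

    node-pred : ∀ {x y} → node (suc x) ≡ node (suc y) → node x ≡ node y
    node-pred {x} {y} eq = begin
      node x                       ≡⟨ node-+n x ⟨
      node (x ℕ.+ n)               ≡⟨ cong node (wrap x) ⟨
      node (suc x ℕ.+ ℕ.pred n)    ≡⟨ node-+ (ℕ.pred n) eq ⟩
      node (suc y ℕ.+ ℕ.pred n)    ≡⟨ cong node (wrap y) ⟩
      node (y ℕ.+ n)               ≡⟨ node-+n y ⟩
      node y                       ∎
      where
      open ≡-Reasoning
      wrap : ∀ z → suc z ℕ.+ ℕ.pred n ≡ z ℕ.+ n
      wrap z = trans (sym (ℕ.+-suc z (ℕ.pred n))) (cong (z ℕ.+_) (ℕ.suc-pred n))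

    node-next : ∀ {u v} x → Next u v → node x ≡ u → node (suc x) ≡ v
    node-next {u} {v} x next refl = Fin.toℕ-injective (trans (toℕ-node (suc x)) (lemma next))
      where
      reduce : suc x % n ≡ suc (toℕ (node x)) % n
      reduce = node-% (node-suc (sym (node-toℕ (node x))))
      lemma : Next (node x) v → suc x % n ≡ toℕ v
      lemma (inj₁ eq)          = trans reduce (trans (cong (_% n) (sym eq)) (m<n⇒m%n≡m (Fin.toℕ<n v)))
      lemma (inj₂ (eq , eq′)) = trans reduce (trans (%-congˡ eq) (trans (n%n≡0 n) (sym eq′)))

    -- A walk in the cycle lifts step by step to the positions above it; `k ≤ x` leaves room for k
    -- steps to the left.
    walk-lift : ∀ k {u v} x → DistanceAtMost (Cycle n) k u v → node x ≡ u → k ℕ.≤ x →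
                ∃[ y ] node y ≡ v × x ℕ.≤ y ℕ.+ k × y ℕ.≤ x ℕ.+ k
    walk-lift zero    x refl xu _ = x , xu , ℕ.m≤m+n x 0 , ℕ.m≤m+n x 0
    walk-lift (suc k) x (inj₁ d) xu k<x with walk-lift k x d xu (ℕ.<⇒≤ k<x)
    ... | y , yv , x≤ , y≤ = y , yv , ℕ.≤-trans x≤ (ℕ.+-monoʳ-≤ y (ℕ.n≤1+n k)) ,
                                       ℕ.≤-trans y≤ (ℕ.+-monoʳ-≤ x (ℕ.n≤1+n k))
    walk-lift (suc k) x (inj₂ (w , d , _ , step)) xu k<x with walk-lift k x d xu (ℕ.<⇒≤ k<x) | step
    ... | y , yw , x≤ , y≤ | inj₁ next =
      suc y , node-next y next yw , ℕ.≤-trans x≤ (ℕ.+-mono-≤ (ℕ.n≤1+n y) (ℕ.n≤1+n k)) ,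
      ℕ.≤-trans (s≤s y≤) (ℕ.≤-reflexive (sym (ℕ.+-suc x k)))
    ... | zero , yw , x≤ , y≤ | inj₂ next = ⊥-elim (ℕ.<-irrefl refl (ℕ.<-≤-trans k<x x≤))
    ... | suc y , yw , x≤ , y≤ | inj₂ next =
      y , trans (node-pred (trans yw (sym (node-next _ next (node-toℕ _))))) (node-toℕ _) ,
      ℕ.≤-trans x≤ (ℕ.≤-reflexive (sym (ℕ.+-suc y k))) ,
      ℕ.≤-trans (ℕ.n≤1+n y) (ℕ.≤-trans y≤ (ℕ.+-monoʳ-≤ x (ℕ.n≤1+n k)))

    -- Only walks that do not cross the seam between `n - 1` and 0 are built; the lower bounds on
    -- edge numbers can spare the others.
    walk : ∀ k d x → d ℕ.≤ k → x ℕ.+ d ℕ.< n → DistanceAtMost (Cycle n) k (node x) (node (x ℕ.+ d))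
    walk zero    zero    x _ _ = cong node (sym (ℕ.+-identityʳ x))
    walk (suc k) d       x d≤ x+d<n with ℕ.m≤n⇒m<n∨m≡n d≤
    ... | inj₁ (s≤s d≤k) = inj₁ (walk k d x d≤k x+d<n)
    ... | inj₂ refl      = inj₂ (node (x ℕ.+ k) , walk k k x ℕ.≤-refl x+k<n ,
            (λ eq → ℕ.1+n≢n (trans (sym succ) (cong toℕ (sym eq)) ∙ toℕ-node-< x+k<n)) ,
            inj₁ (inj₁ (trans succ (cong suc (sym (toℕ-node-< x+k<n))))))
      where
      _∙_ = trans
      succ : toℕ (node (x ℕ.+ suc k)) ≡ suc (x ℕ.+ k)
      succ = trans (toℕ-node-< x+d<n) (ℕ.+-suc x k)
      x+k<n : x ℕ.+ k ℕ.< n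
      x+k<n = ℕ.<⇒≤ (subst (ℕ._< n) (ℕ.+-suc x k) x+d<n)

    power-adj : ∀ k d x → 0 ℕ.< d → d ℕ.≤ k → x ℕ.+ d ℕ.< n →
                Adj (CyclePower n k) (node x) (node (x ℕ.+ d))
    power-adj k d x 0<d d≤k x+d<n = (λ eq → ℕ.<⇒≢ 0<d (sym (ℕ.+-cancelˡ-≡ x d 0
        (trans (sym (toℕ-node-< x+d<n)) (trans (cong toℕ (sym eq))
        (trans (toℕ-node-< (ℕ.≤-<-trans (ℕ.m≤m+n x d) x+d<n)) (sym (ℕ.+-identityʳ x)))))))) ,
      walk k d x d≤k x+d<n

    allFin-applyUpTo : allFin n ≡ applyUpTo node n
    allFin-applyUpTo = tabulate-applyUpTo n id node (λ i → sym (node-toℕ i))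

    module _ (G : Graph n) where

      adj : ℕ → ℕ → ℤ
      adj x y = 𝟙 (adj? G (node x) (node y))

      adj-comm : ∀ x y → adj x y ≡ adj y x
      adj-comm x y = 𝟙-cong (adj? G _ _) (adj? G _ _) (adj-sym G) (adj-sym G)

      adj-cong : ∀ {x x′ y y′} → node x ≡ node x′ → node y ≡ node y′ → adj x y ≡ adj x′ y′
      adj-cong p q = cong₂ (λ u v → 𝟙 (adj? G u v)) p q

      0≤adj : ∀ x y → 0ℤ ≤ adj x y
      0≤adj x y = 0≤𝟙 (adj? G _ _)

      adj-self : ∀ x → adj x x ≡ 0ℤ
      adj-self x = 𝟙-no (adj? G _ _) (irrefl G refl)

      e-∑ : + e G ≡ ∑ n λ x → ∑ n λ y → 𝟙 (edge? G (node x , node y))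
      e-∑ = trans (cong (λ xs → + length (filter (edge? G) (cartesianProduct xs xs))) allFin-applyUpTo)
                  (length-filter-cartesianProduct (edge? G) node node n n)

      degree-∑ : ∀ x → + degree G (node x) ≡ ∑ n (adj x)
      degree-∑ x = trans (cong (λ xs → + length (filter (adj? G (node x)) xs)) allFin-applyUpTo)
                         (length-filter-applyUpTo (adj? G (node x)) node n)

      -- An edge is listed only with its smaller end first, so the two orders of a pair never count
      -- together.
      2e≤∑degree : + 2 * + e G ≤ ∑ n λ x → ∑ n (adj x)
      2e≤∑degree = begin
        + 2 * + e G
          ≡⟨ cong (+ 2 *_) e-∑ ⟩
        + 2 * ∑ n (λ x → ∑ n (E x))
          ≡⟨ double (∑ n λ x → ∑ n (E x)) ⟩
        ∑ n (λ x → ∑ n (E x)) + ∑ n (λ x → ∑ n (E x))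
          ≡⟨ cong (λ r → ∑ n (λ x → ∑ n (E x)) + r) (∑-swap n n E) ⟩
        ∑ n (λ x → ∑ n (E x)) + ∑ n (λ x → ∑ n λ y → E y x)
          ≡⟨ ∑-+ n _ _ ⟨
        ∑ n (λ x → ∑ n (E x) + ∑ n λ y → E y x)
          ≡⟨ ∑-cong′ n (λ x → sym (∑-+ n _ _)) ⟩
        ∑ n (λ x → ∑ n λ y → E x y + E y x)
          ≤⟨ ∑-mono n (λ x _ → ∑-mono n λ y _ → one-way x y) ⟩
        ∑ n (λ x → ∑ n (adj x)) ∎
        where
        open ℤ.≤-Reasoning
        E : ℕ → ℕ → ℤ
        E x y = 𝟙 (edge? G (node x , node y))
        double : ∀ a → + 2 * a ≡ a + a
        double = solve-∀
        one-way : ∀ x y → E x y + E y x ≤ adj x y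
        one-way x y with edge? G (node x , node y) | edge? G (node y , node x)
        ... | no _           | no _           = 0≤adj x y
        ... | yes (_ , a)    | no _           = ℤ.≤-reflexive (sym (𝟙-yes (adj? G _ _) a))
        ... | no _           | yes (_ , a)    = ℤ.≤-reflexive (sym (𝟙-yes (adj? G _ _) (adj-sym G a)))
        ... | yes (x<y , _)  | yes (y<x , _)  = ⊥-elim (ℕ.<-asym x<y y<x)

      -- A neighbour of `x + k` lifts to a position within distance k, that is to some `x + i` with
      -- `i ≤ 2k`. The pairs (i , y) with `x + i` above `y` are counted in both ways, and each `i`
      -- lies above one vertex only. For `n ≤ 2k` the window repeats vertices, hence an inequality.
      degree-local : ∀ k → (∀ u v → Adj G u v → Adj (CyclePower n k) u v) →
        ∀ x → ∑ n (adj (x ℕ.+ k)) ≤ ∑ (suc (k ℕ.+ k)) (λ i → adj (x ℕ.+ k) (x ℕ.+ i))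
      degree-local k sub x = begin
        ∑ n (adj c)
          ≤⟨ ∑-mono n (λ y _ → locate y) ⟩
        ∑ n (λ y → ∑ w λ i → hit i y * adj c (x ℕ.+ i))
          ≡⟨ ∑-swap n w _ ⟩
        ∑ w (λ i → ∑ n λ y → hit i y * adj c (x ℕ.+ i))
          ≡⟨ ∑-cong′ w (λ i → ∑-*ʳ n (adj c (x ℕ.+ i)) (hit i)) ⟩
        ∑ w (λ i → ∑ n (hit i) * adj c (x ℕ.+ i))
          ≤⟨ ∑-mono w (λ i _ → ℤ.*-monoʳ-≤-nonNeg (adj c (x ℕ.+ i)) {{ℤ.nonNegative (0≤adj c _)}}
               (∑-unique≤1 n (λ y → node (x ℕ.+ i) Fin.≟ node y) λ y y′ y<n y′<n p q →
                 trans (sym (toℕ-node-< y<n)) (trans (cong toℕ (trans (sym p) q)) (toℕ-node-< y′<n)))) ⟩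
        ∑ w (λ i → 1ℤ * adj c (x ℕ.+ i))
          ≡⟨ ∑-cong′ w (λ i → ℤ.*-identityˡ _) ⟩
        ∑ w (λ i → adj c (x ℕ.+ i)) ∎
        where
        open ℤ.≤-Reasoning
        c = x ℕ.+ k
        w = suc (k ℕ.+ k)
        hit : ℕ → ℕ → ℤ
        hit i y = 𝟙 (node (x ℕ.+ i) Fin.≟ node y)
        locate : ∀ y → adj c y ≤ ∑ w (λ i → hit i y * adj c (x ℕ.+ i))
        locate y with adj? G (node c) (node y)
        ... | no _  = 0≤∑ w λ i _ → 0≤𝟙 (node (x ℕ.+ i) Fin.≟ node y) ⊛ 0≤adj c _
        ... | yes a with walk-lift k c (proj₂ (sub _ _ a)) refl (ℕ.m≤n+m k x)
        ...   | z , zy , c≤ , z≤ with ℕ.m≤n⇒∃[o]m+o≡n (ℕ.+-cancelʳ-≤ k x z c≤)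
        ...     | i , refl = ℤ.≤-trans
          (ℤ.≤-reflexive (sym (cong₂ _*_ (𝟙-yes (node (x ℕ.+ i) Fin.≟ node y) zy)
            (𝟙-yes (adj? G _ _) (subst (Adj G (node c)) (sym zy) a)))))
          (∑-term w {λ i → hit i y * adj c (x ℕ.+ i)}
            (λ i → 0≤𝟙 (node (x ℕ.+ i) Fin.≟ node y) ⊛ 0≤adj c _)
            (s≤s (ℕ.+-cancelˡ-≤ x i (k ℕ.+ k) (ℕ.≤-trans z≤ (ℕ.≤-reflexive (ℕ.+-assoc x k k))))))

  -- Transport of a subgraph to the vertices of its host

  image : ∀ {m n} → Graph m → (Fin m → Fin n) → Graph n
  image H f .Adj x y = ∃[ u ] ∃[ v ] f u ≡ x × f v ≡ y × Adj H u v × x ≢ y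
  image H f .adj? x y = Fin.any? λ u → Fin.any? λ v →
    (f u Fin.≟ x) ×-dec ((f v Fin.≟ y) ×-dec (adj? H u v ×-dec ¬? (x Fin.≟ y)))
  image H f .adj-sym (u , v , p , q , a , ne) = v , u , q , p , adj-sym H a , ne ∘ sym
  image H f .irrefl eq (_ , _ , _ , _ , _ , ne) = ne eq

  module _ {m n : ℕ} .{{_ : NonZero m}} .{{_ : NonZero n}} (H : Graph m)
           (f : Fin m → Fin n) (f-inj : Injective _≡_ _≡_ f) where
    private
      module H = Unrolled m
      module G = Unrolled n
      φ : ℕ → ℕ
      φ u = toℕ (f (H.node u))
      φ-node : ∀ u → G.node (φ u) ≡ f (H.node u)
      φ-node u = G.node-toℕ (f (H.node u))
      φ<n : ∀ u → u ℕ.< m → φ u ℕ.< n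
      φ<n u _ = Fin.toℕ<n (f (H.node u))
      φ-inj : ∀ u v → u ℕ.< m → v ℕ.< m → φ u ≡ φ v → u ≡ v
      φ-inj u v u<m v<m eq = trans (sym (H.toℕ-node-< u<m))
        (trans (cong toℕ (f-inj (Fin.toℕ-injective eq))) (H.toℕ-node-< v<m))

    image-adj : ∀ u v → Adj H u v → Adj (image H f) (f u) (f v)
    image-adj u v a = u , v , refl , refl , a , λ eq → irrefl H (f-inj eq) a

    degree-image : ∀ u → ∑ m (H.adj H u) ≤ ∑ n (G.adj (image H f) (φ u))
    degree-image u = ℤ.≤-trans
      (∑-mono m λ v _ → 𝟙-mono (adj? H _ _) (adj? (image H f) _ _) λ a →
        subst₂ (Adj (image H f)) (sym (φ-node u)) (sym (φ-node v)) (image-adj _ _ a))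
      (∑-inject m n φ φ<n φ-inj (G.0≤adj (image H f) (φ u)))

    2e≤∑degree-image : + 2 * + e H ≤ ∑ n λ x → ∑ n (G.adj (image H f) x)
    2e≤∑degree-image = ℤ.≤-trans (H.2e≤∑degree H) (ℤ.≤-trans
      (∑-mono m λ u _ → degree-image u)
      (∑-inject m n φ φ<n φ-inj {λ x → ∑ n (G.adj (image H f) x)}
        (λ x → 0≤∑ n λ y _ → G.0≤adj (image H f) x y)))

  -- Every vertex of a clique on at least two vertices lies on an edge, and an edge of `image H f`
  -- comes with preimages of its ends; so the clique avoids the vertices outside the range of `f`.
  K-image : ∀ {m n s} (H : Graph m) (f : Fin m → Fin n) → Injective _≡_ _≡_ f →
            K (suc (suc s)) ⊑ image H f → K (suc (suc s)) ⊑ H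
  K-image {m} {n} {s} H f f-inj (h , h-inj , h-hom) = pre , pre-inj , pre-hom
    where
    other : ∀ i → Σ[ j ∈ Fin (suc (suc s)) ] i ≢ j
    other zero    = suc zero , λ ()
    other (suc i) = zero , λ ()
    pre : Fin (suc (suc s)) → Fin m
    pre i = proj₁ (h-hom i (proj₁ (other i)) (proj₂ (other i)))
    f-pre : ∀ i → f (pre i) ≡ h i
    f-pre i = proj₁ (proj₂ (proj₂ (h-hom i (proj₁ (other i)) (proj₂ (other i)))))
    pre-inj : Injective _≡_ _≡_ pre
    pre-inj {i} {j} eq = h-inj (trans (sym (f-pre i)) (trans (cong f eq) (f-pre j)))
    pre-hom : ∀ i j → i ≢ j → Adj H (pre i) (pre j)
    pre-hom i j i≢j with h-hom i j i≢j
    ... | u , v , p , q , a , _ = subst₂ (Adj H) (f-inj (trans p (sym (f-pre i))))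
                                                 (f-inj (trans q (sym (f-pre j)))) a

  -- Triangle-free graphs

  clique-⊑ : ∀ {n t} (G : Graph n) (h : Fin t → Fin n) →
             (∀ i j → i ≢ j → Adj G (h i) (h j)) → K t ⊑ G
  clique-⊑ G h clique = h , inj , clique
    where
    inj : ∀ {i j} → h i ≡ h j → i ≡ j
    inj {i} {j} eq with i Fin.≟ j
    ... | yes i≡j = i≡j
    ... | no  i≢j = ⊥-elim (irrefl G eq (clique i j i≢j))

  triangle-⊑ : ∀ {n} (G : Graph n) {u v w} → Adj G u v → Adj G v w → Adj G u w → K 3 ⊑ G
  triangle-⊑ {n} G {u} {v} {w} uv vw uw = clique-⊑ G h clique
    where
    h : Fin 3 → Fin n
    h zero             = u
    h (suc zero)       = v
    h (suc (suc zero)) = w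
    clique : ∀ i j → i ≢ j → Adj G (h i) (h j)
    clique zero             zero             ne = ⊥-elim (ne refl)
    clique zero             (suc zero)       ne = uv
    clique zero             (suc (suc zero)) ne = uw
    clique (suc zero)       zero             ne = adj-sym G uv
    clique (suc zero)       (suc zero)       ne = ⊥-elim (ne refl)
    clique (suc zero)       (suc (suc zero)) ne = vw
    clique (suc (suc zero)) zero             ne = adj-sym G uw
    clique (suc (suc zero)) (suc zero)       ne = adj-sym G vw
    clique (suc (suc zero)) (suc (suc zero)) ne = ⊥-elim (ne refl)

  module _ (n k : ℕ) .{{_ : NonZero n}} where

    private
      ∑∑ : (ℕ → ℕ → ℤ) → ℤ
      ∑∑ Φ = ∑ k λ q → ∑ q λ p → Φ p q

      ∑∑-cong : ∀ {Φ Ψ : ℕ → ℕ → ℤ} → (∀ p q → p ℕ.< q → q ℕ.< k → Φ p q ≡ Ψ p q) → ∑∑ Φ ≡ ∑∑ Ψ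
      ∑∑-cong eq = ∑-cong k λ q q<k → ∑-cong q λ p p<q → eq p q p<q q<k

      ∑∑-out : (F : ℕ → ℕ → ℕ → ℤ) → ∑ n (λ x → ∑∑ (F x)) ≡ ∑∑ λ p q → ∑ n λ x → F x p q
      ∑∑-out F = trans (∑-swap n k _) (∑-cong′ k λ q → ∑-swap n q _)

      ∸-flip : ∀ {q} → q ℕ.< k → k ∸ suc (k ∸ suc q) ≡ q
      ∸-flip {q} q<k = ℕ.suc-injective (trans (sym (ℕ.+-∸-assoc 1 (ℕ.≤-trans (ℕ.≤-reflexive (sym (ℕ.+-∸-assoc 1 q<k))) (ℕ.m∸n≤m k q)))) (ℕ.m∸[m∸n]≡n q<k))

      suc-∸ : ∀ {q} → q ℕ.< k → suc (k ∸ suc q) ≡ k ∸ q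
      suc-∸ q<k = sym (ℕ.+-∸-assoc 1 q<k)

    -- Both rotate the composition (p + 1 , q − p , k − q) of k + 1; the first two parts are
    -- the gaps of a triple spanning at most k.
    ∑∑-rotate : ∀ (Φ : ℕ → ℕ → ℤ) →
      ∑∑ (λ p q → Φ (suc p) (suc q)) ≡ ∑∑ (λ p q → Φ (k ∸ q) (k ∸ q ℕ.+ suc p))
    ∑∑-rotate Φ = begin
      ∑∑ (λ p q → Φ (suc p) (suc q))
        ≡⟨ ∑-triangle k (λ p q → Φ (suc p) (suc q)) ⟩
      ∑ k (λ p → ∑ (k ∸ suc p) λ j → Φ (suc p) (suc (suc (p ℕ.+ j))))
        ≡⟨ ∑-rev k _ ⟩
      ∑ k (λ q → ∑ (k ∸ suc (k ∸ suc q)) λ j → Φ (suc (k ∸ suc q)) (suc (suc (k ∸ suc q ℕ.+ j))))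
        ≡⟨ ∑-cong k (λ q q<k → trans
             (cong₂ (λ a b → ∑ a λ j → Φ b (suc (b ℕ.+ j))) (∸-flip q<k) (suc-∸ q<k))
             (∑-cong′ q λ j → cong (Φ (k ∸ q)) (sym (ℕ.+-suc (k ∸ q) j)))) ⟩
      ∑∑ (λ p q → Φ (k ∸ q) (k ∸ q ℕ.+ suc p)) ∎
      where open ≡-Reasoning

    ∑∑-rotate′ : ∀ (Φ : ℕ → ℕ → ℤ) →
      ∑∑ (λ p q → Φ (suc p) (suc q)) ≡ ∑∑ (λ p q → Φ (q ∸ p) (k ∸ p))
    ∑∑-rotate′ Φ = sym (begin
      ∑∑ (λ p q → Φ (q ∸ p) (k ∸ p))
        ≡⟨ ∑-triangle k (λ p q → Φ (q ∸ p) (k ∸ p)) ⟩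
      ∑ k (λ p → ∑ (k ∸ suc p) λ j → Φ (suc (p ℕ.+ j) ∸ p) (k ∸ p))
        ≡⟨ ∑-cong′ k (λ p → ∑-cong′ (k ∸ suc p) λ j → cong (λ a → Φ a (k ∸ p))
             (trans (cong (_∸ p) (sym (ℕ.+-suc p j))) (ℕ.m+n∸m≡n p (suc j)))) ⟩
      ∑ k (λ p → ∑ (k ∸ suc p) λ j → Φ (suc j) (k ∸ p))
        ≡⟨ ∑-rev k _ ⟩
      ∑ k (λ q → ∑ (k ∸ suc (k ∸ suc q)) λ j → Φ (suc j) (k ∸ (k ∸ suc q)))
        ≡⟨ ∑-cong k (λ q q<k → cong₂ (λ a b → ∑ a λ j → Φ (suc j) b) (∸-flip q<k) (ℕ.m∸[m∸n]≡n q<k)) ⟩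
      ∑∑ (λ p q → Φ (suc p) (suc q)) ∎)
      where open ≡-Reasoning

    module _ (F : ℕ → ℕ → ℕ → ℤ) (F-per : ∀ x y z → F (x ℕ.+ n) (y ℕ.+ n) (z ℕ.+ n) ≡ F x y z) where
      private
        Φ : ℕ → ℕ → ℤ
        Φ i j = ∑ n λ x → F x (x ℕ.+ i) (x ℕ.+ j)

        Φ-shift : ∀ d i j → ∑ n (λ x → F (x ℕ.+ d) (x ℕ.+ d ℕ.+ i) (x ℕ.+ d ℕ.+ j)) ≡ Φ i j
        Φ-shift d i j = ∑-shift n {λ x → F x (x ℕ.+ i) (x ℕ.+ j)}
          (λ x → trans (cong₂ (F (x ℕ.+ n)) (slide x n i) (slide x n j)) (F-per x (x ℕ.+ i) (x ℕ.+ j))) d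
          where
          slide : ∀ a b c → a ℕ.+ b ℕ.+ c ≡ a ℕ.+ c ℕ.+ b
          slide a b c = trans (ℕ.+-assoc a b c) (trans (cong (a ℕ.+_) (ℕ.+-comm b c)) (sym (ℕ.+-assoc a c b)))

        canonical : ∑∑ (λ p q → Φ (suc p) (suc q)) ≡ ∑ n λ x → ∑∑ λ p q → F x (x ℕ.+ suc p) (x ℕ.+ suc q)
        canonical = sym (∑∑-out λ x p q → F x (x ℕ.+ suc p) (x ℕ.+ suc q))

      -- In a sum over all `x` a triple may be anchored anywhere. This and the next two put its
      -- first, middle or last vertex at `x + k`, so that products of two edges sharing that vertex
      -- become products of values of `α` and `β` for the same `x`.
      triples-first : (∑ n λ x → ∑∑ λ p q → F x (x ℕ.+ suc p) (x ℕ.+ suc q)) ≡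
                      (∑ n λ x → ∑∑ λ p q → F (x ℕ.+ k) (x ℕ.+ k ℕ.+ suc p) (x ℕ.+ k ℕ.+ suc q))
      triples-first = trans (sym canonical) (trans
        (∑∑-cong λ p q _ _ → sym (Φ-shift k (suc p) (suc q))) (sym (∑∑-out _)))

      -- The outer positions `x + q` and `x + k + suc p` are at most k apart exactly when `p < q`,
      -- so the pairs `p < q` again run over all triples spanning at most k.
      triples-middle : (∑ n λ x → ∑∑ λ p q → F x (x ℕ.+ suc p) (x ℕ.+ suc q)) ≡
                       (∑ n λ x → ∑∑ λ p q → F (x ℕ.+ q) (x ℕ.+ k) (x ℕ.+ k ℕ.+ suc p))
      triples-middle = trans (sym canonical) (trans (∑∑-rotate Φ) (trans
        (∑∑-cong λ p q _ q<k → trans (sym (Φ-shift q (k ∸ q) (k ∸ q ℕ.+ suc p)))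
          (∑-cong′ n λ x → cong₂ (F (x ℕ.+ q)) (reach x q q<k)
            (trans (sym (ℕ.+-assoc (x ℕ.+ q) (k ∸ q) (suc p))) (cong (ℕ._+ suc p) (reach x q q<k)))))
        (sym (∑∑-out _))))
        where
        reach : ∀ x q → q ℕ.< k → x ℕ.+ q ℕ.+ (k ∸ q) ≡ x ℕ.+ k
        reach x q q<k = trans (ℕ.+-assoc x q (k ∸ q)) (cong (x ℕ.+_) (ℕ.m+[n∸m]≡n (ℕ.<⇒≤ q<k)))

      triples-last : (∑ n λ x → ∑∑ λ p q → F x (x ℕ.+ suc p) (x ℕ.+ suc q)) ≡
                     (∑ n λ x → ∑∑ λ p q → F (x ℕ.+ p) (x ℕ.+ q) (x ℕ.+ k))
      triples-last = trans (sym canonical) (trans (∑∑-rotate′ Φ) (trans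
        (∑∑-cong λ p q p<q q<k → trans (sym (Φ-shift p (q ∸ p) (k ∸ p)))
          (∑-cong′ n λ x → cong₂ (F (x ℕ.+ p)) (reach x (ℕ.<⇒≤ p<q))
            (reach x (ℕ.<⇒≤ (ℕ.<-trans p<q q<k)))))
        (sym (∑∑-out _))))
        where
        reach : ∀ x {p q} → p ℕ.≤ q → x ℕ.+ p ℕ.+ (q ∸ p) ≡ x ℕ.+ q
        reach x {p} {q} p≤q = trans (ℕ.+-assoc x p (q ∸ p)) (cong (x ℕ.+_) (ℕ.m+[n∸m]≡n p≤q))

    module _ (G : Graph n) (sub : ∀ u v → Adj G u v → Adj (CyclePower n k) u v) (K₃⋢G : ¬ (K 3 ⊑ G)) where
      open Unrolled n

      private
        A : ℕ → ℕ → ℤ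
        A = adj G

        A-per : ∀ x y → A (x ℕ.+ n) (y ℕ.+ n) ≡ A x y
        A-per x y = adj-cong G (node-+n x) (node-+n y)

        -- When the window from `x + s` to `x + s + k` moves by one, it takes in `x + k + suc s` and
        -- drops `x + s`; the vertex `x + k` stays inside for all k moves.
        α β : ℕ → ℕ → ℤ
        α x s = A (x ℕ.+ k) (x ℕ.+ k ℕ.+ suc s)
        β x s = A (x ℕ.+ k) (x ℕ.+ s)

        F₁ F₂ F₃ : ℕ → ℕ → ℕ → ℤ
        F₁ x y z = A x z - + 5 * (A x y * A x z)
        F₂ x y z = + 3 * A x y + + 3 * A y z - + 6 * (A x y * A y z)
        F₃ x y z = A x z - + 5 * (A x z * A y z)

        -- In a triangle-free graph xy ≥ xy·yz + xy·xz, and likewise for yz and xz; these are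
        -- added with weights 3, 3, 2 and the terms grouped by the common vertex of the two edges.
        triple : ∀ x y z → 0ℤ ≤ F₁ x y z + F₂ x y z + F₃ x y z
        triple x y z with adj? G (node x) (node y) | adj? G (node y) (node z) | adj? G (node x) (node z)
        ... | yes xy | yes yz | yes xz = ⊥-elim (K₃⋢G (triangle-⊑ G xy yz xz))
        ... | yes _  | yes _  | no _   = 0≤+n
        ... | yes _  | no _   | yes _  = 0≤+n
        ... | yes _  | no _   | no _   = 0≤+n
        ... | no _   | yes _  | yes _  = 0≤+n
        ... | no _   | yes _  | no _   = 0≤+n
        ... | no _   | no _   | yes _  = 0≤+n
        ... | no _   | no _   | no _   = 0≤+n

        ∑∑-+ : ∀ (Φ Ψ : ℕ → ℕ → ℤ) → ∑∑ (λ p q → Φ p q + Ψ p q) ≡ ∑∑ Φ + ∑∑ Ψ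
        ∑∑-+ Φ Ψ = trans (∑-cong′ k λ q → ∑-+ q _ _) (∑-+ k _ _)

        split₃ : ∀ (H₁ H₂ H₃ : ℕ → ℕ → ℕ → ℤ) →
          (∑ n λ x → ∑∑ λ p q → H₁ x p q + H₂ x p q + H₃ x p q) ≡
          (∑ n λ x → ∑∑ (H₁ x)) + (∑ n λ x → ∑∑ (H₂ x)) + (∑ n λ x → ∑∑ (H₃ x))
        split₃ H₁ H₂ H₃ = trans
          (∑-cong′ n λ x → trans (∑∑-+ _ (H₃ x)) (cong (_+ ∑∑ (H₃ x)) (∑∑-+ (H₁ x) (H₂ x))))
          (trans (∑-+ n _ _) (cong (_+ (∑ n λ x → ∑∑ (H₃ x))) (∑-+ n _ _)))

        0≤cells : 0ℤ ≤ ∑ n λ x → cells (α x) (β x) k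
        0≤cells = begin
          0ℤ
            ≤⟨ 0≤∑ n (λ x _ → 0≤∑ k λ q _ → 0≤∑ q λ p _ → triple x (x ℕ.+ suc p) (x ℕ.+ suc q)) ⟩
          (∑ n λ x → ∑∑ λ p q → at F₁ x p q + at F₂ x p q + at F₃ x p q)
            ≡⟨ split₃ (at F₁) (at F₂) (at F₃) ⟩
          (∑ n λ x → ∑∑ (at F₁ x)) + (∑ n λ x → ∑∑ (at F₂ x)) + (∑ n λ x → ∑∑ (at F₃ x))
            ≡⟨ cong₂ _+_ (cong₂ _+_
                 (triples-first F₁ λ x y z → cong₂ (λ a b → b - + 5 * (a * b)) (A-per x y) (A-per x z))
                 (triples-middle F₂ λ x y z → cong₂ (λ a b → + 3 * a + + 3 * b - + 6 * (a * b)) (A-per x y) (A-per y z)))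
                 (triples-last F₃ λ x y z → cong₂ (λ a b → a - + 5 * (a * b)) (A-per x z) (A-per y z)) ⟩
          (∑ n λ x → ∑∑ (first x)) + (∑ n λ x → ∑∑ (middle x)) + (∑ n λ x → ∑∑ (last x))
            ≡⟨ split₃ first middle last ⟨
          (∑ n λ x → ∑∑ λ p q → first x p q + middle x p q + last x p q)
            ≡⟨ ∑-cong′ n (λ x → ∑∑-cong λ p q _ _ → regroup x p q) ⟩
          (∑ n λ x → cells (α x) (β x) k) ∎
          where
          open ℤ.≤-Reasoning
          at : (ℕ → ℕ → ℕ → ℤ) → ℕ → ℕ → ℕ → ℤ
          at F x p q = F x (x ℕ.+ suc p) (x ℕ.+ suc q)
          first middle last : ℕ → ℕ → ℕ → ℤ
          first  x p q = F₁ (x ℕ.+ k) (x ℕ.+ k ℕ.+ suc p) (x ℕ.+ k ℕ.+ suc q)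
          middle x p q = F₂ (x ℕ.+ q) (x ℕ.+ k) (x ℕ.+ k ℕ.+ suc p)
          last   x p q = F₃ (x ℕ.+ p) (x ℕ.+ q) (x ℕ.+ k)
          identity : ∀ a a′ b b′ →
            (a′ - + 5 * (a * a′)) + (+ 3 * b′ + + 3 * a - + 6 * (b′ * a)) + (b - + 5 * (b * b′)) ≡
            + 3 * a + + 3 * b′ - + 6 * (a * b′) + b + a′ - + 5 * (b * b′) - + 5 * (a * a′)
          identity = solve-∀
          regroup : ∀ x p q → first x p q + middle x p q + last x p q ≡ cell (α x p) (β x p) (α x q) (β x q)
          regroup x p q = trans
            (cong₂ (λ b b′ → first x p q + (+ 3 * b′ + + 3 * α x p - + 6 * (b′ * α x p)) + (b - + 5 * (b * b′)))
                   (adj-comm G (x ℕ.+ p) (x ℕ.+ k)) (adj-comm G (x ℕ.+ q) (x ℕ.+ k)))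
            (identity (α x p) (α x q) (β x p) (β x q))

        degree≤ : ∀ x → ∑ n (A (x ℕ.+ k)) ≤ ∑ k (α x) + ∑ k (β x)
        degree≤ x = begin
          ∑ n (A c)
            ≤⟨ degree-local G k sub x ⟩
          ∑ (suc (k ℕ.+ k)) (λ i → A c (x ℕ.+ i))
            ≡⟨ cong (λ w → ∑ w λ i → A c (x ℕ.+ i)) (sym (ℕ.+-suc k k)) ⟩
          ∑ (k ℕ.+ suc k) (λ i → A c (x ℕ.+ i))
            ≡⟨ ∑-append k (suc k) (λ i → A c (x ℕ.+ i)) ⟩
          ∑ k (β x) + ∑ (suc k) (λ i → A c (x ℕ.+ (k ℕ.+ i)))
            ≡⟨ cong (λ s → ∑ k (β x) + s) (∑-cong′ (suc k) λ i → cong (A c) (sym (ℕ.+-assoc x k i))) ⟩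
          ∑ k (β x) + ∑ (suc k) (λ i → A c (c ℕ.+ i))
            ≡⟨ cong (λ s → ∑ k (β x) + s) (trans (∑-head k (λ i → A c (c ℕ.+ i)))
                 (cong (_+ ∑ k (α x)) (trans (cong (A c) (ℕ.+-identityʳ c)) (adj-self G c)))) ⟩
          ∑ k (β x) + (0ℤ + ∑ k (α x))
            ≡⟨ swap-+ (∑ k (β x)) (∑ k (α x)) ⟩
          ∑ k (α x) + ∑ k (β x) ∎
          where
          open ℤ.≤-Reasoning
          c = x ℕ.+ k
          swap-+ : ∀ b a → b + (0ℤ + a) ≡ a + b
          swap-+ = solve-∀

      triangle-free-degrees : + 10 * (+ k * ∑ n λ x → ∑ n (adj G x)) ≤ + n * (+ 12 * (+ k * + k) + + 20 * + k)
      triangle-free-degrees = begin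
        + 10 * (+ k * ∑ n λ x → ∑ n (A x))
          ≡⟨ cong (λ s → + 10 * (+ k * s)) (∑-shift n {λ x → ∑ n (A x)}
               (λ x → ∑-cong′ n λ y → adj-cong G (node-+n x) refl) k) ⟨
        + 10 * (+ k * ∑ n λ x → ∑ n (A (x ℕ.+ k)))
          ≤⟨ ℤ.*-monoˡ-≤-nonNeg (+ 10) (ℤ.*-monoˡ-≤-nonNeg (+ k) (∑-mono n λ x _ → degree≤ x)) ⟩
        + 10 * (+ k * ∑ n σ)
          ≤⟨ ≤-by (0≤+n {5} ⊛ 0≤cells) (ℤ.+-comm (+ 5 * ∑ n Q) (+ 10 * (+ k * ∑ n σ))) ⟩
        + 5 * ∑ n Q + + 10 * (+ k * ∑ n σ)
          ≡⟨ cong₂ _+_ (∑-* n (+ 5) Q) (trans (∑-* n (+ 10) _) (cong (+ 10 *_) (∑-* n (+ k) σ))) ⟨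
        ∑ n (λ x → + 5 * Q x) + ∑ n (λ x → + 10 * (+ k * σ x))
          ≡⟨ ∑-+ n _ _ ⟨
        ∑ n (λ x → + 5 * Q x + + 10 * (+ k * σ x))
          ≤⟨ ∑-mono n (λ x _ → cells-bound (α x) (β x) (λ s → 𝟙-bit (adj? G _ _)) (λ s → 𝟙-bit (adj? G _ _)) k) ⟩
        ∑ n (λ _ → + 12 * (+ k * + k) + + 20 * + k)
          ≡⟨ ∑-const n _ ⟩
        + n * (+ 12 * (+ k * + k) + + 20 * + k) ∎
        where
        open ℤ.≤-Reasoning
        Q σ : ℕ → ℤ
        Q x = cells (α x) (β x) k
        σ x = ∑ k (α x) + ∑ k (β x)

  -- Multipartite subgraphs

  ∑-blocks : ∀ N b f → ∑ (N ℕ.* b) f ≡ ∑ N λ q → ∑ b λ p → f (q ℕ.* b ℕ.+ p)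
  ∑-blocks zero    b f = refl
  ∑-blocks (suc N) b f = trans (cong (λ a → ∑ a f) (ℕ.+-comm b (N ℕ.* b)))
    (trans (∑-append (N ℕ.* b) b f) (cong (_+ ∑ b λ p → f (N ℕ.* b ℕ.+ p)) (∑-blocks N b f)))

  ∑-prefix : ∀ {m n f} → m ℕ.≤ n → (∀ i → 0ℤ ≤ f i) → ∑ m f ≤ ∑ n f
  ∑-prefix {m} {f = f} m≤n 0≤f with ℕ.m≤n⇒∃[o]m+o≡n m≤n
  ... | o , refl = ≤-by (0≤∑ o λ i _ → 0≤f (m ℕ.+ i)) (∑-append m o f)

  ∑-interval≥ : ∀ n c L {f} → c ℕ.+ L ℕ.≤ n → (∀ i → 0ℤ ≤ f i) →
                (∀ i → i ℕ.< L → f (c ℕ.+ i) ≡ 1ℤ) → + L ≤ ∑ n f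
  ∑-interval≥ n c L {f} c+L≤n 0≤f one = begin
    + L                                     ≡⟨ trans (∑-const L 1ℤ) (ℤ.*-identityʳ (+ L)) ⟨
    ∑ L (λ _ → 1ℤ)                          ≡⟨ ∑-cong L one ⟨
    ∑ L (λ i → f (c ℕ.+ i))                 ≤⟨ ≤-by (0≤∑ c λ i _ → 0≤f i) (ℤ.+-comm (∑ c f) _) ⟩
    ∑ c f + ∑ L (λ i → f (c ℕ.+ i))         ≡⟨ ∑-append c L f ⟨
    ∑ (c ℕ.+ L) f                           ≤⟨ ∑-prefix c+L≤n 0≤f ⟩
    ∑ n f                                   ∎
    where open ℤ.≤-Reasoning

  module _ (n : ℕ) .{{_ : NonZero n}} where
    open Unrolled n

    node-cancel : ∀ c {x y} → node (c ℕ.+ x) ≡ node (c ℕ.+ y) → node x ≡ node y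
    node-cancel zero    eq = eq
    node-cancel (suc c) eq = node-cancel c (node-pred eq)

    -- Only edges going right from a position below `M` are counted. By `M + k ≤ n` they end before
    -- the seam, so they are distinct and listed in this direction; the edges starting from `M` on
    -- are given up.
    edges≥ : ∀ (G : Graph n) M k → M ℕ.+ k ℕ.≤ n →
             ∑ M (λ x → ∑ k λ i → adj G x (x ℕ.+ suc i)) ≤ + e G
    edges≥ G M k M+k≤n = begin
      ∑ M (λ x → ∑ k λ i → adj G x (x ℕ.+ suc i))
        ≤⟨ ∑-mono M (λ x x<M → ∑-mono k λ i i<k → 𝟙-mono (adj? G _ _) (edge? G _) (forward x i x<M i<k)) ⟩
      ∑ M (λ x → ∑ k λ i → E x (x ℕ.+ suc i))
        ≤⟨ ∑-mono M (λ x x<M → ∑-inject k n (λ i → x ℕ.+ suc i) (λ i → in-range x i x<M)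
             (λ i j _ _ eq → ℕ.suc-injective (ℕ.+-cancelˡ-≡ x _ _ eq)) {E x} (λ y → 0≤𝟙 (edge? G _))) ⟩
      ∑ M (λ x → ∑ n (E x))
        ≤⟨ ∑-prefix (ℕ.≤-trans (ℕ.m≤m+n M k) M+k≤n) (λ x → 0≤∑ n λ y _ → 0≤𝟙 (edge? G _)) ⟩
      ∑ n (λ x → ∑ n (E x))
        ≡⟨ e-∑ G ⟨
      + e G ∎
      where
      open ℤ.≤-Reasoning
      E : ℕ → ℕ → ℤ
      E x y = 𝟙 (edge? G (node x , node y))
      in-range : ∀ x i → x ℕ.< M → i ℕ.< k → x ℕ.+ suc i ℕ.< n
      in-range x i x<M i<k = ℕ.<-≤-trans (ℕ.+-mono-<-≤ x<M i<k) M+k≤n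
      forward : ∀ x i → x ℕ.< M → i ℕ.< k → Adj G (node x) (node (x ℕ.+ suc i)) →
                Edge G (node x , node (x ℕ.+ suc i))
      forward x i x<M i<k a = subst₂ ℕ._<_
        (sym (toℕ-node-< (ℕ.<-≤-trans x<M (ℕ.≤-trans (ℕ.m≤m+n M k) M+k≤n))))
        (sym (toℕ-node-< (in-range x i x<M i<k))) (ℕ.m<m+n x (s≤s z≤n)) , a

    power-edges≥ : ∀ M k → M ℕ.+ k ℕ.≤ n → + M * + k ≤ + e (CyclePower n k)
    power-edges≥ M k M+k≤n = begin
      + M * + k
        ≡⟨ trans (∑-cong′ M λ x → trans (∑-const k 1ℤ) (ℤ.*-identityʳ (+ k))) (∑-const M (+ k)) ⟨
      ∑ M (λ x → ∑ k λ i → 1ℤ)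
        ≡⟨ ∑-cong M (λ x x<M → ∑-cong k λ i i<k → 𝟙-yes (adj? (CyclePower n k) _ _)
             (power-adj k (suc i) x (s≤s z≤n) i<k (ℕ.<-≤-trans (ℕ.+-mono-<-≤ x<M i<k) M+k≤n))) ⟨
      ∑ M (λ x → ∑ k λ i → adj (CyclePower n k) x (x ℕ.+ suc i))
        ≤⟨ edges≥ (CyclePower n k) M k M+k≤n ⟩
      + e (CyclePower n k) ∎
      where open ℤ.≤-Reasoning

    power-edges≤ : ∀ k → + e (CyclePower n k) ≤ + n * + k
    power-edges≤ k = ℤ.*-cancelˡ-≤-pos _ _ (+ 2) (begin
      + 2 * + e C
        ≤⟨ 2e≤∑degree C ⟩
      ∑ n (λ x → ∑ n (adj C x))
        ≡⟨ ∑-shift n {λ x → ∑ n (adj C x)} (λ x → ∑-cong′ n λ y → adj-cong C (node-+n x) refl) k ⟨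
      ∑ n (λ x → ∑ n (adj C (x ℕ.+ k)))
        ≤⟨ ∑-mono n (λ x _ → ℤ.≤-trans (degree-local C k (λ _ _ → id) x) (window x)) ⟩
      ∑ n (λ x → + (k ℕ.+ k))
        ≡⟨ ∑-const n (+ (k ℕ.+ k)) ⟩
      + n * + (k ℕ.+ k)
        ≡⟨ cong (+ n *_) (ℤ.pos-+ k k) ⟩
      + n * (+ k + + k)
        ≡⟨ double (+ n) (+ k) ⟩
      + 2 * (+ n * + k) ∎)
      where
      open ℤ.≤-Reasoning
      C = CyclePower n k
      double : ∀ n k → n * (k + k) ≡ + 2 * (n * k)
      double = solve-∀
      window : ∀ x → ∑ (suc (k ℕ.+ k)) (λ i → adj C (x ℕ.+ k) (x ℕ.+ i)) ≤ + (k ℕ.+ k)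
      window x = begin
        ∑ (suc (k ℕ.+ k)) (a)
          ≡⟨ cong (λ w → ∑ w a) (ℕ.+-suc k k) ⟨
        ∑ (k ℕ.+ suc k) a
          ≡⟨ ∑-append k (suc k) a ⟩
        ∑ k a + ∑ (suc k) (λ i → a (k ℕ.+ i))
          ≡⟨ cong (λ s → ∑ k a + s) (trans (∑-head k (λ i → a (k ℕ.+ i)))
               (cong (_+ ∑ k (λ i → a (k ℕ.+ suc i)))
                 (trans (cong a (ℕ.+-identityʳ k)) (adj-self C (x ℕ.+ k))))) ⟩
        ∑ k a + (0ℤ + ∑ k (λ i → a (k ℕ.+ suc i)))
          ≤⟨ ℤ.+-mono-≤ (ones k a λ i → 𝟙≤1 (adj? C _ _))
               (ℤ.+-monoʳ-≤ 0ℤ (ones k (λ i → a (k ℕ.+ suc i)) λ i → 𝟙≤1 (adj? C _ _))) ⟩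
        + k + (0ℤ + + k)
          ≡⟨ cong (λ s → + k + s) (ℤ.+-identityˡ (+ k)) ⟩
        + (k ℕ.+ k) ∎
        where
        a : ℕ → ℤ
        a i = adj C (x ℕ.+ k) (x ℕ.+ i)
        ones : ∀ m f → (∀ i → f i ≤ 1ℤ) → ∑ m f ≤ + m
        ones m f f≤1 = ℤ.≤-trans (∑-mono m λ i _ → f≤1 i)
          (ℤ.≤-reflexive (trans (∑-const m 1ℤ) (ℤ.*-identityʳ (+ m))))

  -- Consecutive blocks of b vertices receive the colours 0, 1, …, r − 1 cyclically.
  module _ (n k b r : ℕ) .{{_ : NonZero n}} .{{_ : NonZero b}} .{{_ : NonZero r}} where

    colour : Fin n → Fin r
    colour u = (toℕ u / b) mod r

    multipartite : Graph n
    multipartite .Adj u v        = Adj (CyclePower n k) u v × colour u ≢ colour v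
    multipartite .adj? u v       = adj? (CyclePower n k) u v ×-dec ¬? (colour u Fin.≟ colour v)
    multipartite .adj-sym (a , ne) = adj-sym (CyclePower n k) a , ne ∘ sym
    multipartite .irrefl eq (a , _) = irrefl (CyclePower n k) eq a

    multipartite-⊑ : multipartite ⊑ CyclePower n k
    multipartite-⊑ = id , id , λ u v → proj₁

    multipartite-K-free : ¬ (K (suc r) ⊑ multipartite)
    multipartite-K-free (h , _ , h-hom) with Fin.pigeonhole (ℕ.n<1+n r) (colour ∘ h)
    ... | i , j , i<j , eq = proj₂ (h-hom i j (Fin.<⇒≢ i<j)) eq

  [m*b+p]/b : ∀ m b p .{{_ : NonZero b}} → (m ℕ.* b ℕ.+ p) / b ≡ m ℕ.+ p / b
  [m*b+p]/b m b p = trans (+-distrib-/-∣ˡ p (n∣m*n m)) (cong (ℕ._+ p / b) (m*n/n≡m m b))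

  ∑-∸ : ∀ e d → + 2 * ∑ (e ℕ.+ d) (λ c → + (c ∸ e)) ≡ + d * + d - + d
  ∑-∸ e zero = begin
    + 2 * ∑ (e ℕ.+ 0) (λ c → + (c ∸ e))
      ≡⟨ cong (λ m → + 2 * ∑ m λ c → + (c ∸ e)) (ℕ.+-identityʳ e) ⟩
    + 2 * ∑ e (λ c → + (c ∸ e))
      ≡⟨ cong (+ 2 *_) (∑-cong e λ c c<e → cong +_ (ℕ.m≤n⇒m∸n≡0 (ℕ.<⇒≤ c<e))) ⟩
    + 2 * ∑ e (λ _ → 0ℤ)
      ≡⟨ cong (+ 2 *_) (trans (∑-const e 0ℤ) (ℤ.*-zeroʳ (+ e))) ⟩
    0ℤ ∎
    where open ≡-Reasoning
  ∑-∸ e (suc d) = begin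
    + 2 * ∑ (e ℕ.+ suc d) (λ c → + (c ∸ e))
      ≡⟨ cong (λ m → + 2 * ∑ m λ c → + (c ∸ e)) (ℕ.+-suc e d) ⟩
    + 2 * (∑ (e ℕ.+ d) (λ c → + (c ∸ e)) + + (e ℕ.+ d ∸ e))
      ≡⟨ ℤ.*-distribˡ-+ (+ 2) (∑ (e ℕ.+ d) λ c → + (c ∸ e)) (+ (e ℕ.+ d ∸ e)) ⟩
    + 2 * ∑ (e ℕ.+ d) (λ c → + (c ∸ e)) + + 2 * + (e ℕ.+ d ∸ e)
      ≡⟨ cong₂ (λ a m → a + + 2 * + m) (∑-∸ e d) (ℕ.m+n∸m≡n e d) ⟩
    + d * + d - + d + + 2 * + d
      ≡⟨ identity (+ d) ⟩
    + suc d * + suc d - + suc d ∎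
    where
    open ≡-Reasoning
    identity : ∀ d → d * d - d + + 2 * d ≡ (1ℤ + d) * (1ℤ + d) - (1ℤ + d)
    identity = solve-∀

  module _ (n s e′ d : ℕ) .{{_ : NonZero n}} .{{_ : NonZero (e′ ℕ.+ d)}} (1≤s : 1 ℕ.≤ s) where
    private
      b = e′ ℕ.+ d
      k = s ℕ.* b ℕ.+ e′
      G = multipartite n k b (suc s)
      module R = Unrolled (suc s)
    open Unrolled n

    private
      -- The `s * b` positions after the end of block `q` fill the next s blocks, and these carry
      -- precisely the s colours other than that of block `q`.
      block-adj : ∀ q p i′ → p ℕ.< b → i′ ℕ.< s ℕ.* b →
        let x = q ℕ.* b ℕ.+ p ; i = (b ∸ suc p) ℕ.+ i′ in
        i ℕ.< k → x ℕ.+ suc i ℕ.< n → adj G x (x ℕ.+ suc i) ≡ 1ℤ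
      block-adj q p i′ p<b i′<sb i<k y<n = 𝟙-yes (adj? G _ _)
        (power-adj k (suc i) x (s≤s z≤n) i<k y<n , distinct)
        where
        x = q ℕ.* b ℕ.+ p
        i = (b ∸ suc p) ℕ.+ i′
        y≡ : x ℕ.+ suc i ≡ suc q ℕ.* b ℕ.+ i′
        y≡ = begin
          q ℕ.* b ℕ.+ p ℕ.+ suc (b ∸ suc p ℕ.+ i′)
            ≡⟨ cong (q ℕ.* b ℕ.+ p ℕ.+_) (sym (ℕ.+-suc (b ∸ suc p) i′)) ⟩
          q ℕ.* b ℕ.+ p ℕ.+ (b ∸ suc p ℕ.+ suc i′)
            ≡⟨ ℕ.+-assoc (q ℕ.* b) p _ ⟩
          q ℕ.* b ℕ.+ (p ℕ.+ (b ∸ suc p ℕ.+ suc i′))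
            ≡⟨ cong (q ℕ.* b ℕ.+_) (trans (sym (ℕ.+-assoc p (b ∸ suc p) (suc i′)))
                 (trans (ℕ.+-suc (p ℕ.+ (b ∸ suc p)) i′) (cong (ℕ._+ i′) (ℕ.m+[n∸m]≡n p<b)))) ⟩
          q ℕ.* b ℕ.+ (b ℕ.+ i′)
            ≡⟨ ℕ.+-assoc (q ℕ.* b) b i′ ⟨
          q ℕ.* b ℕ.+ b ℕ.+ i′
            ≡⟨ cong (ℕ._+ i′) (ℕ.+-comm (q ℕ.* b) b) ⟩
          suc q ℕ.* b ℕ.+ i′ ∎
          where open ≡-Reasoning
        x/b : toℕ (node x) / b ≡ q ℕ.+ 0
        x/b = trans (cong (_/ b) (toℕ-node-< (ℕ.≤-<-trans (ℕ.m≤m+n x (suc i)) y<n)))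
          (trans ([m*b+p]/b q b p) (cong (q ℕ.+_) (m<n⇒m/n≡0 p<b)))
        y/b : toℕ (node (x ℕ.+ suc i)) / b ≡ q ℕ.+ suc (i′ / b)
        y/b = trans (cong (_/ b) (trans (toℕ-node-< y<n) y≡))
          (trans ([m*b+p]/b (suc q) b i′) (sym (ℕ.+-suc q (i′ / b))))
        distinct : colour n k b (suc s) (node x) ≢ colour n k b (suc s) (node (x ℕ.+ suc i))
        -- Colours are residues modulo `suc s`; cancelling `q` leaves 0 against `suc (i′ / b)`,
        -- which is at most s.
        distinct eq = ℕ.0≢1+n (trans (sym (R.toℕ-node-< (s≤s z≤n))) (trans
          (cong toℕ (node-cancel (suc s) q (trans (cong R.node (sym x/b)) (trans eq (cong R.node y/b)))))
          (R.toℕ-node-< (s≤s (m<n*o⇒m/o<n i′<sb)))))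

      -- To the right of the p-th vertex come `c = b ∸ suc p` vertices of its own block and then
      -- `s * b` positions of other colours, of which the last `c ∸ e′` are farther than
      -- `k = s * b + e′`.
      row≥ : ∀ q p → p ℕ.< b → q ℕ.* b ℕ.+ p ℕ.+ k ℕ.< n →
        + (s ℕ.* b) - + (b ∸ suc p ∸ e′) ≤ ∑ k (λ i → adj G (q ℕ.* b ℕ.+ p) (q ℕ.* b ℕ.+ p ℕ.+ suc i))
      row≥ q p p<b x+k<n = ℤ.≤-trans (ℤ.≤-reflexive (trans (ℤ.m-n≡m⊖n (s ℕ.* b) (c ∸ e′)) (ℤ.⊖-≥ small)))
        (∑-interval≥ k c L fits (λ i → 0≤adj G x _)
          λ i i<L → block-adj q p i p<b (ℕ.<-≤-trans i<L (ℕ.m∸n≤m (s ℕ.* b) (c ∸ e′)))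
            (ℕ.<-≤-trans (ℕ.+-monoʳ-< c i<L) fits)
            (ℕ.≤-<-trans (ℕ.+-monoʳ-≤ x (ℕ.<-≤-trans (ℕ.+-monoʳ-< c i<L) fits)) x+k<n))
        where
        x = q ℕ.* b ℕ.+ p
        c = b ∸ suc p
        L = s ℕ.* b ∸ (c ∸ e′)
        small : c ∸ e′ ℕ.≤ s ℕ.* b
        small = ℕ.≤-trans (ℕ.m∸n≤m c e′) (ℕ.≤-trans (ℕ.m∸n≤m b (suc p))
          (ℕ.≤-trans (ℕ.≤-reflexive (sym (ℕ.*-identityˡ b))) (ℕ.*-monoˡ-≤ b 1≤s)))
        fits : c ℕ.+ L ℕ.≤ k
        fits = ℕ.≤-trans (ℕ.+-monoˡ-≤ L (ℕ.m≤n+m∸n c e′)) (ℕ.≤-reflexive (trans (ℕ.+-assoc e′ (c ∸ e′) L)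
          (trans (cong (e′ ℕ.+_) (ℕ.m+[n∸m]≡n small)) (ℕ.+-comm e′ (s ℕ.* b)))))

    -- Over one block the losses `c ∸ e′` of `row≥` run through 0, mostly repeated, and then 1, ...,
    -- d - 1; twice their sum is `d * d - d`.
    multipartite-edges : ∀ N → N ℕ.* b ℕ.+ k ℕ.≤ n →
      + N * (+ 2 * (+ s * (+ b * + b)) - + d * + d + + d) ≤ + 2 * + e G
    multipartite-edges N room = begin
      + N * (+ 2 * (+ s * (+ b * + b)) - + d * + d + + d)
        ≡⟨ trans (∑-const N _) (cong (+ N *_) block-sum) ⟨
      ∑ N (λ q → + 2 * ∑ b (λ p → + (s ℕ.* b) - + (b ∸ suc p ∸ e′)))
        ≤⟨ ∑-mono N (λ q q<N → ℤ.*-monoˡ-≤-nonNeg (+ 2) (∑-mono b λ p p<b → row≥ q p p<b (inside q p q<N p<b))) ⟩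
      ∑ N (λ q → + 2 * ∑ b (λ p → F (q ℕ.* b ℕ.+ p)))
        ≡⟨ trans (∑-* N (+ 2) _) (cong (+ 2 *_) (sym (∑-blocks N b F))) ⟩
      + 2 * ∑ (N ℕ.* b) F
        ≤⟨ ℤ.*-monoˡ-≤-nonNeg (+ 2) (edges≥ n G (N ℕ.* b) k room) ⟩
      + 2 * + e G ∎
      where
      open ℤ.≤-Reasoning
      F : ℕ → ℤ
      F x = ∑ k λ i → adj G x (x ℕ.+ suc i)
      inside : ∀ q p → q ℕ.< N → p ℕ.< b → q ℕ.* b ℕ.+ p ℕ.+ k ℕ.< n
      inside q p q<N p<b = ℕ.<-≤-trans (ℕ.+-monoˡ-< k (ℕ.<-≤-trans (ℕ.+-monoʳ-< (q ℕ.* b) p<b)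
        (ℕ.≤-trans (ℕ.≤-reflexive (ℕ.+-comm (q ℕ.* b) b)) (ℕ.*-monoˡ-≤ b q<N)))) room
      identity : ∀ S b T d → + 2 * T ≡ d * d - d → + 2 * (b * S - T) ≡ + 2 * (b * S) - d * d + d
      identity S b T d eq = trans (expand S b T) (trans (cong (λ u → + 2 * (b * S) - u) eq) (regroup S b d))
        where
        expand : ∀ S b T → + 2 * (b * S - T) ≡ + 2 * (b * S) - + 2 * T
        expand = solve-∀
        regroup : ∀ S b d → + 2 * (b * S) - (d * d - d) ≡ + 2 * (b * S) - d * d + d
        regroup = solve-∀
      block-sum : + 2 * ∑ b (λ p → + (s ℕ.* b) - + (b ∸ suc p ∸ e′)) ≡ + 2 * (+ s * (+ b * + b)) - + d * + d + + d
      block-sum = begin-equality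
        + 2 * ∑ b (λ p → + (s ℕ.* b) - + (b ∸ suc p ∸ e′))
          ≡⟨ cong (+ 2 *_) (∑-rev b (λ c → + (s ℕ.* b) - + (c ∸ e′))) ⟨
        + 2 * ∑ b (λ c → + (s ℕ.* b) - + (c ∸ e′))
          ≡⟨ cong (+ 2 *_) (∑-+ b _ (λ c → - + (c ∸ e′))) ⟩
        + 2 * (∑ b (λ _ → + (s ℕ.* b)) + ∑ b (λ c → - + (c ∸ e′)))
          ≡⟨ cong (+ 2 *_) (cong₂ _+_ (∑-const b _)
               (trans (∑-cong′ b λ c → sym (ℤ.-1*i≡-i (+ (c ∸ e′)))) (trans (∑-* b (ℤ.-1ℤ) _) (ℤ.-1*i≡-i _)))) ⟩
        + 2 * (+ b * + (s ℕ.* b) - ∑ b (λ c → + (c ∸ e′)))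
          ≡⟨ identity (+ (s ℕ.* b)) (+ b) _ (+ d) (∑-∸ e′ d) ⟩
        + 2 * (+ b * + (s ℕ.* b)) - + d * + d + + d
          ≡⟨ cong (λ z → + 2 * z - + d * + d + + d) (trans (cong (+ b *_) (ℤ.pos-* s b)) (flip (+ b) (+ s))) ⟩
        + 2 * (+ s * (+ b * + b)) - + d * + d + + d ∎
        where
        flip : ∀ b s → b * (s * b) ≡ s * (b * b)
        flip = solve-∀

  -- Cliques from large minimum degree

  least : ∀ {P : ℕ → Set} → (∀ i → Dec (P i)) → ∀ n →
          (∃[ m ] m ℕ.< n × P m × (∀ j → j ℕ.< m → ¬ P j)) ⊎ (∀ j → j ℕ.< n → ¬ P j)
  least P? zero = inj₂ λ _ ()
  least P? (suc n) with least P? n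
  ... | inj₁ (m , m<n , Pm , min) = inj₁ (m , ℕ.m≤n⇒m≤1+n m<n , Pm , min)
  ... | inj₂ none with P? n
  ...   | yes Pn = inj₁ (n , ℕ.≤-refl , Pn , none)
  ...   | no ¬Pn = inj₂ λ j j<1+n → below j (ℕ.m<1+n⇒m<n∨m≡n j<1+n)
    where
    below : ∀ j → j ℕ.< n ⊎ j ≡ n → ¬ _
    below j (inj₁ j<n) = none j j<n
    below j (inj₂ refl) = ¬Pn

  𝟙-union : ∀ {P A B : Set} (p : Dec P) (a : Dec A) (b : Dec B) → (A → B → ¬ P) →
            𝟙 p ≤ 𝟙 (¬? a) + 𝟙 (¬? b) - 𝟙 (¬? a ×-dec ¬? b)
  𝟙-union p (no _)  (no _)  _  = 𝟙≤1 p
  𝟙-union p (no _)  (yes _) _  = 𝟙≤1 p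
  𝟙-union p (yes _) (no _)  _  = 𝟙≤1 p
  𝟙-union p (yes x) (yes y) ¬p = ℤ.≤-reflexive (𝟙-no p (¬p x y))

  module _ (n k : ℕ) .{{_ : NonZero n}} (G : Graph n)
           (sub : ∀ u v → Adj G u v → Adj (CyclePower n k) u v) where
    open Unrolled n

    private
      _~_ : ℕ → ℕ → Set
      x ~ y = Adj G (node x) (node y)

      _~?_ : ∀ x y → Dec (x ~ y)
      x ~? y = adj? G (node x) (node y)

      miss : ℕ → ℕ → ℤ
      miss x y = 𝟙 (¬? (x ~? y))

      0≤miss : ∀ x y → 0ℤ ≤ miss x y
      0≤miss x y = 0≤𝟙 (¬? (x ~? y))

      node-+*n : ∀ x m → node (x ℕ.+ m ℕ.* n) ≡ node x
      node-+*n x m = node-cong ([m+kn]%n≡m%n x m n)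

    module _ (μ : ℕ) (degree≥ : ∀ {u v} → Adj G u v → suc (k ℕ.+ k) ℕ.≤ degree G u ℕ.+ μ) where
      private
        -- By `degree-local` at least `degree` many of the 2k + 1 positions are adjacent to the
        -- centre; `μ` bounds the rest, among them the centre itself.
        window : ∀ x {v} → Adj G (node (x ℕ.+ k)) v → ∑ (suc (k ℕ.+ k)) (λ i → miss (x ℕ.+ k) (x ℕ.+ i)) ≤ + μ
        window x a = ≤-by (0≤-diff total) (identity (+ μ) M)
          where
          w = suc (k ℕ.+ k)
          M = ∑ w (λ i → miss (x ℕ.+ k) (x ℕ.+ i))
          identity : ∀ μ M → μ ≡ M + (μ - M)
          identity = solve-∀
          complement : ∀ y → adj G (x ℕ.+ k) y ≡ 1ℤ + - 1ℤ * miss (x ℕ.+ k) y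
          complement y with (x ℕ.+ k) ~? y
          ... | yes _ = refl
          ... | no  _ = refl
          total : M ≤ + μ
          total = begin
            M
              ≤⟨ ≤-by (0≤-diff (ℤ.+≤+ (degree≥ a))) (rearrange M (+ w) (+ (degree G (node (x ℕ.+ k)) ℕ.+ μ))) ⟩
            + (degree G (node (x ℕ.+ k)) ℕ.+ μ) - (+ w - M)
              ≡⟨ cong₂ (λ a b → a - b) (trans (ℤ.pos-+ (degree G (node (x ℕ.+ k))) μ) (cong (_+ + μ) (degree-∑ G (x ℕ.+ k))))
                   (sym (trans (trans (∑-cong′ w λ i → complement (x ℕ.+ i)) (trans (∑-+ w _ _)
                      (cong₂ _+_ (trans (∑-const w 1ℤ) (ℤ.*-identityʳ (+ w))) (∑-* w (- 1ℤ) _)))) (neg (+ w) M))) ⟩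
            ∑ n (adj G (x ℕ.+ k)) + + μ - ∑ w (λ i → adj G (x ℕ.+ k) (x ℕ.+ i))
              ≤⟨ ≤-by (0≤-diff (degree-local G k sub x)) (rearrange′ (∑ n (adj G (x ℕ.+ k))) (+ μ) (∑ w (λ i → adj G (x ℕ.+ k) (x ℕ.+ i)))) ⟩
            + μ ∎
            where
            open ℤ.≤-Reasoning
            rearrange : ∀ M w D → D - (w - M) ≡ M + (D - w)
            rearrange = solve-∀
            rearrange′ : ∀ S μ T → μ ≡ S + μ - T + (T - S)
            rearrange′ = solve-∀
            neg : ∀ w M → w + - 1ℤ * M ≡ w - M
            neg = solve-∀

        far-window : ∀ x lo len {v} → Adj G (node x) v → k ℕ.≤ x → x ℕ.≤ lo ℕ.+ k → lo ℕ.+ len ℕ.≤ x ℕ.+ suc k →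
                     ∑ len (λ i → miss x (lo ℕ.+ i)) ≤ + μ
        far-window x lo len {v} a k≤x x≤lo+k fits with ℕ.m≤n⇒∃[o]m+o≡n k≤x
        ... | x₀ , refl with ℕ.m≤n⇒∃[o]m+o≡n (ℕ.+-cancelˡ-≤ k x₀ lo (ℕ.≤-trans x≤lo+k (ℕ.≤-reflexive (ℕ.+-comm lo k))))
        ...   | j , refl = begin
          ∑ len (λ i → miss (k ℕ.+ x₀) (x₀ ℕ.+ j ℕ.+ i))
            ≡⟨ ∑-cong′ len (λ i → cong₂ miss (ℕ.+-comm k x₀) (ℕ.+-assoc x₀ j i)) ⟩
          ∑ len (λ i → f (j ℕ.+ i))
            ≤⟨ ≤-by (0≤∑ j λ i _ → 0≤miss _ _) (ℤ.+-comm (∑ j f) _) ⟩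
          ∑ j f + ∑ len (λ i → f (j ℕ.+ i))
            ≡⟨ ∑-append j len f ⟨
          ∑ (j ℕ.+ len) f
            ≤⟨ ∑-prefix (ℕ.+-cancelˡ-≤ x₀ (j ℕ.+ len) (suc (k ℕ.+ k)) (ℕ.≤-trans (ℕ.≤-reflexive (sym (ℕ.+-assoc x₀ j len)))
                 (ℕ.≤-trans fits (ℕ.≤-reflexive (shuffle k x₀))))) (λ i → 0≤miss _ _) ⟩
          ∑ (suc (k ℕ.+ k)) f
            ≤⟨ window x₀ (subst (λ z → Adj G (node z) v) (ℕ.+-comm k x₀) a) ⟩
          + μ ∎
          where
          open ℤ.≤-Reasoning
          f : ℕ → ℤ
          f i = miss (x₀ ℕ.+ k) (x₀ ℕ.+ i)
          shuffle : ∀ k x₀ → k ℕ.+ x₀ ℕ.+ suc k ≡ x₀ ℕ.+ suc (k ℕ.+ k)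
          shuffle = solve-ℕ

      -- Moving everything right by k full turns makes `x` at least k, so that the window around it
      -- starts at a natural number.
      missing≤ : ∀ x lo len {v} → Adj G (node x) v → x ℕ.≤ lo ℕ.+ k → lo ℕ.+ len ℕ.≤ x ℕ.+ suc k →
                 ∑ len (λ i → miss x (lo ℕ.+ i)) ≤ + μ
      missing≤ x lo len {v} a x≤lo+k fits = ℤ.≤-trans
        (ℤ.≤-reflexive (∑-cong′ len λ i → 𝟙-cong (¬? (x ~? (lo ℕ.+ i))) (¬? (x′ ~? (lo′ ℕ.+ i)))
          (subst¬ (sym (node-+*n x k)) (sym (far i))) (subst¬ (node-+*n x k) (far i))))
        (far-window x′ lo′ len (subst (λ u → Adj G u v) (sym (node-+*n x k)) a)
          (ℕ.≤-trans (ℕ.m≤m*n k n) (ℕ.m≤n+m (k ℕ.* n) x))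
          (ℕ.≤-trans (ℕ.+-monoˡ-≤ (k ℕ.* n) x≤lo+k) (ℕ.≤-reflexive (exch lo k (k ℕ.* n))))
          (ℕ.≤-trans (ℕ.≤-reflexive (exch lo (k ℕ.* n) len))
            (ℕ.≤-trans (ℕ.+-monoˡ-≤ (k ℕ.* n) fits) (ℕ.≤-reflexive (exch x (suc k) (k ℕ.* n))))))
        where
        x′ = x ℕ.+ k ℕ.* n
        lo′ = lo ℕ.+ k ℕ.* n
        exch : ∀ a b c → a ℕ.+ b ℕ.+ c ≡ a ℕ.+ c ℕ.+ b
        exch = solve-ℕ
        far : ∀ i → node (lo′ ℕ.+ i) ≡ node (lo ℕ.+ i)
        far i = trans (cong node (exch lo (k ℕ.* n) i)) (node-+*n (lo ℕ.+ i) k)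
        subst¬ : ∀ {u u′ w w′} → u ≡ u′ → w ≡ w′ → ¬ Adj G u w → ¬ Adj G u′ w′
        subst¬ refl refl = id

      module _ (d : ℕ) (0<d : 0 ℕ.< d) where

        -- A clique of i + 2 vertices whose hull [lo + Y, lo + Y + L] contains no common
        -- neighbour; B bounds the number of non-common-neighbours in the window of
        -- positions within distance k of the whole hull.
        record Stage (i : ℕ) : Set where
          field
            h      : Fin (suc (suc i)) → ℕ
            clique : ∀ a b → a ≢ b → h a ~ h b
            lo L Y : ℕ
            L+Y≡k  : L ℕ.+ Y ≡ k
          Bad : ℕ → Set
          Bad y = ∃[ a ] ¬ (h a ~ y)
          bad? : ∀ y → Dec (Bad y)
          bad? y = Fin.any? λ a → ¬? (h a ~? y)
          field
            hull   : ∀ j → j ℕ.≤ L → Bad (lo ℕ.+ Y ℕ.+ j)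
            B      : ℤ
            count  : ∑ (suc (L ℕ.+ Y ℕ.+ Y)) (λ j → 𝟙 (bad? (lo ℕ.+ j))) ≤ B
            B≤     : B + + d ≤ (1ℤ + 1ℤ + + i) * + μ + 1ℤ
            -- If the whole window were bad, then L + 2Y + 1 ≤ B, that is 2k + 1 ≤ L + B. So this
            -- invariant yields a common neighbour as long as (i + 1) μ < k.
            L+B≤   : + L + B ≤ + 2 * ((1ℤ + + i) * + μ) + 1ℤ

          good : ∀ {y} → ¬ Bad y → ∀ a → h a ~ y
          good {y} ¬bad a = decidable-stable (h a ~? y) λ ¬adj → ¬bad (a , ¬adj)

          extended : ℕ → Fin (suc (suc (suc i))) → ℕ
          extended x zero    = x
          extended x (suc a) = h a

          extended-clique : ∀ {x} → ¬ Bad x → ∀ a b → a ≢ b → extended x a ~ extended x b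
          extended-clique ¬bad zero    zero    ne = ⊥-elim (ne refl)
          extended-clique ¬bad zero    (suc b) ne = adj-sym G (good ¬bad b)
          extended-clique ¬bad (suc a) zero    ne = good ¬bad a
          extended-clique ¬bad (suc a) (suc b) ne = clique a b (ne ∘ cong suc)

          -- The hull and `y₀` bad positions on either side form an interval that `B` has to pay
          -- for. With `y₀ = Y` this is the whole window; with `y₀` just below the distance of the
          -- nearest common neighbour it limits the growth of the hull.
          surrounded : ∀ y₀ c → y₀ ℕ.+ c ≡ Y →
            (∀ y → y ℕ.≤ y₀ → Bad (lo ℕ.+ Y ℕ.+ L ℕ.+ y) × Bad (lo ℕ.+ (Y ∸ y))) →
            + suc (L ℕ.+ y₀ ℕ.+ y₀) ≤ B
          surrounded y₀ c eq bad = ℤ.≤-trans (∑-interval≥ _ c (suc (L ℕ.+ y₀ ℕ.+ y₀))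
            (ℕ.≤-trans (ℕ.m≤n+m _ c) (ℕ.≤-reflexive (trans (size L y₀ c) (cong (λ z → suc (L ℕ.+ z ℕ.+ z)) eq)))) (λ j → 0≤𝟙 (bad? (lo ℕ.+ j)))
            λ j j< → 𝟙-yes (bad? (lo ℕ.+ (c ℕ.+ j))) (place j (ℕ.≤-pred j<))) count
            where
            size : ∀ L y c → c ℕ.+ (c ℕ.+ suc (L ℕ.+ y ℕ.+ y)) ≡ suc (L ℕ.+ (y ℕ.+ c) ℕ.+ (y ℕ.+ c))
            size = solve-ℕ
            place : ∀ j → j ℕ.≤ L ℕ.+ y₀ ℕ.+ y₀ → Bad (lo ℕ.+ (c ℕ.+ j))
            place j j≤ with ℕ.≤-total j y₀
            ... | inj₁ j≤y₀ with ℕ.m≤n⇒∃[o]m+o≡n j≤y₀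
            ...   | y , refl = subst (λ z → Bad (lo ℕ.+ z)) left (proj₂ (bad y (ℕ.m≤n+m y j)))
              where
              shuffle : ∀ j y c → j ℕ.+ y ℕ.+ c ≡ c ℕ.+ j ℕ.+ y
              shuffle = solve-ℕ
              left : Y ∸ y ≡ c ℕ.+ j
              left = trans (cong (_∸ y) (trans (sym eq) (shuffle j y c))) (ℕ.m+n∸n≡m (c ℕ.+ j) y)
            place j j≤ | inj₂ y₀≤j with ℕ.m≤n⇒∃[o]m+o≡n y₀≤j
            ... | j′ , refl with ℕ.≤-total j′ L
            ...   | inj₁ j′≤L = subst Bad (trans (cong (λ z → lo ℕ.+ z ℕ.+ j′) (sym eq)) (shuffle lo y₀ c j′)) (hull j′ j′≤L)
              where
              shuffle : ∀ lo y c j → lo ℕ.+ (y ℕ.+ c) ℕ.+ j ≡ lo ℕ.+ (c ℕ.+ (y ℕ.+ j))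
              shuffle = solve-ℕ
            ...   | inj₂ L≤j′ with ℕ.m≤n⇒∃[o]m+o≡n L≤j′
            ...     | y , refl = subst Bad (trans (cong (λ z → lo ℕ.+ z ℕ.+ L ℕ.+ y) (sym eq)) (shuffle lo y₀ c L y)) (proj₁ (bad y (ℕ.+-cancelˡ-≤ (L ℕ.+ y₀) y y₀
                        (ℕ.≤-trans (ℕ.≤-reflexive (shuffle′ L y₀ y)) j≤))))
              where
              shuffle : ∀ lo y₀ c L y → lo ℕ.+ (y₀ ℕ.+ c) ℕ.+ L ℕ.+ y ≡ lo ℕ.+ (c ℕ.+ (y₀ ℕ.+ (L ℕ.+ y)))
              shuffle = solve-ℕ
              shuffle′ : ∀ L y₀ y → L ℕ.+ y₀ ℕ.+ y ≡ y₀ ℕ.+ (L ℕ.+ y)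
              shuffle′ = solve-ℕ

        module _ {i} (st : Stage i) (room : suc i ℕ.* μ ℕ.< k) where
          open Stage st

          private
            Found : ℕ → Set
            Found y = ¬ Bad (lo ℕ.+ Y ℕ.+ L ℕ.+ y) ⊎ ¬ Bad (lo ℕ.+ (Y ∸ y))

            found? : ∀ y → Dec (Found y)
            found? y = ¬? (bad? _) ⊎-dec ¬? (bad? _)

            both-bad : ∀ {y} → ¬ Found y → Bad (lo ℕ.+ Y ℕ.+ L ℕ.+ y) × Bad (lo ℕ.+ (Y ∸ y))
            both-bad ¬found = decidable-stable (bad? _) (¬found ∘ inj₁) , decidable-stable (bad? _) (¬found ∘ inj₂)

            crowded : ¬ (∀ y → y ℕ.< suc Y → ¬ Found y)
            crowded none = ℤ.<⇒≱ (ℤ.+<+ room) (ℤ.*-cancelˡ-≤-pos _ _ (+ 2) (begin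
              + 2 * + k
                ≡⟨ cong (λ m → + 2 * m) (trans (cong +_ (sym L+Y≡k)) (ℤ.pos-+ L Y)) ⟩
              + 2 * (+ L + + Y)
                ≤⟨ ≤-by (0≤-diff (surrounded Y 0 (ℕ.+-identityʳ Y) (λ y y≤Y → both-bad (none y (s≤s y≤Y))))
                          ⊕ 0≤-diff L+B≤)
                     (trans (cong (+ 2 *_) (ℤ.pos-* (suc i) μ))
                       (trans (identity (+ L) (+ Y) B (+ i) (+ μ))
                         (cong (λ w → + 2 * (+ L + + Y) + (B - w + (+ 2 * (+ suc i * + μ) + 1ℤ - (+ L + B)))) (sym (cast L Y))))) ⟩
              + 2 * + (suc i ℕ.* μ) ∎))
              where
              open ℤ.≤-Reasoning
              cast : ∀ L Y → + suc (L ℕ.+ Y ℕ.+ Y) ≡ 1ℤ + (+ L + + Y + + Y)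
              cast L Y = cong (λ z → 1ℤ + z) (trans (ℤ.pos-+ (L ℕ.+ Y) Y) (cong (_+ + Y) (ℤ.pos-+ L Y)))
              identity : ∀ L Y B i μ → + 2 * ((1ℤ + i) * μ) ≡
                + 2 * (L + Y) + (B - (1ℤ + (L + Y + Y)) + (+ 2 * ((1ℤ + i) * μ) + 1ℤ - (L + B)))
              identity = solve-∀

          common-neighbour : ∃[ y ] y ℕ.≤ Y × Found y × (∀ j → j ℕ.< y → ¬ Found j)
          common-neighbour with least found? (suc Y)
          ... | inj₁ (y , s≤s y≤Y , found , min) = y , y≤Y , found , min
          ... | inj₂ none = ⊥-elim (crowded none)

          clique-suc : ∃[ x ] ¬ Bad x
          clique-suc with common-neighbour
          ... | y , _ , inj₁ ¬bad , _ = _ , ¬bad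
          ... | y , _ , inj₂ ¬bad , _ = _ , ¬bad

          private
            extend : ∀ x o L′ Y′ → ¬ Bad x → L′ ℕ.+ Y′ ≡ k → let lo′ = lo ℕ.+ o ; w = suc (L′ ℕ.+ Y′ ℕ.+ Y′) in
              (∀ j → j ℕ.≤ L′ → Bad (lo′ ℕ.+ Y′ ℕ.+ j) ⊎ lo′ ℕ.+ Y′ ℕ.+ j ≡ x) →
              o ℕ.+ w ℕ.≤ suc (L ℕ.+ Y ℕ.+ Y) → x ℕ.≤ lo′ ℕ.+ k → lo′ ℕ.+ w ℕ.≤ x ℕ.+ suc k →
              + 2 * + L′ ≤ + L + B + 1ℤ → Stage (suc i)
            extend x o L′ Y′ ¬bad L′+Y′≡k hull′ inside near₁ near₂ L′≤ = record
              { h = extended x ; clique = extended-clique ¬bad ; lo = lo ℕ.+ o ; L = L′ ; Y = Y′ ; L+Y≡k = L′+Y′≡k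
              ; hull = λ j j≤ → grow (hull′ j j≤)
              ; B = B + + μ
              ; count = count′
              ; B≤ = ≤-by (0≤-diff B≤) (B-identity B (+ d) (+ i) (+ μ))
              -- From 2L′ ≤ L + B + 1, the old invariant and B ≤ (i + 2) μ + 1 - d follows 2 (L′ + B
              -- + μ) ≤ 4 (i + 2) μ + 4 - 2d; since d ≥ 1 this is at most twice the new bound.
              ; L+B≤ = ℤ.*-cancelˡ-≤-pos _ _ (+ 2) (≤-by
                  (0≤-diff L′≤ ⊕ 0≤-diff L+B≤ ⊕ (0≤+n {2} ⊛ 0≤-diff B≤) ⊕ 0≤+n {2} ⊛ 0≤-diff (ℤ.+≤+ 0<d))
                  (L-identity (+ L) (+ L′) B (+ d) (+ i) (+ μ)))
              }
              where
              w = suc (L′ ℕ.+ Y′ ℕ.+ Y′)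
              Bad′ : ℕ → Set
              Bad′ y = ∃[ a ] ¬ (extended x a ~ y)
              bad′? : ∀ y → Dec (Bad′ y)
              bad′? y = Fin.any? λ a → ¬? (extended x a ~? y)
              grow : ∀ {y} → Bad y ⊎ y ≡ x → Bad′ y
              grow (inj₁ (a , ¬adj)) = suc a , ¬adj
              grow (inj₂ refl)       = zero , irrefl G refl
              union : ∀ y → 𝟙 (bad′? y) ≤ 𝟙 (bad? y) + miss x y
              union y with bad′? y
              ... | no _                = 0≤𝟙 (bad? y) ⊕ 0≤miss x y
              ... | yes (zero , ¬adj)   = ≤-by (0≤𝟙 (bad? y))
                (trans (cong (λ m → 𝟙 (bad? y) + m) (𝟙-yes (¬? (x ~? y)) ¬adj)) (ℤ.+-comm (𝟙 (bad? y)) 1ℤ))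
              ... | yes (suc a , ¬adj)  = ≤-by (0≤miss x y) (cong (_+ miss x y) (𝟙-yes (bad? y) (a , ¬adj)))
              count′ : ∑ w (λ j → 𝟙 (bad′? (lo ℕ.+ o ℕ.+ j))) ≤ B + + μ
              count′ = begin
                ∑ w (λ j → 𝟙 (bad′? (lo ℕ.+ o ℕ.+ j)))
                  ≤⟨ ∑-mono w (λ j _ → union (lo ℕ.+ o ℕ.+ j)) ⟩
                ∑ w (λ j → 𝟙 (bad? (lo ℕ.+ o ℕ.+ j)) + miss x (lo ℕ.+ o ℕ.+ j))
                  ≡⟨ ∑-+ w _ _ ⟩
                ∑ w (λ j → 𝟙 (bad? (lo ℕ.+ o ℕ.+ j))) + ∑ w (λ j → miss x (lo ℕ.+ o ℕ.+ j))
                  ≤⟨ ℤ.+-mono-≤ old (missing≤ x (lo ℕ.+ o) w (adj-sym G (good ¬bad zero)) near₁ near₂) ⟩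
                B + + μ ∎
                where
                open ℤ.≤-Reasoning
                f : ℕ → ℤ
                f j = 𝟙 (bad? (lo ℕ.+ j))
                old : ∑ w (λ j → 𝟙 (bad? (lo ℕ.+ o ℕ.+ j))) ≤ B
                old = begin
                  ∑ w (λ j → 𝟙 (bad? (lo ℕ.+ o ℕ.+ j)))
                    ≡⟨ ∑-cong′ w (λ j → cong (λ z → 𝟙 (bad? z)) (ℕ.+-assoc lo o j)) ⟩
                  ∑ w (λ j → f (o ℕ.+ j))
                    ≤⟨ ≤-by (0≤∑ o λ j _ → 0≤𝟙 (bad? _)) (ℤ.+-comm (∑ o f) _) ⟩
                  ∑ o f + ∑ w (λ j → f (o ℕ.+ j))
                    ≡⟨ ∑-append o w f ⟨
                  ∑ (o ℕ.+ w) f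
                    ≤⟨ ∑-prefix inside (λ j → 0≤𝟙 (bad? _)) ⟩
                  ∑ (suc (L ℕ.+ Y ℕ.+ Y)) f
                    ≤⟨ count ⟩
                  B ∎
              B-identity : ∀ B d i μ → (1ℤ + 1ℤ + (1ℤ + i)) * μ + 1ℤ ≡ B + μ + d + ((1ℤ + 1ℤ + i) * μ + 1ℤ - (B + d))
              B-identity = solve-∀
              L-identity : ∀ L L′ B d i μ → + 2 * (+ 2 * ((1ℤ + (1ℤ + i)) * μ) + 1ℤ) ≡ + 2 * (L′ + (B + μ)) +
                ((L + B + 1ℤ - + 2 * L′) + ((+ 2 * ((1ℤ + i) * μ) + 1ℤ - (L + B))
                 + (+ 2 * ((1ℤ + 1ℤ + i) * μ + 1ℤ - (B + d)) + + 2 * (d - 1ℤ))))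
              L-identity = solve-∀

            at-least-one : ∀ {y} → Found y → ∃[ y₀ ] y ≡ suc y₀
            at-least-one {zero} (inj₁ ¬bad) = ⊥-elim (¬bad (subst Bad (sym (ℕ.+-identityʳ _)) (hull L ℕ.≤-refl)))
            at-least-one {zero} (inj₂ ¬bad) = ⊥-elim (¬bad (subst Bad (ℕ.+-identityʳ _) (hull 0 z≤n)))
            at-least-one {suc y₀} _         = y₀ , refl

          next-stage : Stage (suc i)
          next-stage with common-neighbour
          ... | y , y≤Y , found , min with at-least-one found
          ...   | y₀ , refl with ℕ.m≤n⇒∃[o]m+o≡n y≤Y
          ...     | Y′ , eq = build found
            where
            sides : ∀ y → y ℕ.≤ y₀ → Bad (lo ℕ.+ Y ℕ.+ L ℕ.+ y) × Bad (lo ℕ.+ (Y ∸ y))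
            sides y y≤y₀ = both-bad (min y (s≤s y≤y₀))
            L′≤ : + 2 * + (L ℕ.+ suc y₀) ≤ + L + B + 1ℤ
            L′≤ = ≤-by (0≤-diff (surrounded y₀ (suc Y′) (trans (ℕ.+-suc y₀ Y′) eq) sides))
              (trans (identity (+ L) (+ y₀) B) (cong₂ (λ a b → + 2 * a + (B - b)) (sym (ℤ.pos-+ L (suc y₀))) (sym cast)))
              where
              cast : + suc (L ℕ.+ y₀ ℕ.+ y₀) ≡ 1ℤ + (+ L + + y₀ + + y₀)
              cast = cong (λ z → 1ℤ + z) (trans (ℤ.pos-+ (L ℕ.+ y₀) y₀) (cong (_+ + y₀) (ℤ.pos-+ L y₀)))
              identity : ∀ L y B → L + B + 1ℤ ≡ + 2 * (L + (1ℤ + y)) + (B - (1ℤ + (L + y + y)))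
              identity = solve-∀
            size : L ℕ.+ suc y₀ ℕ.+ Y′ ≡ k
            size = trans (trans (ℕ.+-assoc L (suc y₀) Y′) (cong (L ℕ.+_) eq)) L+Y≡k
            fit : ∀ L y Y′ → y ℕ.+ suc (L ℕ.+ y ℕ.+ Y′ ℕ.+ Y′) ≡ suc (L ℕ.+ (y ℕ.+ Y′) ℕ.+ (y ℕ.+ Y′))
            fit = solve-ℕ
            fit′ : suc (L ℕ.+ (suc y₀ ℕ.+ Y′) ℕ.+ (suc y₀ ℕ.+ Y′)) ℕ.≤ suc (L ℕ.+ Y ℕ.+ Y)
            fit′ = ℕ.≤-reflexive (cong (λ z → suc (L ℕ.+ z ℕ.+ z)) eq)
            build : Found (suc y₀) → Stage (suc i)
            build (inj₁ ¬bad) = extend (lo ℕ.+ Y ℕ.+ L ℕ.+ suc y₀) (suc y₀) (L ℕ.+ suc y₀) Y′ ¬bad size hull′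
              (ℕ.≤-trans (ℕ.≤-reflexive (fit L (suc y₀) Y′)) fit′)
              (ℕ.≤-reflexive (trans (cong (λ z → lo ℕ.+ z ℕ.+ L ℕ.+ suc y₀) (sym eq))
                (trans (end lo (suc y₀) Y′ L) (cong (lo ℕ.+ suc y₀ ℕ.+_) size))))
              (ℕ.≤-trans (ℕ.≤-reflexive (end′ lo y₀ Y′ L)) (ℕ.+-mono-≤
                (ℕ.≤-reflexive (cong (λ z → lo ℕ.+ z ℕ.+ L ℕ.+ suc y₀) eq))
                (s≤s (ℕ.≤-trans (ℕ.m≤n+m Y′ (L ℕ.+ suc y₀)) (ℕ.≤-reflexive size)))))
              L′≤
              where
              end : ∀ lo y Y′ L → lo ℕ.+ (y ℕ.+ Y′) ℕ.+ L ℕ.+ y ≡ lo ℕ.+ y ℕ.+ (L ℕ.+ y ℕ.+ Y′)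
              end = solve-ℕ
              end′ : ∀ lo y Y′ L → lo ℕ.+ suc y ℕ.+ suc (L ℕ.+ suc y ℕ.+ Y′ ℕ.+ Y′) ≡ lo ℕ.+ (suc y ℕ.+ Y′) ℕ.+ L ℕ.+ suc y ℕ.+ suc Y′
              end′ = solve-ℕ
              start : ∀ j → lo ℕ.+ suc y₀ ℕ.+ Y′ ℕ.+ j ≡ lo ℕ.+ Y ℕ.+ j
              start j = cong (ℕ._+ j) (trans (ℕ.+-assoc lo (suc y₀) Y′) (cong (lo ℕ.+_) eq))
              -- The new hull consists of the old one, the positions passed over, which are bad
              -- because a nearest common neighbour was taken, and the new vertex, which is not
              -- adjacent to itself.
              hull′ : ∀ j → j ℕ.≤ L ℕ.+ suc y₀ → Bad (lo ℕ.+ suc y₀ ℕ.+ Y′ ℕ.+ j) ⊎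
                      lo ℕ.+ suc y₀ ℕ.+ Y′ ℕ.+ j ≡ lo ℕ.+ Y ℕ.+ L ℕ.+ suc y₀
              hull′ j j≤ with ℕ.≤-total j L
              ... | inj₁ j≤L = inj₁ (subst Bad (sym (start j)) (hull j j≤L))
              ... | inj₂ L≤j with ℕ.m≤n⇒∃[o]m+o≡n L≤j
              ...   | y , refl with ℕ.m≤n⇒m<n∨m≡n (ℕ.+-cancelˡ-≤ L y (suc y₀) j≤)
              ...     | inj₁ (s≤s y≤y₀) = inj₁ (subst Bad (trans (ℕ.+-assoc (lo ℕ.+ Y) L y) (sym (start (L ℕ.+ y))))
                                                     (proj₁ (sides y y≤y₀)))
              ...     | inj₂ refl       = inj₂ (trans (start (L ℕ.+ suc y₀)) (sym (ℕ.+-assoc (lo ℕ.+ Y) L (suc y₀))))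
            build (inj₂ ¬bad) = extend (lo ℕ.+ (Y ∸ suc y₀)) 0 (L ℕ.+ suc y₀) Y′ ¬bad size hull′
              (ℕ.≤-trans (ℕ.≤-trans (ℕ.m≤n+m _ (suc y₀)) (ℕ.≤-reflexive (fit L (suc y₀) Y′))) fit′)
              (ℕ.≤-trans (ℕ.≤-reflexive (cong (lo ℕ.+_) Y∸)) (ℕ.+-mono-≤ (ℕ.m≤m+n lo 0)
                (ℕ.≤-trans (ℕ.m≤n+m Y′ (L ℕ.+ suc y₀)) (ℕ.≤-reflexive size))))
              (ℕ.≤-reflexive (trans (end lo y₀ Y′ L) (cong₂ (λ a b → lo ℕ.+ a ℕ.+ suc b) (sym Y∸) size)))
              L′≤
              where
              Y∸ : Y ∸ suc y₀ ≡ Y′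
              Y∸ = trans (cong (_∸ suc y₀) (sym eq)) (ℕ.m+n∸m≡n (suc y₀) Y′)
              end : ∀ lo y Y′ L → lo ℕ.+ 0 ℕ.+ suc (L ℕ.+ suc y ℕ.+ Y′ ℕ.+ Y′) ≡ lo ℕ.+ Y′ ℕ.+ suc (L ℕ.+ suc y ℕ.+ Y′)
              end = solve-ℕ
              hull′ : ∀ j → j ℕ.≤ L ℕ.+ suc y₀ → Bad (lo ℕ.+ 0 ℕ.+ Y′ ℕ.+ j) ⊎
                      lo ℕ.+ 0 ℕ.+ Y′ ℕ.+ j ≡ lo ℕ.+ (Y ∸ suc y₀)
              hull′ zero j≤ = inj₂ (trans (shuffle lo Y′) (cong (lo ℕ.+_) (sym Y∸)))
                where
                shuffle : ∀ lo Y′ → lo ℕ.+ 0 ℕ.+ Y′ ℕ.+ 0 ≡ lo ℕ.+ Y′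
                shuffle = solve-ℕ
              hull′ (suc j) j≤ with ℕ.≤-total (suc j) (suc y₀)
              ... | inj₂ y≤j with ℕ.m≤n⇒∃[o]m+o≡n y≤j
              ...   | j′ , refl = inj₁ (subst Bad
                        (trans (cong (λ z → lo ℕ.+ z ℕ.+ j′) (sym eq)) (shuffle lo y₀ Y′ j′))
                        (hull j′ (ℕ.+-cancelʳ-≤ (suc y₀) j′ L (ℕ.≤-trans (ℕ.≤-reflexive (ℕ.+-comm j′ (suc y₀))) j≤))))
                where
                shuffle : ∀ lo y Y′ j → lo ℕ.+ (suc y ℕ.+ Y′) ℕ.+ j ≡ lo ℕ.+ 0 ℕ.+ Y′ ℕ.+ (suc y ℕ.+ j)
                shuffle = solve-ℕ
              hull′ (suc j) j≤ | inj₁ (s≤s j≤y₀) with ℕ.m≤n⇒∃[o]m+o≡n j≤y₀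
              ... | y , refl = inj₁ (subst Bad (trans (cong (lo ℕ.+_) left) (shuffle′ lo Y′ j))
                                           (proj₂ (sides y (ℕ.m≤n+m y j))))
                where
                shuffle : ∀ j y Y′ → suc (j ℕ.+ y) ℕ.+ Y′ ≡ Y′ ℕ.+ suc j ℕ.+ y
                shuffle = solve-ℕ
                shuffle′ : ∀ lo Y′ j → lo ℕ.+ (Y′ ℕ.+ suc j) ≡ lo ℕ.+ 0 ℕ.+ Y′ ℕ.+ suc j
                shuffle′ = solve-ℕ
                left : Y ∸ y ≡ Y′ ℕ.+ suc j
                left = trans (cong (_∸ y) (trans (sym eq) (shuffle j y Y′))) (ℕ.m+n∸n≡m (Y′ ℕ.+ suc j) y)

        stages : ∀ {i} → Stage 0 → i ℕ.* μ ℕ.< k → Stage i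
        stages {zero}  st _    = st
        stages {suc i} st room = next-stage (stages st (ℕ.≤-<-trans (ℕ.m≤n+m (i ℕ.* μ) μ) room)) room

        clique-⊑-G : ∀ i → Stage 0 → suc i ℕ.* μ ℕ.< k → K (suc (suc (suc i))) ⊑ G
        clique-⊑-G i st room = clique-⊑ G (node ∘ extended (proj₁ last)) (extended-clique (proj₂ last))
          where
          stage = stages st (ℕ.≤-<-trans (ℕ.m≤n+m (i ℕ.* μ) μ) room)
          open Stage stage
          last : ∃[ x ] ¬ Bad x
          last = clique-suc stage room

      private
        Joined : ℕ → Set
        Joined d = 0 ℕ.< d × ∃[ u ] Adj G u (node (toℕ u ℕ.+ d))

        joined? : ∀ d → Dec (Joined d)
        joined? d = (0 ℕ.<? d) ×-dec Fin.any? λ u → adj? G u (node (toℕ u ℕ.+ d))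

        joined : ∀ {x d} → 0 ℕ.< d → x ~ (x ℕ.+ d) → Joined d
        joined {x} {d} 0<d a = 0<d , node x ,
          subst (Adj G (node x)) (sym (node-+ d (node-toℕ (node x)))) a

        some-joined : ∀ {u v} → Adj G u v → ∃[ d ] d ℕ.≤ k × Joined d
        some-joined {u} {v} a with walk-lift k (toℕ u ℕ.+ k ℕ.* n) (proj₂ (sub u v a))
            (trans (node-+*n (toℕ u) k) (node-toℕ u)) (ℕ.≤-trans (ℕ.m≤m*n k n) (ℕ.m≤n+m (k ℕ.* n) (toℕ u)))
        ... | y , yv , x≤y+k , y≤x+k = orient (ℕ.≤-total x y)
          where
          x = toℕ u ℕ.+ k ℕ.* n
          xu : node x ≡ u
          xu = trans (node-+*n (toℕ u) k) (node-toℕ u)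
          positive : ∀ z d → z ~ (z ℕ.+ d) → 0 ℕ.< d
          positive z zero    b = ⊥-elim (irrefl G (cong node (sym (ℕ.+-identityʳ z))) b)
          positive z (suc d) b = s≤s z≤n
          orient : x ℕ.≤ y ⊎ y ℕ.≤ x → ∃[ d ] d ℕ.≤ k × Joined d
          orient (inj₁ x≤y) with ℕ.m≤n⇒∃[o]m+o≡n x≤y
          ... | d , eq = d , ℕ.+-cancelˡ-≤ x d k (ℕ.≤-trans (ℕ.≤-reflexive eq) y≤x+k) , joined (positive x d b) b
            where
            b : x ~ (x ℕ.+ d)
            b = subst₂ (Adj G) (sym xu) (trans (sym yv) (cong node (sym eq))) a
          orient (inj₂ y≤x) with ℕ.m≤n⇒∃[o]m+o≡n y≤x
          ... | d , eq = d , ℕ.+-cancelˡ-≤ y d k (ℕ.≤-trans (ℕ.≤-reflexive eq) x≤y+k) , joined (positive y d b) b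
            where
            b : y ~ (y ℕ.+ d)
            b = subst₂ (Adj G) (sym yv) (trans (sym xu) (cong node (sym eq))) (adj-sym G a)

        shortest : ∀ {u v} → Adj G u v → ∃[ d ] d ℕ.≤ k × Joined d × (∀ j → j ℕ.< d → ¬ Joined j)
        shortest a with some-joined a
        ... | d₀ , d₀≤k , J with least joined? (suc d₀)
        ...   | inj₁ (d , s≤s d≤d₀ , Jd , min) = d , ℕ.≤-trans d≤d₀ d₀≤k , Jd , min
        ...   | inj₂ none                      = ⊥-elim (none d₀ ℕ.≤-refl J)

        -- The d − 1 positions strictly between the ends of a shortest edge are missed by both
        -- ends, which is what B may save over 2μ.
        first-stage : ∀ d₁ → suc d₁ ℕ.≤ k → Joined (suc d₁) → (∀ j → j ℕ.< suc d₁ → ¬ Joined j) →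
                      Stage (suc d₁) (s≤s z≤n) 0
        first-stage d₁ d≤k (_ , u , a) min with ℕ.m≤n⇒∃[o]m+o≡n d≤k
        ... | Y , d+Y≡k with ℕ.m≤n⇒∃[o]m+o≡n (ℕ.≤-trans (ℕ.≤-trans (ℕ.m≤n+m Y (suc d₁)) (ℕ.≤-reflexive d+Y≡k)) (ℕ.m≤m*n k n))
        ...   | r , Y+r≡kn = record
          { h = h ; clique = clique ; lo = lo ; L = d ; Y = Y ; L+Y≡k = d+Y≡k
          ; hull = hull ; B = + 2 * + μ - + d₁ ; count = count
          ; B≤ = ℤ.≤-reflexive (B-identity (+ μ) (+ d₁)) ; L+B≤ = ℤ.≤-reflexive (L-identity (+ μ) (+ d₁)) }
          where
          d = suc d₁
          -- Since `Y + r` is k full turns, `lo + Y` is a position above `u` with `Y` positions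
          -- available to its left.
          lo = toℕ u ℕ.+ r
          x₀ = lo ℕ.+ Y
          x₁ = lo ℕ.+ Y ℕ.+ d
          x₀u : node x₀ ≡ u
          x₀u = trans (cong node (trans (ℕ.+-assoc (toℕ u) r Y) (cong (toℕ u ℕ.+_) (trans (ℕ.+-comm r Y) Y+r≡kn))))
                      (trans (node-+*n (toℕ u) k) (node-toℕ u))
          edge : x₀ ~ x₁
          edge = subst₂ (Adj G) (sym x₀u) (node-+ d (trans (node-toℕ u) (sym x₀u))) a
          h : Fin 2 → ℕ
          h zero       = x₀
          h (suc zero) = x₁
          clique : ∀ a b → a ≢ b → h a ~ h b
          clique zero       zero       ne = ⊥-elim (ne refl)
          clique zero       (suc zero) ne = edge
          clique (suc zero) zero       ne = adj-sym G edge
          clique (suc zero) (suc zero) ne = ⊥-elim (ne refl)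
          Bad : ℕ → Set
          Bad y = ∃[ a ] ¬ (h a ~ y)
          bad? : ∀ y → Dec (Bad y)
          bad? y = Fin.any? λ a → ¬? (h a ~? y)
          inside₀ : ∀ j → j ℕ.< d₁ → ¬ (x₀ ~ (x₀ ℕ.+ suc j))
          inside₀ j j<d₁ b = min (suc j) (s≤s j<d₁) (joined (s≤s z≤n) b)
          inside₁ : ∀ j → j ℕ.< d₁ → ¬ (x₁ ~ (x₀ ℕ.+ suc j))
          inside₁ j j<d₁ b with ℕ.m≤n⇒∃[o]m+o≡n j<d₁
          ... | o , refl = min (suc o) (s≤s (ℕ.m<n+m o (s≤s z≤n)))
            (joined (s≤s z≤n) (subst (λ z → (x₀ ℕ.+ suc j) ~ z) (shuffle x₀ j o) (adj-sym G b)))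
            where
            shuffle : ∀ x j o → x ℕ.+ suc (suc j ℕ.+ o) ≡ x ℕ.+ suc j ℕ.+ suc o
            shuffle = solve-ℕ
          hull : ∀ j → j ℕ.≤ d → Bad (x₀ ℕ.+ j)
          hull zero    _ = zero , irrefl G (cong node (sym (ℕ.+-identityʳ x₀)))
          hull (suc j) (s≤s j≤d₁) with ℕ.m≤n⇒m<n∨m≡n j≤d₁
          ... | inj₁ j<d₁ = zero , inside₀ j j<d₁
          ... | inj₂ refl = suc zero , irrefl G refl
          w = suc (d ℕ.+ Y ℕ.+ Y)
          Inner : ℕ → Set
          Inner y = ¬ (x₀ ~ y) × ¬ (x₁ ~ y)
          inner? : ∀ y → Dec (Inner y)
          inner? y = ¬? (x₀ ~? y) ×-dec ¬? (x₁ ~? y)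
          inclusion-exclusion : ∀ y → 𝟙 (bad? y) ≤ miss x₀ y + miss x₁ y - 𝟙 (inner? y)
          inclusion-exclusion y = 𝟙-union (bad? y) (x₀ ~? y) (x₁ ~? y)
            λ { b₀ b₁ (zero , nb) → nb b₀ ; b₀ b₁ (suc zero , nb) → nb b₁ }
          inner-count : + d₁ ≤ ∑ w (λ j → 𝟙 (inner? (lo ℕ.+ j)))
          inner-count = ∑-interval≥ w (suc Y) d₁ (ℕ.≤-trans (ℕ.m≤m+n (suc Y ℕ.+ d₁) (suc Y)) (ℕ.≤-reflexive (shuffle Y d₁)))
            (λ j → 0≤𝟙 (inner? (lo ℕ.+ j)))
            (λ j j<d₁ → 𝟙-yes (inner? (lo ℕ.+ (suc Y ℕ.+ j)))
              (subst Inner (shuffle′ lo Y j) (inside₀ j j<d₁ , inside₁ j j<d₁)))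
            where
            shuffle : ∀ Y d₁ → suc Y ℕ.+ d₁ ℕ.+ suc Y ≡ suc (suc d₁ ℕ.+ Y ℕ.+ Y)
            shuffle = solve-ℕ
            shuffle′ : ∀ lo Y j → lo ℕ.+ Y ℕ.+ suc j ≡ lo ℕ.+ (suc Y ℕ.+ j)
            shuffle′ = solve-ℕ
          k≡ : lo ℕ.+ Y ℕ.+ d ≡ lo ℕ.+ k
          k≡ = trans (ℕ.+-assoc lo Y d) (cong (lo ℕ.+_) (trans (ℕ.+-comm Y d) d+Y≡k))
          miss₀ : ∑ w (λ j → miss x₀ (lo ℕ.+ j)) ≤ + μ
          miss₀ = missing≤ x₀ lo w edge
            (ℕ.+-monoʳ-≤ lo (ℕ.≤-trans (ℕ.m≤n+m Y d) (ℕ.≤-reflexive d+Y≡k)))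
            (ℕ.≤-reflexive (trans (shuffle lo Y d) (cong (λ z → x₀ ℕ.+ suc z) d+Y≡k)))
            where
            shuffle : ∀ lo Y d → lo ℕ.+ suc (d ℕ.+ Y ℕ.+ Y) ≡ lo ℕ.+ Y ℕ.+ suc (d ℕ.+ Y)
            shuffle = solve-ℕ
          miss₁ : ∑ w (λ j → miss x₁ (lo ℕ.+ j)) ≤ + μ
          miss₁ = missing≤ x₁ lo w (adj-sym G edge) (ℕ.≤-reflexive k≡)
            (ℕ.≤-trans (ℕ.≤-reflexive (shuffle lo Y d))
              (ℕ.+-monoʳ-≤ x₁ (s≤s (ℕ.≤-trans (ℕ.m≤n+m Y d) (ℕ.≤-reflexive d+Y≡k)))))
            where
            shuffle : ∀ lo Y d → lo ℕ.+ suc (d ℕ.+ Y ℕ.+ Y) ≡ lo ℕ.+ Y ℕ.+ d ℕ.+ suc Y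
            shuffle = solve-ℕ
          count : ∑ w (λ j → 𝟙 (bad? (lo ℕ.+ j))) ≤ + 2 * + μ - + d₁
          count = begin
            ∑ w (λ j → 𝟙 (bad? (lo ℕ.+ j)))
              ≤⟨ ∑-mono w (λ j _ → inclusion-exclusion (lo ℕ.+ j)) ⟩
            ∑ w (λ j → miss x₀ (lo ℕ.+ j) + miss x₁ (lo ℕ.+ j) - 𝟙 (inner? (lo ℕ.+ j)))
              ≡⟨ trans (∑-+ w _ _) (cong₂ _+_ (∑-+ w _ _)
                   (trans (∑-cong′ w λ j → sym (ℤ.-1*i≡-i (𝟙 (inner? (lo ℕ.+ j))))) (∑-* w ℤ.-1ℤ _))) ⟩
            M₀ + M₁ + ℤ.-1ℤ * I
              ≤⟨ ≤-by (0≤-diff miss₀ ⊕ 0≤-diff miss₁ ⊕ 0≤-diff inner-count) (identity (+ μ) (+ d₁) M₀ M₁ I) ⟩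
            + 2 * + μ - + d₁ ∎
            where
            open ℤ.≤-Reasoning
            M₀ = ∑ w (λ j → miss x₀ (lo ℕ.+ j))
            M₁ = ∑ w (λ j → miss x₁ (lo ℕ.+ j))
            I = ∑ w (λ j → 𝟙 (inner? (lo ℕ.+ j)))
            identity : ∀ μ d M₀ M₁ I → + 2 * μ - d ≡ M₀ + M₁ + - 1ℤ * I + ((μ - M₀) + ((μ - M₁) + (I - d)))
            identity = solve-∀
          B-identity : ∀ μ d₁ → + 2 * μ - d₁ + (1ℤ + d₁) ≡ (1ℤ + 1ℤ + 0ℤ) * μ + 1ℤ
          B-identity = solve-∀
          L-identity : ∀ μ d₁ → 1ℤ + d₁ + (+ 2 * μ - d₁) ≡ + 2 * ((1ℤ + 0ℤ) * μ) + 1ℤ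
          L-identity = solve-∀

      large-degree-clique : ∀ i {u v} → Adj G u v → suc i ℕ.* μ ℕ.< k → K (suc (suc (suc i))) ⊑ G
      large-degree-clique i a room with shortest a
      ... | suc d₁ , d≤k , J , min = clique-⊑-G (suc d₁) (s≤s z≤n) i (first-stage d₁ d≤k J min) room

  -- Numerical estimates for densities and average degrees

  <-scaled : ∀ {m a b c} → 0ℤ ≤ m → 1ℤ ≤ c → m * a + c ≤ m * b → a < b
  <-scaled {m} {a} {b} {c} 0≤m 1≤c le = ℤ.*-cancelˡ-<-nonNeg m {{ℤ.nonNegative 0≤m}}
    (ℤ.<-≤-trans (ℤ.≤-<-trans (ℤ.≤-reflexive (sym (ℤ.+-identityʳ (m * a))))
      (ℤ.+-monoʳ-< (m * a) (ℤ.<-≤-trans (ℤ.+<+ ℕ.0<1+n) 1≤c))) le)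

  -- The integral form `1ℤ + + 3 * B ≤ + 5 * A` of 3/5 < A/B leaves a surplus k n in 5 (A e - x B).
  -- From it, 5 B n pays for the linear term of the degree bound and 5 A k² for the edges missing at
  -- the seam.
  density-upper : ∀ {k n A B x e} → 0ℤ ≤ B → 0ℤ ≤ n →
    + 10 * (k * (+ 2 * x)) ≤ n * (+ 12 * (k * k) + + 20 * k) → (n - k) * k ≤ e →
    1ℤ + + 3 * B ≤ + 5 * A → 1ℤ + + 5 * B ≤ k → 1ℤ + + 5 * (A * (k * k)) ≤ n → x * B < A * e
  density-upper {k} {n} {A} {B} {x} {e} 0≤B 0≤n few many gap k-large n-large =
    <-scaled (0≤+n {20} ⊛ 0≤k) (ℤ.≤-trans 1≤k (≤-by (0≤+n {3} ⊛ 0≤k) (four k)))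
      (≤-by (0≤+n {20} ⊛ 0≤k ⊛ 0≤A ⊛ 0≤-diff many ⊕ 0≤B ⊛ 0≤-diff few
             ⊕ 0≤+n {4} ⊛ 0≤k ⊛ (0≤n ⊛ 0≤k ⊛ 0≤-diff gap ⊕ 0≤n ⊛ 0≤-diff k-large ⊕ 0≤-diff n-large))
            (identity k n A B x e))
    where
    1≤k : 1ℤ ≤ k
    1≤k = ℤ.≤-trans (≤-by (0≤+n {5} ⊛ 0≤B) refl) k-large
    0≤k : 0ℤ ≤ k
    0≤k = ℤ.≤-trans (0≤+n {1}) 1≤k
    0≤A : 0ℤ ≤ A
    0≤A = ℤ.*-cancelˡ-≤-pos 0ℤ A (+ 5) (ℤ.≤-trans (0≤+n {1} ⊕ 0≤+n {3} ⊛ 0≤B) gap)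
    four : ∀ k → + 4 * k ≡ k + + 3 * k
    four = solve-∀
    identity : ∀ k n A B x e → + 20 * k * (A * e) ≡ + 20 * k * (x * B) + + 4 * k +
      (+ 20 * (k * (A * (e - (n - k) * k))) + (B * (n * (+ 12 * (k * k) + + 20 * k) - + 10 * (k * (+ 2 * x)))
       + + 4 * (k * (n * (k * (+ 5 * A - (1ℤ + + 3 * B))) + (n * (k - (1ℤ + + 5 * B)) + (n - (1ℤ + + 5 * (A * (k * k)))))))))
    identity = solve-∀

  module _ {s E D j N n x : ℤ} (0≤s : 0ℤ ≤ s) (0≤E : 0ℤ ≤ E) (0≤D : 0ℤ ≤ D) (1≤j : 1ℤ ≤ j) (0≤N : 0ℤ ≤ N) (0≤n : 0ℤ ≤ n) where
    private
      b = E * j + D * j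
      k = s * b + E * j
      0≤j : 0ℤ ≤ j
      0≤j = ℤ.≤-trans (0≤+n {1}) 1≤j

    -- With Q = E + D and P = s Q + E, the limiting density of the construction is (2 s Q² - D²) /
    -- (2 Q P). The hypothesis `root` says exactly that this is at least D / Q, and `gap` puts A / B
    -- below D / Q by a margin that pays for the boundary once `n` is large.
    density-lower : ∀ {A B e} → 0ℤ ≤ A → 0ℤ ≤ B → 1ℤ ≤ s * (E + D) + E →
      N * (+ 2 * (s * (b * b)) - D * j * (D * j) + D * j) ≤ + 2 * x → e ≤ n * k → n ≤ N * b + b + k →
      (E + D) * (E + D) ≤ + 2 * (s * ((E + D) * E)) + E * E →
      1ℤ + A * (E + D) ≤ B * D → 1ℤ + B * (D * (b + k)) ≤ n → A * e < x * B
    density-lower {A} {B} {e} 0≤A 0≤B 1≤P many few blocks root gap n-large =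
      <-scaled {+ 2 * (E + D)} {A * e} {x * B} {+ 2 * ((s * (E + D) + E) * j)} (0≤+n {2} ⊛ (0≤E ⊕ 0≤D))
        (ℤ.≤-trans 1≤P (≤-by (0≤P ⊛ 0≤-diff 1≤j ⊕ 0≤P ⊛ 0≤j) (double (s * (E + D) + E) j)))
        (≤-by ((0≤Q ⊛ 0≤B ⊛ 0≤-diff many) ⊕ (0≤+n {2} ⊛ 0≤Q ⊛ 0≤A ⊛ 0≤-diff few)
               ⊕ (0≤Q ⊛ 0≤B ⊛ 0≤N ⊛ 0≤j ⊛ 0≤j ⊛ 0≤-diff root) ⊕ (0≤Q ⊛ 0≤B ⊛ 0≤N ⊛ 0≤D ⊛ 0≤j)
               ⊕ (0≤+n {2} ⊛ 0≤P ⊛ 0≤D ⊛ 0≤j ⊛ 0≤B ⊛ 0≤-diff blocks)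
               ⊕ (0≤+n {2} ⊛ 0≤P ⊛ 0≤j ⊛ (0≤n ⊛ 0≤-diff gap ⊕ 0≤-diff n-large)))
              (identity s E D j N n x A B e))
      where
      0≤Q : 0ℤ ≤ E + D
      0≤Q = 0≤E ⊕ 0≤D
      0≤P : 0ℤ ≤ s * (E + D) + E
      0≤P = 0≤s ⊛ 0≤Q ⊕ 0≤E
      double : ∀ P j → + 2 * (P * j) ≡ P + (P * (j - 1ℤ) + P * j)
      double = solve-∀
      identity : ∀ s E D j N n x A B e →
        + 2 * (E + D) * (x * B) ≡ + 2 * (E + D) * (A * e) + + 2 * ((s * (E + D) + E) * j) +
        ((E + D) * (B * (+ 2 * x - N * (+ 2 * (s * ((E * j + D * j) * (E * j + D * j))) - D * j * (D * j) + D * j)))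
         + (+ 2 * ((E + D) * (A * (n * (s * (E * j + D * j) + E * j) - e)))
         + ((E + D) * (B * (N * (j * (j * (+ 2 * (s * ((E + D) * E)) + E * E - (E + D) * (E + D))))))
         + ((E + D) * (B * (N * (D * j)))
         + (+ 2 * ((s * (E + D) + E) * (D * (j * (B * (N * (E * j + D * j) + (E * j + D * j) + (s * (E * j + D * j) + E * j) - n)))))
         + + 2 * ((s * (E + D) + E) * (j * (n * (B * D - (1ℤ + A * (E + D)))
                  + (n - (1ℤ + B * (D * (E * j + D * j + (s * (E * j + D * j) + E * j)))))))))))))
      identity = solve-∀

  -- For large `n` the average degree guaranteed is about F / b = 2 s b - b + 2 e′ + 1 - e′ (e′ + 1)
  -- / b, while (2 - 1/s) k + 1 = 2 s b - b + 2 e′ + 1 - e′ / s. So the threshold is beaten when s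
  -- (e′ + 1) < b and e′ is positive; e′ = 0 would only tie.
  average-degree-lower : ∀ {s e′ d N n x} → 1ℤ ≤ s → 1ℤ ≤ e′ → 0ℤ ≤ d → 0ℤ ≤ n →
    let b = e′ + d ; k = s * b + e′ ; F = + 2 * (s * (b * b)) - d * d + d in
    N * F ≤ + 2 * x → n ≤ N * b + b + k → 1ℤ + s * (e′ + 1ℤ) ≤ b → 1ℤ + s * ((b + k) * F) ≤ n →
    (+ 2 * (s * k) - k + s) * n < + 2 * x * s
  average-degree-lower {s} {e′} {d} {N} {n} {x} 1≤s 1≤e′ 0≤d 0≤n many blocks b-large n-large =
    <-scaled {e′ + d} (0≤e′ ⊕ 0≤d) ℤ.≤-refl
      (≤-by ((0≤b ⊛ 0≤s ⊛ 0≤-diff many)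
             ⊕ (0≤s ⊛ (0≤+n {2} ⊛ 0≤-diff 1≤s ⊛ 0≤b ⊛ 0≤b ⊕ 0≤b ⊛ 0≤b ⊕ 0≤e′ ⊛ 0≤e′ ⊕ 0≤+n {2} ⊛ 0≤e′ ⊛ 0≤d ⊕ 0≤d)
                ⊛ 0≤-diff blocks)
             ⊕ (0≤n ⊛ 0≤e′ ⊛ 0≤-diff b-large ⊕ 0≤n ⊛ 0≤-diff 1≤e′) ⊕ 0≤-diff n-large)
            (identity s e′ d N n x))
    where
    0≤s : 0ℤ ≤ s
    0≤s = ℤ.≤-trans (0≤+n {1}) 1≤s
    0≤e′ : 0ℤ ≤ e′
    0≤e′ = ℤ.≤-trans (0≤+n {1}) 1≤e′
    0≤b : 0ℤ ≤ e′ + d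
    0≤b = 0≤e′ ⊕ 0≤d
    identity : ∀ s e′ d N n x →
      (e′ + d) * (+ 2 * x * s) ≡ (e′ + d) * ((+ 2 * (s * (s * (e′ + d) + e′)) - (s * (e′ + d) + e′) + s) * n) + 1ℤ +
      ((e′ + d) * (s * (+ 2 * x - N * (+ 2 * (s * ((e′ + d) * (e′ + d))) - d * d + d)))
       + (s * ((+ 2 * ((s - 1ℤ) * ((e′ + d) * (e′ + d))) + ((e′ + d) * (e′ + d) + (e′ * e′ + (+ 2 * (e′ * d) + d))))
               * (N * (e′ + d) + (e′ + d) + (s * (e′ + d) + e′) - n))
       + ((n * (e′ * (e′ + d - (1ℤ + s * (e′ + 1ℤ)))) + n * (e′ - 1ℤ))
       + (n - (1ℤ + s * ((e′ + d + (s * (e′ + d) + e′)) * (+ 2 * (s * ((e′ + d) * (e′ + d))) - d * d + d)))))))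
    identity = solve-∀

-- Rational arithmetic, the cuts of a - √N and their expansion

module Surds where
  open import Data.Rational using (_≤_; _<_; _+_; _-_; _*_; -_; _/_)

  ι : ℤ → ℚ
  ι i = i / 1

  ι-toℚᵘ : ∀ i → toℚᵘ (ι i) ℚᵘ.≃ mkℚᵘ i 0
  ι-toℚᵘ i = ℚ.toℚᵘ-fromℚᵘ (mkℚᵘ i 0)

  ι-+ : ∀ i j → ι (i ℤ.+ j) ≡ ι i + ι j
  ι-+ i j = ℚ.toℚᵘ-injective (begin
    toℚᵘ (ι (i ℤ.+ j))             ≈⟨ ι-toℚᵘ (i ℤ.+ j) ⟩
    mkℚᵘ (i ℤ.+ j) 0               ≈⟨ *≡* (identity i j) ⟩
    mkℚᵘ i 0 ℚᵘ.+ mkℚᵘ j 0         ≈⟨ ℚᵘ.+-cong (ι-toℚᵘ i) (ι-toℚᵘ j) ⟨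
    toℚᵘ (ι i) ℚᵘ.+ toℚᵘ (ι j)     ≈⟨ ℚ.toℚᵘ-homo-+ (ι i) (ι j) ⟨
    toℚᵘ (ι i + ι j)               ∎)
    where
    open ℚᵘ.≃-Reasoning
    identity : ∀ i j → (i ℤ.+ j) ℤ.* 1ℤ ≡ (i ℤ.* 1ℤ ℤ.+ j ℤ.* 1ℤ) ℤ.* 1ℤ
    identity = ℤ-Solver.solve-∀

  ι-* : ∀ i j → ι (i ℤ.* j) ≡ ι i * ι j
  ι-* i j = ℚ.toℚᵘ-injective (begin
    toℚᵘ (ι (i ℤ.* j))             ≈⟨ ι-toℚᵘ (i ℤ.* j) ⟩
    mkℚᵘ (i ℤ.* j) 0               ≈⟨ ℚᵘ.*-cong (ι-toℚᵘ i) (ι-toℚᵘ j) ⟨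
    toℚᵘ (ι i) ℚᵘ.* toℚᵘ (ι j)     ≈⟨ ℚ.toℚᵘ-homo-* (ι i) (ι j) ⟨
    toℚᵘ (ι i * ι j)               ∎)
    where open ℚᵘ.≃-Reasoning

  ι-neg : ∀ i → ι (ℤ.- i) ≡ - ι i
  ι-neg i = ℚ.toℚᵘ-injective (begin
    toℚᵘ (ι (ℤ.- i))       ≈⟨ ι-toℚᵘ (ℤ.- i) ⟩
    mkℚᵘ (ℤ.- i) 0         ≈⟨ ℚᵘ.-‿cong (ι-toℚᵘ i) ⟨
    ℚᵘ.- toℚᵘ (ι i)        ≈⟨ ℚ.toℚᵘ-homo‿- (ι i) ⟨
    toℚᵘ (- ι i)           ∎)
    where open ℚᵘ.≃-Reasoning

  ι-minus : ∀ i j → ι (i ℤ.- j) ≡ ι i - ι j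
  ι-minus i j = trans (ι-+ i (ℤ.- j)) (cong (λ z → ι i + z) (ι-neg j))

  ι-mono-< : ∀ {i j} → i ℤ.< j → ι i < ι j
  ι-mono-< {i} {j} i<j = ℚ.toℚᵘ-cancel-< (ℚᵘ.<-respʳ-≃ (ℚᵘ.≃-sym (ι-toℚᵘ j)) (ℚᵘ.<-respˡ-≃ (ℚᵘ.≃-sym (ι-toℚᵘ i))
    (*<* (ℤ.*-monoʳ-<-pos 1ℤ i<j))))

  ι-mono-≤ : ∀ {i j} → i ℤ.≤ j → ι i ≤ ι j
  ι-mono-≤ {i} {j} i≤j = ℚ.toℚᵘ-cancel-≤ (ℚᵘ.≤-respʳ-≃ (ℚᵘ.≃-sym (ι-toℚᵘ j)) (ℚᵘ.≤-respˡ-≃ (ℚᵘ.≃-sym (ι-toℚᵘ i))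
    (*≤* (ℤ.*-monoʳ-≤-nonNeg 1ℤ i≤j))))

  ι-cancel-< : ∀ {i j} → ι i < ι j → i ℤ.< j
  ι-cancel-< {i} {j} lt = ℤ.≰⇒> λ j≤i → ℚ.<-irrefl refl (ℚ.<-≤-trans lt (ι-mono-≤ j≤i))

  ι-cancel-≤ : ∀ {i j} → ι i ≤ ι j → i ℤ.≤ j
  ι-cancel-≤ {i} {j} le = ℤ.≮⇒≥ λ j<i → ℚ.<-irrefl refl (ℚ.<-≤-trans (ι-mono-< j<i) le)

  0<ι : ∀ n → 0ℚ < ι (+ suc n)
  0<ι n = ι-mono-< {0ℤ} {+ suc n} (ℤ.+<+ (s≤s z≤n))

  0≤ι : ∀ n → 0ℚ ≤ ι (+ n)
  0≤ι n = ι-mono-≤ {0ℤ} {+ n} (ℤ.+≤+ z≤n)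

  ÷-* : ∀ a b → a ÷ suc b * ι (+ suc b) ≡ ι (+ a)
  ÷-* a b = ℚ.toℚᵘ-injective (begin
    toℚᵘ (a ÷ suc b * ι (+ suc b))              ≈⟨ ℚ.toℚᵘ-homo-* (a ÷ suc b) (ι (+ suc b)) ⟩
    toℚᵘ (a ÷ suc b) ℚᵘ.* toℚᵘ (ι (+ suc b))    ≈⟨ ℚᵘ.*-cong (ℚ.toℚᵘ-fromℚᵘ (mkℚᵘ (+ a) b)) (ι-toℚᵘ (+ suc b)) ⟩
    mkℚᵘ (+ a) b ℚᵘ.* mkℚᵘ (+ suc b) 0          ≈⟨ *≡* (trans (ℤ.*-identityʳ _) (cong (+ a ℤ.*_) (cong +_ (sym (ℕ.*-identityʳ (suc b)))))) ⟩
    mkℚᵘ (+ a) 0                                ≈⟨ ι-toℚᵘ (+ a) ⟨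
    toℚᵘ (ι (+ a))                              ∎)
    where open ℚᵘ.≃-Reasoning

  ↥-↧ : ∀ q → q * ι (↧ q) ≡ ι (↥ q)
  ↥-↧ q@(mkℚ a b _) = ℚ.toℚᵘ-injective (begin
    toℚᵘ (q * ι (+ suc b))                      ≈⟨ ℚ.toℚᵘ-homo-* q (ι (+ suc b)) ⟩
    mkℚᵘ a b ℚᵘ.* toℚᵘ (ι (+ suc b))            ≈⟨ ℚᵘ.*-cong (ℚᵘ.≃-refl {mkℚᵘ a b}) (ι-toℚᵘ (+ suc b)) ⟩
    mkℚᵘ a b ℚᵘ.* mkℚᵘ (+ suc b) 0              ≈⟨ *≡* (trans (ℤ.*-identityʳ _) (cong (a ℤ.*_) (cong +_ (sym (ℕ.*-identityʳ (suc b)))))) ⟩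
    mkℚᵘ a 0                                    ≈⟨ ι-toℚᵘ a ⟨
    toℚᵘ (ι a)                                  ∎)
    where open ℚᵘ.≃-Reasoning

  0<⇒<÷ : ∀ q a b → 0 ℕ.< b → ↥ q ℤ.* + b ℤ.< + a ℤ.* ↧ q → q < a ÷ b
  0<⇒<÷ (mkℚ _ _ _) a (suc b) _ lt = ℚ.toℚᵘ-cancel-<
    (ℚᵘ.<-respʳ-≃ (ℚᵘ.≃-sym (ℚ.toℚᵘ-fromℚᵘ (mkℚᵘ (+ a) b))) (*<* lt))

  ÷< : ∀ q a b → 0 ℕ.< b → + a ℤ.* ↧ q ℤ.< ↥ q ℤ.* + b → a ÷ b < q
  ÷< (mkℚ _ _ _) a (suc b) _ lt = ℚ.toℚᵘ-cancel-<
    (ℚᵘ.<-respˡ-≃ (ℚᵘ.≃-sym (ℚ.toℚᵘ-fromℚᵘ (mkℚᵘ (+ a) b))) (*<* lt))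

  0≤÷ : ∀ a b → 0ℚ ≤ a ÷ b
  0≤÷ a zero    = ℚ.≤-refl
  0≤÷ a (suc b) = ℚ.toℚᵘ-cancel-≤ (ℚᵘ.≤-respʳ-≃ (ℚᵘ.≃-sym (ℚ.toℚᵘ-fromℚᵘ (mkℚᵘ (+ a) b)))
    (*≤* (ℤ.≤-trans (ℤ.+≤+ z≤n) (ℤ.≤-reflexive (sym (ℤ.*-identityʳ (+ a)))))))

  ι-homomorphism : ℤ.+-*-rawRing -Raw-AlmostCommutative⟶ fromCommutativeRing ℚ.+-*-commutativeRing
  ι-homomorphism = record
    { ⟦_⟧ = ι ; +-homo = ι-+ ; *-homo = ι-* ; -‿homo = ι-neg ; 0-homo = refl ; 1-homo = refl }

  ι-≟ : ∀ i j → Maybe (ι i ≡ ι j)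
  ι-≟ i j with i ℤ.≟ j
  ... | yes refl = just refl
  ... | no _     = nothing
  open Ring-Solver ℤ.+-*-rawRing (fromCommutativeRing ℚ.+-*-commutativeRing) ι-homomorphism ι-≟
    using (solve; _:=_; _:+_; _:*_; _:-_; :-_; con) public

  ÷-*′ : ∀ a b → 0 ℕ.< b → a ÷ b * ι (+ b) ≡ ι (+ a)
  ÷-*′ a (suc b) _ = ÷-* a b

  shift-< : ∀ {p q p′ q′} c → p < q → p + c ≡ p′ → q + c ≡ q′ → p′ < q′
  shift-< c p<q refl refl = ℚ.+-monoˡ-< c p<q

  *-inverse-unique : ∀ {x y c} → x * c ≡ 1ℚ → y * c ≡ 1ℚ → x ≡ y
  *-inverse-unique {x} {y} {c} xc yc = begin
    x              ≡⟨ ℚ.*-identityʳ x ⟨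
    x * 1ℚ         ≡⟨ cong (x *_) yc ⟨
    x * (y * c)    ≡⟨ exchange x y c ⟩
    y * (x * c)    ≡⟨ cong (y *_) xc ⟩
    y * 1ℚ         ≡⟨ ℚ.*-identityʳ y ⟩
    y              ∎
    where
    open ≡-Reasoning
    exchange : ∀ x y c → x * (y * c) ≡ y * (x * c)
    exchange = solve 3 (λ x y c → x :* (y :* c) := y :* (x :* c)) refl

  square-cancel : ∀ {r s} → 0ℚ ≤ s → r * r ≤ s * s → r ≤ s
  square-cancel {r} {s} 0≤s rr≤ss = ℚ.≮⇒≥ λ s<r → ℚ.<-irrefl refl (ℚ.<-≤-trans
    (ℚ.≤-<-trans (ℚ.*-monoˡ-≤-nonNeg s {{ℚ.nonNegative 0≤s}} (ℚ.<⇒≤ s<r))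
                 (ℚ.*-monoˡ-<-pos r {{ℚ.positive (ℚ.≤-<-trans 0≤s s<r)}} s<r))
    rr≤ss)

  module _ (a : ℚ) (N : ℕ) where
    private
      x : Cut
      x = ⟦ a ⟧ -ᶜ √ N

    -- These four lemmas describe the cut by a single rational `r` on the proper side of the root,
    -- instead of the two summands and the negation inside `_-ᶜ_`.
    lower-surd⁻ : ∀ {q} → lower x q → ∃[ r ] 0ℚ ≤ r × fromℕ N ≤ r * r × q < a - r
    lower-surd⁻ {q} (p , p′ , p<a , (r , r<-p′ , 0≤r , N≤rr) , q<p+p′) =
      r , 0≤r , N≤rr , ℚ.<-trans q<p+p′ (ℚ.+-mono-< p<a (shift-< (p′ - r) r<-p′ (left r p′) (right r p′)))
      where
      left : ∀ r p′ → r + (p′ - r) ≡ p′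
      left = solve 2 (λ r p′ → r :+ (p′ :- r) := p′) refl
      right : ∀ r p′ → - p′ + (p′ - r) ≡ - r
      right = solve 2 (λ r p′ → :- p′ :+ (p′ :- r) := :- r) refl

    lower-surd⁺ : ∀ {q} r → 0ℚ ≤ r → fromℕ N ≤ r * r → q < a - r → lower x q
    lower-surd⁺ {q} r 0≤r N≤rr q<a-r =
      let (p , q+r<p , p<a) = ℚ.<-dense (shift-< r q<a-r refl (cancel a r))
          (p′ , q-p<p′ , p′<-r) = ℚ.<-dense (shift-< (- p - r) q+r<p (left q r p) (right p r))
      in p , p′ , p<a , (r , shift-< (r - p′) p′<-r (left′ r p′) (right′ r p′) , 0≤r , N≤rr) ,
         shift-< p q-p<p′ (cancel q p) (ℚ.+-comm p′ p)
      where
      cancel : ∀ a r → a - r + r ≡ a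
      cancel = solve 2 (λ a r → a :- r :+ r := a) refl
      left : ∀ q r p → q + r + (- p - r) ≡ q - p
      left = solve 3 (λ q r p → q :+ r :+ (:- p :- r) := q :- p) refl
      right : ∀ p r → p + (- p - r) ≡ - r
      right = solve 2 (λ p r → p :+ (:- p :- r) := :- r) refl
      left′ : ∀ r p′ → p′ + (r - p′) ≡ r
      left′ = solve 2 (λ r p′ → p′ :+ (r :- p′) := r) refl
      right′ : ∀ r p′ → - r + (r - p′) ≡ - p′
      right′ = solve 2 (λ r p′ → :- r :+ (r :- p′) := :- p′) refl

    upper-surd⁻ : ∀ {q} → upper x q → ∃[ r ] r * r ≤ fromℕ N × a - r < q
    upper-surd⁻ {q} (p , p′ , a<p , (r , -p′<r , rr≤N) , p+p′<q) =
      r , rr≤N , ℚ.<-trans (ℚ.+-mono-< a<p (shift-< (p′ - r) -p′<r (left r p′) (right r p′))) p+p′<q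
      where
      left : ∀ r p′ → - p′ + (p′ - r) ≡ - r
      left = solve 2 (λ r p′ → :- p′ :+ (p′ :- r) := :- r) refl
      right : ∀ r p′ → r + (p′ - r) ≡ p′
      right = solve 2 (λ r p′ → r :+ (p′ :- r) := p′) refl

    upper-surd⁺ : ∀ {q} r → r * r ≤ fromℕ N → a - r < q → upper x q
    upper-surd⁺ {q} r rr≤N a-r<q =
      let (p , a<p , p<q+r) = ℚ.<-dense (shift-< r a-r<q (cancel a r) refl)
          (p′ , -r<p′ , p′<q-p) = ℚ.<-dense (shift-< (- p - r) p<q+r (left p r) (right q r p))
      in p , p′ , a<p , (r , shift-< (r - p′) -r<p′ (left′ r p′) (right′ r p′) , rr≤N) ,
         shift-< p p′<q-p (ℚ.+-comm p′ p) (cancel q p)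
      where
      cancel : ∀ a r → a - r + r ≡ a
      cancel = solve 2 (λ a r → a :- r :+ r := a) refl
      left : ∀ p r → p + (- p - r) ≡ - r
      left = solve 2 (λ p r → p :+ (:- p :- r) := :- r) refl
      right : ∀ q r p → q + r + (- p - r) ≡ q - p
      right = solve 3 (λ q r p → q :+ r :+ (:- p :- r) := q :- p) refl
      left′ : ∀ r p′ → - r + (r - p′) ≡ - p′
      left′ = solve 2 (λ r p′ → :- r :+ (r :- p′) := :- p′) refl
      right′ : ∀ r p′ → p′ + (r - p′) ≡ r
      right′ = solve 2 (λ r p′ → p′ :+ (r :- p′) := r) refl

    -- A surd is located, so its lower cut determines it.
    surd-≤ᶜ : ∀ Z → (∀ q → lower x q → lower Z q) → x ≤ᶜ Z
    surd-≤ᶜ Z lower⊆ = lower⊆ , upper⊆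
      where
      double : ∀ a p → a - (a - p) ≡ p
      double = solve 2 (λ a p → a :- (a :- p) := p) refl
      decide : ∀ {q p p₂} → p < q → p₂ < p → upper Z p₂ →
               Dec (0ℚ ≤ a - p) → Dec ((a - p) * (a - p) ≤ fromℕ N) → upper x q
      decide {q} {p} p<q _ _ (no a-p≱0) _ = upper-surd⁺ 0ℚ (0≤ι N)
        (ℚ.<-trans (shift-< p (ℚ.≰⇒> a-p≱0) (left a p) (ℚ.+-identityˡ p)) p<q)
        where
        left : ∀ a p → a - p + p ≡ a - 0ℚ
        left = solve 2 (λ a p → a :- p :+ p := a :- con 0ℤ) refl
      decide {q} {p} p<q _ _ (yes _) (yes sq≤N) = upper-surd⁺ (a - p) sq≤N (subst (_< q) (sym (double a p)) p<q)
      -- Here `p` is at most the surd, so a rational `z` strictly between `p₂` and `p` belongs to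
      -- the lower cut of `Z`, although `p₂ < z` is in the upper one.
      decide {q} {p} {p₂} _ p₂<p up₂ (yes 0≤a-p) (no sq≰N) =
        let (z , p₂<z , z<p) = ℚ.<-dense p₂<p
            z-lower = lower-surd⁺ (a - p) 0≤a-p (ℚ.<⇒≤ (ℚ.≰⇒> sq≰N)) (subst (z <_) (sym (double a p)) z<p)
        in ⊥-elim (ℚ.<-asym p₂<z (separated Z (lower⊆ z z-lower) up₂))
      upper⊆ : ∀ q → upper Z q → upper x q
      upper⊆ q uq =
        let (p , p<q , up) = upper-open Z uq
            (p₂ , p₂<p , up₂) = upper-open Z up
        in decide p<q p₂<p up₂ (0ℚ ℚ.≤? a - p) ((a - p) * (a - p) ℚ.≤? fromℕ N)

    rational≤surd : ∀ v → 0ℚ ≤ v → fromℕ N ≤ v * v → ⟦ a - v ⟧ ≤ᶜ x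
    rational≤surd v 0≤v N≤vv = (λ q → lower-surd⁺ v 0≤v N≤vv) , λ q uq →
      let (r , rr≤N , a-r<q) = upper-surd⁻ uq in
      ℚ.≤-<-trans (ℚ.+-monoʳ-≤ a (ℚ.neg-antimono-≤ (square-cancel 0≤v (ℚ.≤-trans rr≤N N≤vv)))) a-r<q

    surd≤rational : ∀ w → w * w ≤ fromℕ N → x ≤ᶜ ⟦ a - w ⟧
    surd≤rational w ww≤N = (λ q lq →
      let (r , 0≤r , N≤rr , q<a-r) = lower-surd⁻ lq in
      ℚ.<-≤-trans q<a-r (ℚ.+-monoʳ-≤ a (ℚ.neg-antimono-≤ (square-cancel 0≤r (ℚ.≤-trans ww≤N N≤rr))))) ,
      λ q → upper-surd⁺ w ww≤N

  0≤ℚ* : ∀ {p q} → 0ℚ ≤ p → 0ℚ ≤ q → 0ℚ ≤ p * q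
  0≤ℚ* {p} {q} 0≤p 0≤q = ℚ.≤-trans (ℚ.≤-reflexive (sym (ℚ.*-zeroˡ q)))
    (ℚ.*-monoʳ-≤-nonNeg q {{ℚ.nonNegative 0≤q}} 0≤p)

  0≤ℚ+ : ∀ {p q} → 0ℚ ≤ p → 0ℚ ≤ q → 0ℚ ≤ p + q
  0≤ℚ+ 0≤p 0≤q = ℚ.+-mono-≤ 0≤p 0≤q

  ≤ℚ-by : ∀ {p q d} → 0ℚ ≤ d → q ≡ p + d → p ≤ q
  ≤ℚ-by {p} 0≤d refl = ℚ.≤-trans (ℚ.≤-reflexive (sym (ℚ.+-identityʳ p))) (ℚ.+-monoʳ-≤ p 0≤d)

  -- With u = 1 / 2s one has w² = s² + 1 − 2u⁴ + u⁶ for w = s + u − u³, the Taylor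
  -- polynomial of √(s² + 1).
  module Taylor (S u : ℚ) (0≤u : 0ℚ ≤ u) (u≤1 : u ≤ 1ℚ) (0≤S : 0ℚ ≤ S) (Su : S * (u + u) ≡ 1ℚ) where

    w v i : ℚ
    w = S + u - u * u * u
    i = u + u
    v = w + i * i * i * i * i

    private
      1-u² : ℚ
      1-u² = 1ℚ - u * u

      0≤1-u² : 0ℚ ≤ 1-u²
      0≤1-u² = ℚ.≤-trans (ℚ.≤-reflexive (sym (ℚ.+-inverseʳ (u * u)))) (ℚ.+-monoˡ-≤ (- (u * u))
        (ℚ.≤-trans (ℚ.*-monoˡ-≤-nonNeg u {{ℚ.nonNegative 0≤u}} u≤1) (ℚ.≤-trans (ℚ.≤-reflexive (ℚ.*-identityʳ u)) u≤1)))

      0≤w : 0ℚ ≤ w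
      0≤w = ℚ.≤-trans (0≤ℚ+ 0≤S (0≤ℚ* 0≤u 0≤1-u²)) (ℚ.≤-reflexive (identity S u))
        where
        identity : ∀ S u → S + u * (1ℚ - u * u) ≡ S + u - u * u * u
        identity = solve 2 (λ S u → S :+ u :* (con 1ℤ :- u :* u) := S :+ u :- u :* u :* u) refl

      u⁴ : ℚ
      u⁴ = u * u * (u * u)

      0≤u⁴ : 0ℚ ≤ u⁴
      0≤u⁴ = 0≤ℚ* (0≤ℚ* 0≤u 0≤u) (0≤ℚ* 0≤u 0≤u)

    w²≤ : w * w ≤ S * S + 1ℚ
    w²≤ = ≤ℚ-by (0≤ℚ* 0≤u⁴ (0≤ℚ+ 0≤1-u² (0≤ι 1)))
      (trans (cong (λ z → S * S + z) (sym Su))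
      (trans (sym (ℚ.+-identityʳ _))
      (trans (cong (λ z → S * S + S * (u + u) + z) (sym (zero-factor)))
             (identity S u))))
      where
      -- The relation `Su` enters the polynomial identity through this vanishing product; it equals
      -- u² - 2 S u³, the part of w² that cancels.
      zero-factor : (1ℚ - S * (u + u)) * (u * u) ≡ 0ℚ
      zero-factor = trans (cong (λ z → (1ℚ - z) * (u * u)) Su) (ℚ.*-zeroˡ (u * u))
      identity : ∀ S u → S * S + S * (u + u) + (1ℚ - S * (u + u)) * (u * u) ≡
        (S + u - u * u * u) * (S + u - u * u * u) + u * u * (u * u) * ((1ℚ - u * u) + 1ℚ)
      identity = solve 2 (λ S u → S :* S :+ S :* (u :+ u) :+ (con 1ℤ :- S :* (u :+ u)) :* (u :* u) :=
        (S :+ u :- u :* u :* u) :* (S :+ u :- u :* u :* u) :+ u :* u :* (u :* u) :* ((con 1ℤ :- u :* u) :+ con 1ℤ)) refl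

    0≤v : 0ℚ ≤ v
    0≤v = 0≤ℚ+ 0≤w (0≤ℚ* (0≤ℚ* (0≤ℚ* (0≤ℚ* 0≤i 0≤i) 0≤i) 0≤i) 0≤i)
      where
      0≤i : 0ℚ ≤ i
      0≤i = 0≤ℚ+ 0≤u 0≤u

    -- 2 w i⁵ ≥ 2 S i⁵ = 2 i⁴ = 32 u⁴ outweighs the deficit 2 u⁴ − u⁶ of w².
    ≤v² : S * S + 1ℚ ≤ v * v
    ≤v² = ≤ℚ-by (0≤ℚ+ (0≤ℚ* 0≤u⁴ (0≤ℚ+ (0≤ι 30) (0≤ℚ* 0≤u 0≤u)))
                  (0≤ℚ+ (0≤ℚ* (0≤ι 64) (0≤ℚ* (0≤ℚ* 0≤u⁴ (0≤ℚ* 0≤u 0≤u)) 0≤1-u²))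
                        (0≤ℚ* 0≤i⁵ 0≤i⁵)))
      (trans (sym (ℚ.+-identityʳ (v * v)))
      (trans (cong (λ z → v * v + z) (sym zero-factor))
      (trans (identity S u)
             (cong (λ z → S * S + z + (u⁴ * (ι (+ 30) + u * u) + (ι (+ 64) * (u⁴ * (u * u) * (1ℚ - u * u)) + i * i * i * i * i * (i * i * i * i * i)))) Su))))
      where
      0≤i⁵ : 0ℚ ≤ i * i * i * i * i
      0≤i⁵ = 0≤ℚ* (0≤ℚ* (0≤ℚ* (0≤ℚ* 0≤i 0≤i) 0≤i) 0≤i) 0≤i
        where
        0≤i : 0ℚ ≤ i
        0≤i = 0≤ℚ+ 0≤u 0≤u
      zero-factor : (1ℚ - S * (u + u)) * (ι (+ 32) * (u * u * (u * u)) - u * u) ≡ 0ℚ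
      zero-factor = trans (cong (λ z → (1ℚ - z) * (ι (+ 32) * (u * u * (u * u)) - u * u)) Su) (ℚ.*-zeroˡ (ι (+ 32) * (u * u * (u * u)) - u * u))
      identity : ∀ S u →
        (S + u - u * u * u + (u + u) * (u + u) * (u + u) * (u + u) * (u + u)) * (S + u - u * u * u + (u + u) * (u + u) * (u + u) * (u + u) * (u + u))
        + (1ℚ - S * (u + u)) * (ι (+ 32) * (u * u * (u * u)) - u * u)
        ≡ S * S + S * (u + u) + (u * u * (u * u) * (ι (+ 30) + u * u) + (ι (+ 64) * (u * u * (u * u) * (u * u) * (1ℚ - u * u))
          + (u + u) * (u + u) * (u + u) * (u + u) * (u + u) * ((u + u) * (u + u) * (u + u) * (u + u) * (u + u))))
      identity = solve 2 (λ S u →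
        (S :+ u :- u :* u :* u :+ (u :+ u) :* (u :+ u) :* (u :+ u) :* (u :+ u) :* (u :+ u)) :* (S :+ u :- u :* u :* u :+ (u :+ u) :* (u :+ u) :* (u :+ u) :* (u :+ u) :* (u :+ u))
        :+ (con 1ℤ :- S :* (u :+ u)) :* (con (+ 32) :* (u :* u :* (u :* u)) :- u :* u)
        := S :* S :+ S :* (u :+ u) :+ (u :* u :* (u :* u) :* (con (+ 30) :+ u :* u) :+ (con (+ 64) :* (u :* u :* (u :* u) :* (u :* u) :* (con 1ℤ :- u :* u))
          :+ (u :+ u) :* (u :+ u) :* (u :+ u) :* (u :+ u) :* (u :+ u) :* ((u :+ u) :* (u :+ u) :* (u :+ u) :* (u :+ u) :* (u :+ u))))) refl

  -- The reciprocals of 2s, 8s³ and s⁵ are u, u³ and (2u)⁵.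
  module _ (s′ : ℕ) where
    private
      s = suc s′
      S = ι (+ s)
      u = 1 ÷ (2 ℕ.* s)

      cast : ∀ {m i} → + m ≡ i → ι (+ m) ≡ ι i
      cast = cong ι

      power-pos : ∀ n → 0 ℕ.< s ℕ.^ n
      power-pos n = ℕ.m^n>0 s n

      pos-^ : ∀ n → + (s ℕ.^ suc n) ≡ + s ℤ.* + (s ℕ.^ n)
      pos-^ n = ℤ.pos-* s (s ℕ.^ n)

      pos-^3 : + (s ℕ.^ 3) ≡ + s ℤ.* (+ s ℤ.* (+ s ℤ.* 1ℤ))
      pos-^3 = trans (pos-^ 2) (cong (+ s ℤ.*_) (trans (pos-^ 1) (cong (+ s ℤ.*_) (pos-^ 0))))

      pos-^5 : + (s ℕ.^ 5) ≡ + s ℤ.* (+ s ℤ.* (+ s ℤ.* (+ s ℤ.* (+ s ℤ.* 1ℤ))))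
      pos-^5 = trans (pos-^ 4) (cong (+ s ℤ.*_) (trans (pos-^ 3) (cong (+ s ℤ.*_) pos-^3)))

      ι-cube : ∀ a → ι (a ℤ.* a ℤ.* a) ≡ ι a * ι a * ι a
      ι-cube a = trans (ι-* (a ℤ.* a) a) (cong (_* ι a) (ι-* a a))

      u-inverse : u * (S + S) ≡ 1ℚ
      u-inverse = trans (cong (u *_) (sym (trans (cast {2 ℕ.* s} (cong (λ z → + (s ℕ.+ z)) (ℕ.+-identityʳ s))) (ι-+ (+ s) (+ s)))))
        (÷-*′ 1 (2 ℕ.* s) (s≤s z≤n))

      Su : S * (u + u) ≡ 1ℚ
      Su = trans (identity S u) u-inverse
        where
        identity : ∀ S u → S * (u + u) ≡ u * (S + S)
        identity = solve 2 (λ S u → S :* (u :+ u) := u :* (S :+ S)) refl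

      ι-8s³ : ι (+ (8 ℕ.* s ℕ.^ 3)) ≡ (S + S) * (S + S) * (S + S)
      ι-8s³ = trans (cast (trans (ℤ.pos-* 8 (s ℕ.^ 3)) (trans (cong (+ 8 ℤ.*_) pos-^3) (identity (+ s)))))
        (trans (ι-cube (+ s ℤ.+ + s)) (cong (λ z → z * z * z) two))
        where
        two : ι (+ s ℤ.+ + s) ≡ S + S
        two = ι-+ (+ s) (+ s)
        identity : ∀ s → + 8 ℤ.* (s ℤ.* (s ℤ.* (s ℤ.* 1ℤ))) ≡ (s ℤ.+ s) ℤ.* (s ℤ.+ s) ℤ.* (s ℤ.+ s)
        identity = ℤ-Solver.solve-∀

      ι-s⁵ : ι (+ (s ℕ.^ 5)) ≡ S * S * S * S * S
      ι-s⁵ = trans (cast (trans pos-^5 (identity (+ s))))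
        (trans (ι-* (+ s ℤ.* + s ℤ.* + s ℤ.* + s) (+ s)) (cong (_* S)
          (trans (ι-* (+ s ℤ.* + s ℤ.* + s) (+ s)) (cong (_* S) (ι-cube (+ s))))))
        where
        identity : ∀ s → s ℤ.* (s ℤ.* (s ℤ.* (s ℤ.* (s ℤ.* 1ℤ)))) ≡ s ℤ.* s ℤ.* s ℤ.* s ℤ.* s
        identity = ℤ-Solver.solve-∀

      u³ : 1 ÷ (8 ℕ.* s ℕ.^ 3) ≡ u * u * u
      u³ = *-inverse-unique {c = (S + S) * (S + S) * (S + S)}
        (trans (cong (1 ÷ (8 ℕ.* s ℕ.^ 3) *_) (sym ι-8s³))
               (÷-*′ 1 (8 ℕ.* s ℕ.^ 3) (ℕ.*-mono-< {0} {8} {0} (s≤s z≤n) (power-pos 3))))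
        (trans (identity S u) (cong (λ z → z * z * z) u-inverse))
        where
        identity : ∀ S u → u * u * u * ((S + S) * (S + S) * (S + S)) ≡ u * (S + S) * (u * (S + S)) * (u * (S + S))
        identity = solve 2 (λ S u → u :* u :* u :* ((S :+ S) :* (S :+ S) :* (S :+ S)) := u :* (S :+ S) :* (u :* (S :+ S)) :* (u :* (S :+ S))) refl

      i⁵ : 1 ÷ (s ℕ.^ 5) ≡ (u + u) * (u + u) * (u + u) * (u + u) * (u + u)
      i⁵ = *-inverse-unique {c = S * S * S * S * S}
        (trans (cong (1 ÷ (s ℕ.^ 5) *_) (sym ι-s⁵)) (÷-*′ 1 (s ℕ.^ 5) (power-pos 5)))
        (trans (identity S (u + u)) (cong (λ z → z * z * z * z * z) Su))
        where
        identity : ∀ S i → i * i * i * i * i * (S * S * S * S * S) ≡ S * i * (S * i) * (S * i) * (S * i) * (S * i)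
        identity = solve 2 (λ S i → i :* i :* i :* i :* i :* (S :* S :* S :* S :* S) := S :* i :* (S :* i) :* (S :* i) :* (S :* i) :* (S :* i)) refl

      0≤u : 0ℚ ≤ u
      0≤u = 0≤÷ 1 (2 ℕ.* s)

      u≤1 : u ≤ 1ℚ
      u≤1 = ≤ℚ-by (0≤ℚ* 0≤u (0≤ι (s′ ℕ.+ s))) (trans (sym u-inverse) (trans (cong (λ z → u * (z + S)) (ι-+ 1ℤ (+ s′)))
        (trans (identity u (ι (+ s′)) S) (cong (λ z → u + u * z) (sym (ι-+ (+ s′) (+ s)))))))
        where
        identity : ∀ u a b → u * (1ℚ + a + b) ≡ u + u * (a + b)
        identity = solve 3 (λ u a b → u :* (con 1ℤ :+ a :+ b) := u :+ u :* (a :+ b)) refl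

      open Taylor S u 0≤u u≤1 (0≤ι s) Su

      fromℕ-radicand : fromℕ (s ℕ.^ 2 ℕ.+ 1) ≡ S * S + 1ℚ
      fromℕ-radicand = trans (ι-+ (+ (s ℕ.^ 2)) 1ℤ) (cong (_+ 1ℚ) (trans
        (cast (trans (pos-^ 1) (cong (+ s ℤ.*_) (cong +_ (ℕ.*-identityʳ s))))) (ι-* (+ s) (+ s))))

    surd-lower-expansion : ⟦ 1ℚ - 1 ÷ (2 ℕ.* s) + 1 ÷ (8 ℕ.* s ℕ.^ 3) - 1ℚ * (1 ÷ s ℕ.^ 5) ⟧ ≤ᶜ
                           ⟦ fromℕ (suc s) ⟧ -ᶜ √ (s ℕ.^ 2 ℕ.+ 1)
    surd-lower-expansion = subst (λ q → ⟦ q ⟧ ≤ᶜ ⟦ fromℕ (suc s) ⟧ -ᶜ √ (s ℕ.^ 2 ℕ.+ 1)) eq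
      (rational≤surd (fromℕ (suc s)) (s ℕ.^ 2 ℕ.+ 1) v 0≤v (ℚ.≤-trans (ℚ.≤-reflexive fromℕ-radicand) ≤v²))
      where
      identity : ∀ S u i → 1ℚ + S - (S + u - u * u * u + i) ≡ 1ℚ - u + u * u * u - 1ℚ * i
      identity = solve 3 (λ S u i → con 1ℤ :+ S :- (S :+ u :- u :* u :* u :+ i) := con 1ℤ :- u :+ u :* u :* u :- con 1ℤ :* i) refl
      eq : fromℕ (suc s) - v ≡ 1ℚ - u + 1 ÷ (8 ℕ.* s ℕ.^ 3) - 1ℚ * (1 ÷ s ℕ.^ 5)
      eq = trans (cong (_- v) (ι-+ 1ℤ (+ s))) (trans (identity S u (i * i * i * i * i))
        (cong₂ (λ a b → 1ℚ - u + a - 1ℚ * b) (sym u³) (sym i⁵)))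

    surd-upper-expansion : ⟦ fromℕ (suc s) ⟧ -ᶜ √ (s ℕ.^ 2 ℕ.+ 1) ≤ᶜ ⟦ 1ℚ - 1 ÷ (2 ℕ.* s) + 1 ÷ (8 ℕ.* s ℕ.^ 3) ⟧
    surd-upper-expansion = subst (λ q → ⟦ fromℕ (suc s) ⟧ -ᶜ √ (s ℕ.^ 2 ℕ.+ 1) ≤ᶜ ⟦ q ⟧) eq
      (surd≤rational (fromℕ (suc s)) (s ℕ.^ 2 ℕ.+ 1) w (ℚ.≤-trans w²≤ (ℚ.≤-reflexive (sym fromℕ-radicand))))
      where
      identity : ∀ S u → 1ℚ + S - (S + u - u * u * u) ≡ 1ℚ - u + u * u * u
      identity = solve 2 (λ S u → con 1ℤ :+ S :- (S :+ u :- u :* u :* u) := con 1ℤ :- u :+ u :* u :* u) refl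
      eq : fromℕ (suc s) - w ≡ 1ℚ - u + 1 ÷ (8 ℕ.* s ℕ.^ 3)
      eq = trans (cong (_- w) (ι-+ 1ℤ (+ s))) (trans (identity S u) (cong (λ a → 1ℚ - u + a) (sym u³)))

-- The upper bound 3/5 for triangles

module Densities where
  open Counting
  open Surds
  open import Data.Integer using (_+_; _*_; _-_; -_; _≤_; _<_)
  open ℤ-Solver using (solve-∀)

  -- `ex` is either attained or the default 0, so a bound on all attained numbers that also holds at
  -- 0 passes to `ex` without exhibiting an attained number.
  greatest-elim : ∀ {ℓ} {P : ℕ → Set ℓ} (P? : ∀ x → Dec (P x)) (R : ℕ → Set) →
                  R zero → (∀ x → P x → R x) → ∀ b → R (greatest P? b)
  greatest-elim P? R base step zero = base
  greatest-elim P? R base step (suc b) with P? (suc b)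
  ... | yes Pb = step (suc b) Pb
  ... | no  _  = greatest-elim P? R base step b

  image-sub : ∀ {m n} (H : Graph m) (G : Graph n) ((f , _) : H ⊑ G) → ∀ x y → Adj (image H f) x y → Adj G x y
  image-sub H G (f , _ , f-hom) _ _ (u , v , refl , refl , a , _) = f-hom u v a

  module _ (n k : ℕ) .{{_ : NonZero n}} where

    Sparse : ℕ → Set
    Sparse x = + 10 * (+ k * (+ 2 * + x)) ≤ + n * (+ 12 * (+ k * + k) + + 20 * + k)

    sparse-0 : Sparse 0
    sparse-0 = ℤ.≤-trans (ℤ.≤-reflexive (identity (+ k)))
      (0≤+n {n} ⊛ (0≤+n {12} ⊛ 0≤+n {k} ⊛ 0≤+n {k} ⊕ 0≤+n {20} ⊛ 0≤+n {k}))
      where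
      identity : ∀ k → + 10 * (k * (+ 2 * 0ℤ)) ≡ 0ℤ
      identity = solve-∀

    triangle-free-sparse : ∀ {m} (H : Graph m) → H ⊑ CyclePower n k → ¬ (K 3 ⊑ H) → Sparse (e H)
    triangle-free-sparse {zero}  H H⊑C free = sparse-0
    triangle-free-sparse {suc m} H H⊑C@(f , f-inj , f-hom) free = ℤ.≤-trans
      (ℤ.*-monoˡ-≤-nonNeg (+ 10) (ℤ.*-monoˡ-≤-nonNeg (+ k) (2e≤∑degree-image H f f-inj)))
      (triangle-free-degrees n k (image H f) (image-sub H (CyclePower n k) H⊑C) (free ∘ K-image H f f-inj))

    ex-sparse : Sparse (ex (CyclePower n k) (K 3))
    ex-sparse = greatest-elim (attainable? (CyclePower n k) (K 3)) Sparse sparse-0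
      (λ { x (m , H , H⊑C , free , refl) → triangle-free-sparse H H⊑C free }) (n ℕ.* n)

  sparse-density<3/5 : ∀ q → 3 ÷ 5 ℚ.< q → ∀ {k n x y} → suc (5 ℕ.* ↧ₙ q) ℕ.≤ k →
    suc (5 ℕ.* (ℤ.∣ ↥ q ∣ ℕ.* (k ℕ.* k))) ℕ.≤ n →
    + 10 * (+ k * (+ 2 * + x)) ≤ + n * (+ 12 * (+ k * + k) + + 20 * + k) → (+ n - + k) * + k ≤ + y →
    x ÷ y ℚ.< q
  sparse-density<3/5 q 3/5<q {k} {n} {x} {y} k-large n-large few many = ÷< q x y (positive y refl) few<many
    where
    A = ↥ q
    B = ↧ q
    gap : 1ℤ + + 3 * B ≤ + 5 * A
    gap = ℤ.i<j⇒suc[i]≤j (ℤ.<-≤-trans (ℚ.drop-*<* 3/5<q) (ℤ.≤-reflexive (ℤ.*-comm A (+ 5))))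
    0≤A : 0ℤ ≤ A
    0≤A = ℤ.*-cancelˡ-≤-pos 0ℤ A (+ 5) (ℤ.≤-trans (0≤+n {1} ⊕ 0≤+n {3} ⊛ 0≤+n {↧ₙ q}) gap)
    k-large′ : 1ℤ + + 5 * B ≤ + k
    k-large′ = ℤ.≤-trans (ℤ.≤-reflexive (cong (λ z → 1ℤ + z) (sym (ℤ.pos-* 5 (↧ₙ q))))) (ℤ.+≤+ k-large)
    n-large′ : 1ℤ + + 5 * (A * (+ k * + k)) ≤ + n
    n-large′ = ℤ.≤-trans (ℤ.≤-reflexive (cong (λ z → 1ℤ + z) (sym (trans (ℤ.pos-* 5 (ℤ.∣ A ∣ ℕ.* (k ℕ.* k)))
        (cong (+ 5 *_) (trans (ℤ.pos-* ℤ.∣ A ∣ (k ℕ.* k)) (cong₂ _*_ (ℤ.0≤i⇒+∣i∣≡i 0≤A) (ℤ.pos-* k k))))))))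
      (ℤ.+≤+ n-large)
    few<many : + x * B ℤ.< A * + y
    few<many = density-upper {+ k} {+ n} {A} {B} {+ x} {+ y} (0≤+n {↧ₙ q}) (0≤+n {n}) few many gap k-large′ n-large′
    -- The strict inequality excludes `y = 0`, where `÷` takes a conventional value.
    positive : ∀ z → y ≡ z → 0 ℕ.< z
    positive (suc _) _  = s≤s z≤n
    positive zero    eq = ⊥-elim (ℤ.<⇒≱ few<many (ℤ.≤-trans
      (ℤ.≤-reflexive (trans (cong (λ z → A * + z) eq) (ℤ.*-zeroʳ A))) (0≤+n {x} ⊛ 0≤+n {↧ₙ q})))

  triangle-density<3/5 : ∀ q → 3 ÷ 5 ℚ.< q → ∀ k → suc (5 ℕ.* ↧ₙ q) ℕ.≤ k →
    ∀ n → k ℕ.+ suc (5 ℕ.* (ℤ.∣ ↥ q ∣ ℕ.* (k ℕ.* k))) ℕ.≤ n →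
    ex (CyclePower n k) (K 3) ÷ e (CyclePower n k) ℚ.< q
  triangle-density<3/5 q 3/5<q k k-large n n-large =
    sparse-density<3/5 q 3/5<q {k} {n} k-large n-large′ (ex-sparse n k) many
    where
    n-large′ : suc (5 ℕ.* (ℤ.∣ ↥ q ∣ ℕ.* (k ℕ.* k))) ℕ.≤ n
    n-large′ = ℕ.≤-trans (ℕ.m≤n+m _ k) n-large
    instance
      n≢0 : NonZero n
      n≢0 = ℕ.>-nonZero (ℕ.≤-trans (s≤s z≤n) n-large′)
    k≤n : k ℕ.≤ n
    k≤n = ℕ.≤-trans (ℕ.m≤m+n k _) n-large
    many : (+ n - + k) * + k ≤ + e (CyclePower n k)
    many = ℤ.≤-trans (ℤ.≤-reflexive (cong (_* + k) (trans (ℤ.m-n≡m⊖n n k) (ℤ.⊖-≥ k≤n))))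
      (power-edges≥ n (n ∸ k) k (ℕ.≤-reflexive (ℕ.m∸n+n≡m k≤n)))

  -- Each of the two nested limits asks for a rational strictly below the previous one, hence `q₁`
  -- and `q₂`.
  πcyc-K₃-upper : ∀ q → 3 ÷ 5 ℚ.< q → upper (πcyc (K 3)) q
  πcyc-K₃-upper q 3/5<q =
    let (q₁ , 3/5<q₁ , q₁<q) = ℚ.<-dense 3/5<q
        (q₂ , 3/5<q₂ , q₂<q₁) = ℚ.<-dense 3/5<q₁
    in q₁ , q₁<q , _ , λ k k-large → q₂ , q₂<q₁ , _ , triangle-density<3/5 q₂ 3/5<q₂ k k-large

  πcyc-K₃≤3/5 : πcyc (K 3) ≤ᶜ ⟦ 3 ÷ 5 ⟧
  πcyc-K₃≤3/5 = below , πcyc-K₃-upper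
    where
    below : ∀ q → lower (πcyc (K 3)) q → q ℚ.< 3 ÷ 5
    below q lq =
      let (q₁ , q<q₁ , lq₁) = lower-open (πcyc (K 3)) lq
      in ℚ.<-≤-trans q<q₁ (ℚ.≮⇒≥ λ 3/5<q₁ →
           let (p , 3/5<p , p<q₁) = ℚ.<-dense 3/5<q₁
           in ℚ.<-asym p<q₁ (separated (πcyc (K 3)) lq₁ (πcyc-K₃-upper p 3/5<p)))

  -- The lower bound for cliques

  ℤ-square-cancel : ∀ {a b} → 0ℤ ≤ b → a * a ≤ b * b → a ≤ b
  ℤ-square-cancel {a} {b} 0≤b aa≤bb = ℤ.≮⇒≥ λ b<a → ℤ.<⇒≱ (ℤ.+<+ ℕ.0<1+n)
    (ℤ.≤-trans (≤-by (0≤-diff aa≤bb ⊕ 0≤+n {2} ⊛ 0≤b ⊕ 0≤+n {2} ⊛ 0≤-diff (ℤ.i<j⇒suc[i]≤j b<a) ⊛ 0≤b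
        ⊕ 0≤+n {2} ⊛ 0≤-diff (ℤ.i<j⇒suc[i]≤j b<a) ⊕ 0≤-diff (ℤ.i<j⇒suc[i]≤j b<a) ⊛ 0≤-diff (ℤ.i<j⇒suc[i]≤j b<a))
      (identity a b)) ℤ.≤-refl)
    where
    identity : ∀ a b → 0ℤ ≡ 1ℤ + ((b * b - a * a) + (+ 2 * b + (+ 2 * ((a - (1ℤ + b)) * b)
      + (+ 2 * (a - (1ℤ + b)) + (a - (1ℤ + b)) * (a - (1ℤ + b))))))
    identity = solve-∀

  0≤⇒0≤↥ : ∀ q → 0ℚ ℚ.≤ q → 0ℤ ≤ ↥ q
  0≤⇒0≤↥ q 0≤q = ℤ.≤-trans (ℚ.drop-*≤* 0≤q) (ℤ.≤-reflexive (ℤ.*-identityʳ (↥ q)))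

  0<ι↧ : ∀ q → 0ℚ ℚ.< ι (↧ q)
  0<ι↧ (ℚ.mkℚ _ d _) = 0<ι d

  pos-radicand : ∀ s → + (s ℕ.^ 2 ℕ.+ 1) ≡ + s * + s + 1ℤ
  pos-radicand s = cong (_+ 1ℤ) (trans (ℤ.pos-* s (s ℕ.* 1)) (cong (λ z → + s * + z) (ℕ.*-identityʳ s)))

  radicand≤⇒ : ∀ s r → fromℕ (s ℕ.^ 2 ℕ.+ 1) ℚ.≤ r ℚ.* r → (+ s * + s + 1ℤ) * (↧ r * ↧ r) ≤ ↥ r * ↥ r
  radicand≤⇒ s r N≤rr = ι-cancel-≤ (begin
    ι ((+ s * + s + 1ℤ) * (↧ r * ↧ r))
      ≡⟨ trans (ι-* (+ s * + s + 1ℤ) (↧ r * ↧ r)) (cong₂ ℚ._*_ (cong ι (sym (pos-radicand s))) (ι-* (↧ r) (↧ r))) ⟩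
    fromℕ (s ℕ.^ 2 ℕ.+ 1) ℚ.* (Q ℚ.* Q)
      ≤⟨ ℚ.*-monoʳ-≤-nonNeg (Q ℚ.* Q) {{ℚ.nonNegative 0≤QQ}} N≤rr ⟩
    r ℚ.* r ℚ.* (Q ℚ.* Q)
      ≡⟨ identity r Q ⟩
    r ℚ.* Q ℚ.* (r ℚ.* Q)
      ≡⟨ cong₂ ℚ._*_ (↥-↧ r) (↥-↧ r) ⟩
    ι (↥ r) ℚ.* ι (↥ r)
      ≡⟨ ι-* (↥ r) (↥ r) ⟨
    ι (↥ r * ↥ r) ∎)
    where
    open ℚ.≤-Reasoning
    Q = ι (↧ r)
    0≤QQ : 0ℚ ℚ.≤ Q ℚ.* Q
    0≤QQ = ℚ.≤-trans (ℚ.≤-reflexive (sym (ℚ.*-zeroˡ Q)))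
      (ℚ.*-monoʳ-≤-nonNeg Q {{ℚ.nonNegative (ℚ.<⇒≤ (0<ι↧ r))}} (ℚ.<⇒≤ (0<ι↧ r)))
    identity : ∀ r Q → r ℚ.* r ℚ.* (Q ℚ.* Q) ≡ r ℚ.* Q ℚ.* (r ℚ.* Q)
    identity = solve 2 (λ r Q → r :* r :* (Q :* Q) := r :* Q :* (r :* Q)) refl

  <-surd⇒ : ∀ s q r → q ℚ.< fromℕ (suc s) ℚ.- r → ↥ q * ↧ r ℤ.< ↧ q * ((1ℤ + + s) * ↧ r - ↥ r)
  <-surd⇒ s q r q<a-r = ι-cancel-< (begin-strict
    ι (↥ q * ↧ r)
      ≡⟨ trans (ι-* (↥ q) (↧ r)) (cong (λ z → z ℚ.* Q) (sym (↥-↧ q))) ⟩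
    q ℚ.* B ℚ.* Q
      <⟨ ℚ.*-monoˡ-<-pos Q {{ℚ.positive (0<ι↧ r)}} (ℚ.*-monoˡ-<-pos B {{ℚ.positive (0<ι↧ q)}} q<a-r) ⟩
    (a ℚ.- r) ℚ.* B ℚ.* Q
      ≡⟨ identity a r B Q ⟩
    B ℚ.* (a ℚ.* Q ℚ.- r ℚ.* Q)
      ≡⟨ cong (λ z → B ℚ.* (a ℚ.* Q ℚ.- z)) (↥-↧ r) ⟩
    B ℚ.* (a ℚ.* Q ℚ.- ι (↥ r))
      ≡⟨ cong (λ z → B ℚ.* z) (trans (ι-minus ((1ℤ + + s) * ↧ r) (↥ r)) (cong (λ z → z ℚ.- ι (↥ r)) (ι-* (1ℤ + + s) (↧ r)))) ⟨
    B ℚ.* ι ((1ℤ + + s) * ↧ r - ↥ r)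
      ≡⟨ ι-* (↧ q) ((1ℤ + + s) * ↧ r - ↥ r) ⟨
    ι (↧ q * ((1ℤ + + s) * ↧ r - ↥ r)) ∎)
    where
    open ℚ.≤-Reasoning
    a = fromℕ (suc s)
    B = ι (↧ q)
    Q = ι (↧ r)
    identity : ∀ a r B Q → (a ℚ.- r) ℚ.* B ℚ.* Q ≡ B ℚ.* (a ℚ.* Q ℚ.- r ℚ.* Q)
    identity = solve 4 (λ a r B Q → (a :- r) :* B :* Q := B :* (a :* Q :- r :* Q)) refl

  -- With r = P / Q approximating √(s² + 1), the blocks have length b = Qj for k = Pj, so
  -- that b / k ≈ 1 / √(s² + 1); here Q = E + D and P = s Q + E.
  record Scale (s : ℕ) (q : ℚ) : Set where
    field
      E D  : ℕ
      0≤↥  : 0ℤ ≤ ↥ q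
      1≤Q  : 1 ℕ.≤ E ℕ.+ D
      root : (+ E + + D) * (+ E + + D) ≤ + 2 * (+ s * ((+ E + + D) * + E)) + + E * + E
      gap  : 1ℤ + ↥ q * (+ E + + D) ≤ ↧ q * + D

  scale : ∀ s q r → 0ℚ ℚ.≤ q → 0ℚ ℚ.≤ r → fromℕ (s ℕ.^ 2 ℕ.+ 1) ℚ.≤ r ℚ.* r →
          q ℚ.< fromℕ (suc s) ℚ.- r → Scale s q
  scale s q r 0≤q 0≤r N≤rr q<a-r = record
    { E = ℤ.∣ E′ ∣ ; D = ℤ.∣ D′ ∣ ; 0≤↥ = 0≤⇒0≤↥ q 0≤q
    ; 1≤Q = ℤ.drop‿+≤+ (ℤ.≤-trans (ℤ.+≤+ (s≤s z≤n)) (ℤ.≤-reflexive Q-eq))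
    ; root = subst₂ (λ x y → x * x ≤ + 2 * (+ s * (x * y)) + y * y) Q-eq (sym ∣E∣) root′
    ; gap = subst₂ (λ x y → 1ℤ + ↥ q * x ≤ ↧ q * y) Q-eq (sym ∣D∣) (ℤ.i<j⇒suc[i]≤j gap′) }
    where
    P = ↥ r
    Q = ↧ r
    E′ = P - + s * Q
    D′ = (1ℤ + + s) * Q - P
    0≤P : 0ℤ ≤ P
    0≤P = 0≤⇒0≤↥ r 0≤r
    square : (+ s * + s + 1ℤ) * (Q * Q) ≤ P * P
    square = radicand≤⇒ s r N≤rr
    gap′ : ↥ q * Q ℤ.< ↧ q * D′
    gap′ = <-surd⇒ s q r q<a-r
    sQ≤P : + s * Q ≤ P
    sQ≤P = ℤ-square-cancel 0≤P (≤-by (0≤-diff square ⊕ 0≤square Q) (identity (+ s) Q P))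
      where
      identity : ∀ s Q P → P * P ≡ s * Q * (s * Q) + (P * P - (s * s + 1ℤ) * (Q * Q) + Q * Q)
      identity = solve-∀
    ∣E∣ : + ℤ.∣ E′ ∣ ≡ E′
    ∣E∣ = ℤ.0≤i⇒+∣i∣≡i (0≤-diff sQ≤P)
    0<D′ : 0ℤ ℤ.< D′
    0<D′ = ℤ.*-cancelˡ-<-nonNeg (↧ q) (ℤ.≤-<-trans (ℤ.≤-trans (ℤ.≤-reflexive (ℤ.*-zeroʳ (↧ q)))
      (0≤⇒0≤↥ q 0≤q ⊛ 0≤+n {↧ₙ r})) gap′)
    ∣D∣ : + ℤ.∣ D′ ∣ ≡ D′
    ∣D∣ = ℤ.0≤i⇒+∣i∣≡i (ℤ.<⇒≤ 0<D′)
    Q-eq : Q ≡ + ℤ.∣ E′ ∣ + + ℤ.∣ D′ ∣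
    Q-eq = trans (identity (+ s) Q P) (sym (cong₂ _+_ ∣E∣ ∣D∣))
      where
      identity : ∀ s Q P → Q ≡ P - s * Q + ((1ℤ + s) * Q - P)
      identity = solve-∀
    -- As P = s Q + E′, this says (s² + 1) Q² ≤ P², that is s² + 1 ≤ r².
    root′ : Q * Q ≤ + 2 * (+ s * (Q * E′)) + E′ * E′
    root′ = ≤-by (0≤-diff square) (identity (+ s) Q P)
      where
      identity : ∀ s Q P → + 2 * (s * (Q * (P - s * Q))) + (P - s * Q) * (P - s * Q) ≡ Q * Q + (P * P - (s * s + 1ℤ) * (Q * Q))
      identity = solve-∀

  -- A record, so that comparing two such statements never unfolds ex.
  record DenserThan (q : ℚ) {p} (F : Graph p) (k n : ℕ) : Set where
    constructor denser
    field
      density : q ℚ.< ex (CyclePower n k) F ÷ e (CyclePower n k)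

  module _ (k b m : ℕ) .{{_ : NonZero b}} where

    blocks-fit : m ℕ./ b ℕ.* b ℕ.+ k ℕ.≤ m ℕ.+ k
    blocks-fit = ℕ.+-monoˡ-≤ k (m/n*n≤m m b)

    blocks-fill : + (m ℕ.+ k) ≤ + (m ℕ./ b) * + b + + b + + k
    blocks-fill = ℤ.≤-trans (ℤ.+≤+ (ℕ.+-monoˡ-≤ k (ℕ.≤-trans (ℕ.≤-reflexive (m≡m%n+[m/n]*n m b))
        (ℕ.≤-trans (ℕ.+-monoˡ-≤ (m ℕ./ b ℕ.* b) (ℕ.<⇒≤ (m%n<n m b))) (ℕ.≤-reflexive (ℕ.+-comm b _))))))
      (ℤ.≤-reflexive (cong (λ z → z + + b + + k) (ℤ.pos-* (m ℕ./ b) b)))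

  module _ {s} (1≤s : 1 ℕ.≤ s) {q : ℚ} (sc : Scale s q) where
    open Scale sc

    private
      1≤P : 1ℤ ≤ + s * (+ E + + D) + + E
      1≤P = ℤ.≤-trans (ℤ.+≤+ (ℕ.*-mono-≤ 1≤s 1≤Q)) (ℤ.≤-trans (ℤ.≤-reflexive (ℤ.pos-* s (E ℕ.+ D)))
        (≤-by (0≤+n {E}) refl))

    module _ (j : ℕ) (1≤j : 1 ℕ.≤ j) where
      private
        e′ = E ℕ.* j
        d = D ℕ.* j

      block width : ℕ
      block = e′ ℕ.+ d
      width = s ℕ.* block ℕ.+ e′

      private
        block-eq : + block ≡ + E * + j + + D * + j
        block-eq = cong₂ _+_ (ℤ.pos-* E j) (ℤ.pos-* D j)

        width-eq : + width ≡ + s * (+ E * + j + + D * + j) + + E * + j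
        width-eq = cong₂ _+_ (trans (ℤ.pos-* s block) (cong (+ s *_) block-eq)) (ℤ.pos-* E j)

        instance
          block≢0 : NonZero block
          block≢0 = ℕ.>-nonZero (ℕ.≤-trans (ℕ.*-mono-≤ 1≤Q 1≤j) (ℕ.≤-reflexive (ℕ.*-distribʳ-+ j E D)))

      j≤width : j ℕ.≤ width
      j≤width = ℤ.drop‿+≤+ (≤-by (0≤-diff 1≤P ⊛ 0≤+n {j})
        (trans width-eq (identity (+ s) (+ E) (+ D) (+ j))))
        where
        identity : ∀ s E D j → s * (E * j + D * j) + E * j ≡ j + (s * (E + D) + E - 1ℤ) * j
        identity = solve-∀

      module _ (m : ℕ) (m-large : suc (↧ₙ q ℕ.* (D ℕ.* (block ℕ.+ width))) ℕ.≤ m) where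
        private
          n = m ℕ.+ width
          instance
            n≢0 : NonZero n
            n≢0 = ℕ.>-nonZero (ℕ.≤-trans (s≤s z≤n) (ℕ.≤-trans m-large (ℕ.m≤m+n m width)))
          H = multipartite n width block (suc s)
          N = m ℕ./ block

          many : + N * (+ 2 * (+ s * ((+ E * + j + + D * + j) * (+ E * + j + + D * + j))) - + D * + j * (+ D * + j) + + D * + j) ≤ + 2 * + e H
          many = ℤ.≤-trans (ℤ.≤-reflexive (sym (cong₂ (λ b d → + N * (+ 2 * (+ s * (b * b)) - d * d + d)) block-eq (ℤ.pos-* D j))))
            (multipartite-edges n s e′ d 1≤s N (blocks-fit width block m))

          few : + e (CyclePower n width) ≤ + n * (+ s * (+ E * + j + + D * + j) + + E * + j)
          few = ℤ.≤-trans (power-edges≤ n width) (ℤ.≤-reflexive (cong (+ n *_) width-eq))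

          filled : + n ≤ + N * (+ E * + j + + D * + j) + (+ E * + j + + D * + j) + (+ s * (+ E * + j + + D * + j) + + E * + j)
          filled = ℤ.≤-trans (blocks-fill width block m)
            (ℤ.≤-reflexive (cong₂ (λ b k → + N * b + b + k) block-eq width-eq))

          large : 1ℤ + ↧ q * (+ D * (+ E * + j + + D * + j + (+ s * (+ E * + j + + D * + j) + + E * + j))) ≤ + n
          large = ℤ.≤-trans (ℤ.≤-reflexive (cong (λ z → 1ℤ + z) (sym (trans (ℤ.pos-* (↧ₙ q) (D ℕ.* (block ℕ.+ width)))
              (cong (↧ q *_) (trans (ℤ.pos-* D (block ℕ.+ width)) (cong (+ D *_) (cong₂ _+_ block-eq width-eq))))))))
            (ℤ.+≤+ (ℕ.≤-trans m-large (ℕ.m≤m+n m width)))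

          dense : ∀ x y → + N * (+ 2 * (+ s * ((+ E * + j + + D * + j) * (+ E * + j + + D * + j))) - + D * + j * (+ D * + j) + + D * + j) ≤ + 2 * + x →
                  + y ≤ + n * (+ s * (+ E * + j + + D * + j) + + E * + j) → ↥ q * + y ℤ.< + x * ↧ q
          dense x y many few = density-lower {+ s} {+ E} {+ D} {+ j} {+ N} {+ n} {+ x}
            (0≤+n {s}) (0≤+n {E}) (0≤+n {D}) (ℤ.+≤+ 1≤j) (0≤+n {N}) (0≤+n {n})
            {↥ q} {↧ q} {+ y} 0≤↥ (0≤+n {↧ₙ q}) 1≤P many few filled root gap large

          attained : e H ℕ.≤ ex (CyclePower n width) (K (suc (suc s)))
          attained = ex-upper (CyclePower n width) (K (suc (suc s)))
            (n , H , multipartite-⊑ n width block (suc s) , multipartite-K-free n width block (suc s) , refl)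

          0<e : 0 ℕ.< e (CyclePower n width)
          0<e = ℤ.drop‿+<+ (ℤ.<-≤-trans (ℤ.+<+ (ℕ.*-mono-< {0} {m} {0}
              (ℕ.≤-trans (s≤s z≤n) m-large) (ℕ.≤-trans 1≤j j≤width)))
            (ℤ.≤-trans (ℤ.≤-reflexive (ℤ.pos-* m width)) (power-edges≥ n m width ℕ.≤-refl)))

          ratio : ∀ x y z → x ℕ.≤ z → 0 ℕ.< y → ↥ q * + y ℤ.< + x * ↧ q → q ℚ.< z ÷ y
          ratio x y z x≤z 0<y lt = 0<⇒<÷ q z y 0<y (ℤ.<-≤-trans lt (ℤ.*-monoʳ-≤-nonNeg (↧ q) (ℤ.+≤+ x≤z)))

        multipartite-density : DenserThan q (K (suc (suc s))) width n
        multipartite-density = denser (ratio (e H) (e (CyclePower n width)) (ex (CyclePower n width) (K (suc (suc s))))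
          attained 0<e (dense (e H) (e (CyclePower n width)) many few))

  module _ {s} (1≤s : 1 ℕ.≤ s) where
    private
      πcyc-lower⁺ : ∀ {q q₁ q₂} → q ℚ.< q₁ → q₁ ℚ.< q₂ →
        (∀ k₀ → ∃[ k ] k₀ ℕ.≤ k × (∀ n₀ → ∃[ n ] n₀ ℕ.≤ n × DenserThan q₂ (K (suc (suc s))) k n)) → lower (πcyc (K (suc (suc s)))) q
      πcyc-lower⁺ {q} {q₁} {q₂} q<q₁ q₁<q₂ often = q₁ , q<q₁ , λ k₀ →
        let (k , k₀≤k , often-n) = often k₀ in k , k₀≤k , q₂ , q₁<q₂ , λ n₀ →
        let (n , n₀≤n , dense) = often-n n₀ in n , n₀≤n , DenserThan.density dense

      -- Only the multiples P j of P = s Q + E occur as widths, which is enough: the limit superior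
      -- asks for arbitrarily large k, not for all.
      dense-often : ∀ {q} → Scale s q → ∀ k₀ → ∃[ k ] k₀ ℕ.≤ k × (∀ n₀ → ∃[ n ] n₀ ℕ.≤ n × DenserThan q (K (suc (suc s))) k n)
      dense-often {q} sc k₀ = k , ℕ.≤-trans (ℕ.n≤1+n k₀) (j≤width 1≤s sc j 1≤j) , λ n₀ →
        n₀ ℕ.+ m ℕ.+ k , ℕ.≤-trans (ℕ.m≤m+n n₀ m) (ℕ.m≤m+n (n₀ ℕ.+ m) k) ,
        multipartite-density 1≤s sc j 1≤j (n₀ ℕ.+ m) (ℕ.m≤n+m m n₀)
        where
        j = suc k₀
        1≤j : 1 ℕ.≤ j
        1≤j = s≤s z≤n
        k = width 1≤s sc j 1≤j
        m = suc (↧ₙ q ℕ.* (Scale.D sc ℕ.* (block 1≤s sc j 1≤j ℕ.+ k)))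

      -- A `Scale` requires a non-negative rational; below 0 it is enough that no quotient is
      -- negative.
      negative : ∀ {q q₁ q₂} → q ℚ.< q₁ → q₁ ℚ.< q₂ → q₂ ℚ.< 0ℚ → lower (πcyc (K (suc (suc s)))) q
      negative q<q₁ q₁<q₂ q₂<0 = πcyc-lower⁺ q<q₁ q₁<q₂ λ k → k , ℕ.≤-refl , λ n → n , ℕ.≤-refl ,
        denser (ℚ.<-≤-trans q₂<0 (0≤÷ (ex (CyclePower n k) (K (suc (suc s)))) (e (CyclePower n k))))

      non-negative : ∀ {q q₁ q₂ r} → 0ℚ ℚ.≤ q → 0ℚ ℚ.≤ r → fromℕ (s ℕ.^ 2 ℕ.+ 1) ℚ.≤ r ℚ.* r →
        q ℚ.< q₁ → q₁ ℚ.< q₂ → q₂ ℚ.< fromℕ (suc s) ℚ.- r → lower (πcyc (K (suc (suc s)))) q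
      non-negative {q₂ = q₂} {r} 0≤q 0≤r N≤rr q<q₁ q₁<q₂ q₂<a-r = πcyc-lower⁺ q<q₁ q₁<q₂
        (dense-often (scale s q₂ r (ℚ.≤-trans 0≤q (ℚ.<⇒≤ (ℚ.<-trans q<q₁ q₁<q₂))) 0≤r N≤rr q₂<a-r))

      two-between : ∀ {p q} → p ℚ.< q → ∃[ p₁ ] ∃[ p₂ ] p ℚ.< p₁ × p₁ ℚ.< p₂ × p₂ ℚ.< q
      two-between p<q =
        let (p₁ , p<p₁ , p₁<q) = ℚ.<-dense p<q
            (p₂ , p₁<p₂ , p₂<q) = ℚ.<-dense p₁<q
        in p₁ , p₂ , p<p₁ , p₁<p₂ , p₂<q

      by-sign : ∀ q r → Dec (0ℚ ℚ.≤ q) → 0ℚ ℚ.≤ r → fromℕ (s ℕ.^ 2 ℕ.+ 1) ℚ.≤ r ℚ.* r →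
        q ℚ.< fromℕ (suc s) ℚ.- r → lower (πcyc (K (suc (suc s)))) q
      by-sign q r (no q≱0) _ _ _ =
        let (q₁ , q₂ , q<q₁ , q₁<q₂ , q₂<0) = two-between (ℚ.≰⇒> q≱0) in negative {q} {q₁} {q₂} q<q₁ q₁<q₂ q₂<0
      by-sign q r (yes 0≤q) 0≤r N≤rr q<a-r =
        let (q₁ , q₂ , q<q₁ , q₁<q₂ , q₂<a-r) = two-between q<a-r
        in non-negative {q} {q₁} {q₂} {r} 0≤q 0≤r N≤rr q<q₁ q₁<q₂ q₂<a-r

      from-approximation : ∀ q → (∃[ r ] 0ℚ ℚ.≤ r × fromℕ (s ℕ.^ 2 ℕ.+ 1) ℚ.≤ r ℚ.* r × q ℚ.< fromℕ (suc s) ℚ.- r) →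
        lower (πcyc (K (suc (suc s)))) q
      from-approximation q (r , 0≤r , N≤rr , q<a-r) = by-sign q r (0ℚ ℚ.≤? q) 0≤r N≤rr q<a-r

    πcyc-lower : ∀ q → lower (⟦ fromℕ (suc s) ⟧ -ᶜ √ (s ℕ.^ 2 ℕ.+ 1)) q → lower (πcyc (K (suc (suc s)))) q
    πcyc-lower q lq = from-approximation q (lower-surd⁻ (fromℕ (suc s)) (s ℕ.^ 2 ℕ.+ 1) {q} lq)

  surd≤πcyc : ∀ {s} → 1 ℕ.≤ s → ⟦ fromℕ (suc s) ⟧ -ᶜ √ (s ℕ.^ 2 ℕ.+ 1) ≤ᶜ πcyc (K (suc (suc s)))
  surd≤πcyc {s} 1≤s = surd-≤ᶜ (fromℕ (suc s)) (s ℕ.^ 2 ℕ.+ 1) (πcyc (K (suc (suc s)))) (πcyc-lower 1≤s)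

  -- The degree threshold

  threshold : ℕ → ℕ → ℚ
  threshold s k = (fromℕ 2 ℚ.- 1 ÷ s) ℚ.* fromℕ k ℚ.+ 1ℚ

  threshold-* : ∀ s′ k → let s = suc s′ in threshold s k ℚ.* ι (+ s) ≡ ι (+ 2 * (+ s * + k) - + k + + s)
  threshold-* s′ k = begin
    ((ι (+ 2) ℚ.- u) ℚ.* Kk ℚ.+ 1ℚ) ℚ.* S
      ≡⟨ identity u Kk S ⟩
    ι (+ 2) ℚ.* (S ℚ.* Kk) ℚ.- u ℚ.* S ℚ.* Kk ℚ.+ S
      ≡⟨ cong (λ z → ι (+ 2) ℚ.* (S ℚ.* Kk) ℚ.- z ℚ.+ S) (trans (cong (ℚ._* Kk) (÷-* 1 s′)) (ℚ.*-identityˡ Kk)) ⟩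
    ι (+ 2) ℚ.* (S ℚ.* Kk) ℚ.- Kk ℚ.+ S
      ≡⟨ cong (λ z → z ℚ.- Kk ℚ.+ S) (trans (ι-* (+ 2) (+ suc s′ * + k)) (cong (ι (+ 2) ℚ.*_) (ι-* (+ suc s′) (+ k)))) ⟨
    ι (+ 2 * (+ suc s′ * + k)) ℚ.- Kk ℚ.+ S
      ≡⟨ trans (ι-+ (+ 2 * (+ suc s′ * + k) - + k) (+ suc s′)) (cong (ℚ._+ S) (ι-minus (+ 2 * (+ suc s′ * + k)) (+ k))) ⟨
    ι (+ 2 * (+ suc s′ * + k) - + k + + suc s′) ∎
    where
    open ≡-Reasoning
    u = 1 ÷ suc s′
    Kk = ι (+ k)
    S = ι (+ suc s′)
    identity : ∀ u k S → ((ι (+ 2) ℚ.- u) ℚ.* k ℚ.+ 1ℚ) ℚ.* S ≡ ι (+ 2) ℚ.* (S ℚ.* k) ℚ.- u ℚ.* S ℚ.* k ℚ.+ S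
    identity = solve 3 (λ u k S → ((con (+ 2) :- u) :* k :+ con 1ℤ) :* S := con (+ 2) :* (S :* k) :- u :* S :* k :+ S) refl

  threshold<ratio : ∀ s′ k n x → 0 ℕ.< n → let s = suc s′ in
    (+ 2 * (+ s * + k) - + k + + s) * + n < + 2 * + x * + s → threshold s k ℚ.< (2 ℕ.* x) ÷ n
  threshold<ratio s′ k (suc n′) x _ lt = ℚ.≰⇒> λ y≤T → ℤ.<⇒≱ lt (ι-cancel-≤ (begin
    ι (+ 2 * + x * S)
      ≡⟨ trans (ι-* (+ 2 * + x) S) (cong (λ z → z ℚ.* ι S) (trans (cong ι (sym (ℤ.pos-* 2 x))) (sym (÷-* (2 ℕ.* x) n′)))) ⟩
    y ℚ.* ι N ℚ.* ι S
      ≤⟨ ℚ.*-monoʳ-≤-nonNeg (ι S) {{ℚ.nonNegative (0≤ι (suc s′))}} (ℚ.*-monoʳ-≤-nonNeg (ι N) {{ℚ.nonNegative (0≤ι (suc n′))}} y≤T) ⟩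
    T ℚ.* ι N ℚ.* ι S
      ≡⟨ identity T (ι N) (ι S) ⟩
    T ℚ.* ι S ℚ.* ι N
      ≡⟨ trans (cong (λ z → z ℚ.* ι N) (threshold-* s′ k)) (sym (ι-* (+ 2 * (S * + k) - + k + S) N)) ⟩
    ι ((+ 2 * (S * + k) - + k + S) * N) ∎))
    where
    open ℚ.≤-Reasoning
    S N : ℤ
    S = + suc s′
    N = + suc n′
    y = (2 ℕ.* x) ÷ suc n′
    T = threshold (suc s′) k
    identity : ∀ T N S → T ℚ.* N ℚ.* S ≡ T ℚ.* S ℚ.* N
    identity = solve 3 (λ T N S → T :* N :* S := T :* S :* N) refl

  threshold<degree : ∀ s′ k x → let s = suc s′ in
    threshold s k ℚ.< fromℕ x → + 2 * (+ s * + k) - + k + + s < + x * + s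
  threshold<degree s′ k x lt = ι-cancel-< (ℚ.<-respˡ-≡ (threshold-* s′ k) (ℚ.<-respʳ-≡ (sym (ι-* (+ x) (+ suc s′)))
    (ℚ.*-monoˡ-<-pos (ι (+ suc s′)) {{ℚ.positive (0<ι s′)}} lt)))

  i≤∣i∣ : ∀ i → i ≤ + ℤ.∣ i ∣
  i≤∣i∣ (+ n)      = ℤ.≤-refl
  i≤∣i∣ ℤ.-[1+ n ] = ℤ.-≤+

  record Dense (s k n : ℕ) : Set₁ where
    field
      {m}     : ℕ
      H       : Graph m
      host    : H ⊑ CyclePower n k
      free    : ¬ (K (suc (suc s)) ⊑ H)
      average : threshold s k ℚ.< averageDegree H

  -- k = s b + e′ with 1 ≤ e′ ≤ s: blocks slightly shorter than k / s.
  module _ (s′ : ℕ) where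
    private
      s = suc s′

    -- From here on (k - 1) / s is at least 1 + s (s + 1), which covers the requirement 1 + s (e′ +
    -- 1) on the block length for every e′ ≤ s.
    k₀ : ℕ
    k₀ = suc (suc (s ℕ.* suc s) ℕ.* s)

    module _ (e′ d : ℕ) (1≤e′ : 1 ℕ.≤ e′) (long : suc (s ℕ.* suc e′) ℕ.≤ e′ ℕ.+ d) where
      private
        b = e′ ℕ.+ d
        k = s ℕ.* b ℕ.+ e′
        bℤ kℤ F X : ℤ
        bℤ = + e′ + + d
        kℤ = + s * bℤ + + e′
        F = + 2 * (+ s * (bℤ * bℤ)) - + d * + d + + d
        X = + s * ((bℤ + kℤ) * F)

        kℤ-eq : + k ≡ kℤ
        kℤ-eq = cong (_+ + e′) (ℤ.pos-* s b)

        instance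
          b≢0 : NonZero b
          b≢0 = ℕ.>-nonZero (ℕ.≤-trans (s≤s z≤n) long)

      n₀ : ℕ
      n₀ = suc ℤ.∣ X ∣ ℕ.+ k

      dense-subgraph : ∀ m → suc ℤ.∣ X ∣ ℕ.≤ m → Dense s k (m ℕ.+ k)
      dense-subgraph m m-large = record
        { H = multipartite n k b (suc s) ; host = multipartite-⊑ n k b (suc s)
        ; free = multipartite-K-free n k b (suc s)
        ; average = threshold<ratio s′ k n (e (multipartite n k b (suc s))) 0<n (exceeds (e (multipartite n k b (suc s))) many) }
        where
        n = m ℕ.+ k
        0<n : 0 ℕ.< n
        0<n = ℕ.≤-trans (s≤s z≤n) (ℕ.≤-trans m-large (ℕ.m≤m+n m k))
        instance
          n≢0 : NonZero n
          n≢0 = ℕ.>-nonZero 0<n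
        N = m ℕ./ b
        many : + N * F ≤ + 2 * + e (multipartite n k b (suc s))
        many = multipartite-edges n s e′ d (s≤s z≤n) N (blocks-fit k b m)
        long′ : 1ℤ + + s * (+ e′ + 1ℤ) ≤ bℤ
        long′ = ℤ.≤-trans (ℤ.≤-reflexive (cong (λ z → 1ℤ + z)
          (sym (trans (cong (λ z → + (s ℕ.* z)) (sym (ℕ.+-comm e′ 1))) (ℤ.pos-* s (e′ ℕ.+ 1)))))) (ℤ.+≤+ long)
        exceeds : ∀ x → + N * F ≤ + 2 * + x → (+ 2 * (+ s * + k) - + k + + s) * + n < + 2 * + x * + s
        exceeds x many = subst (λ z → (+ 2 * (+ s * z) - z + + s) * + n < + 2 * + x * + s) (sym kℤ-eq)
          (average-degree-lower {+ s} {+ e′} {+ d} {+ N} {+ n} {+ x} (ℤ.+≤+ (s≤s z≤n)) (ℤ.+≤+ 1≤e′) (0≤+n {d}) (0≤+n {n})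
            many (ℤ.≤-trans (blocks-fill k b m) (ℤ.≤-reflexive (cong (λ z → + N * + b + + b + z) kℤ-eq))) long′
            (ℤ.≤-trans (ℤ.+-monoʳ-≤ 1ℤ (i≤∣i∣ X)) (ℤ.+≤+ (ℕ.≤-trans m-large (ℕ.m≤m+n m k)))))

      dense-subgraphs : ∀ n → n₀ ℕ.≤ n → Dense s k n
      dense-subgraphs n n-large = subst (Dense s k) (ℕ.m∸n+n≡m {n} {k} (ℕ.≤-trans (ℕ.m≤n+m k (suc ℤ.∣ X ∣)) n-large))
        (dense-subgraph (n ∸ k) (ℕ.m+n≤o⇒m≤o∸n (suc ℤ.∣ X ∣) n-large))

    split : ∀ k → k₀ ℕ.≤ k → ∃[ e′ ] ∃[ d ] 1 ℕ.≤ e′ × suc (s ℕ.* suc e′) ℕ.≤ e′ ℕ.+ d × k ≡ s ℕ.* (e′ ℕ.+ d) ℕ.+ e′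
    split (suc k′) (s≤s k-large) = e′ , d , s≤s z≤n , subst (suc (s ℕ.* suc e′) ℕ.≤_) (sym b≡) long , (begin
        suc k′                               ≡⟨ cong suc (m≡m%n+[m/n]*n k′ s) ⟩
        e′ ℕ.+ k′ ℕ./ s ℕ.* s                 ≡⟨ cong (e′ ℕ.+_) (ℕ.*-comm (k′ ℕ./ s) s) ⟩
        e′ ℕ.+ s ℕ.* (k′ ℕ./ s)               ≡⟨ ℕ.+-comm e′ _ ⟩
        s ℕ.* (k′ ℕ./ s) ℕ.+ e′               ≡⟨ cong (λ z → s ℕ.* z ℕ.+ e′) b≡ ⟨
        s ℕ.* (e′ ℕ.+ d) ℕ.+ e′               ∎)
      where
      open ≡-Reasoning
      -- Taking the remainder of k - 1 and adding 1 gives a value from 1 to s, never 0: when s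
      -- divides k, the blocks have length k / s - 1 instead of k / s.
      e′ = suc (k′ ℕ.% s)
      d = k′ ℕ./ s ∸ e′
      e′≤s : e′ ℕ.≤ s
      e′≤s = m%n<n k′ s
      long : suc (s ℕ.* suc e′) ℕ.≤ k′ ℕ./ s
      long = ℕ.≤-trans (s≤s (ℕ.*-monoʳ-≤ s (s≤s e′≤s)))
        (ℕ.≤-trans (ℕ.≤-reflexive (sym (m*n/n≡m (suc (s ℕ.* suc s)) s))) (/-monoˡ-≤ s k-large))
      b≡ : e′ ℕ.+ d ≡ k′ ℕ./ s
      b≡ = ℕ.m+[n∸m]≡n (ℕ.≤-trans e′≤s (ℕ.≤-trans (ℕ.≤-trans (ℕ.m≤m*n s (suc e′)) (ℕ.n≤1+n _)) long))

    eventually-dense : ∀ k → k₀ ℕ.≤ k → ∃[ n₀ ] ∀ n → n₀ ℕ.≤ n → Dense s k n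
    eventually-dense k k-large = from-split (split k k-large)
      where
      from-split : (∃[ e′ ] ∃[ d ] 1 ℕ.≤ e′ × suc (s ℕ.* suc e′) ℕ.≤ e′ ℕ.+ d × k ≡ s ℕ.* (e′ ℕ.+ d) ℕ.+ e′) →
                   ∃[ n₀ ] ∀ n → n₀ ℕ.≤ n → Dense s k n
      from-split (e′ , d , 1≤e′ , long , refl) = n₀ e′ d 1≤e′ long , dense-subgraphs e′ d 1≤e′ long

  module _ (s′ k n : ℕ) .{{_ : NonZero n}} (1≤k : 1 ℕ.≤ k) where
    private
      s = suc s′
      μ = (k ∸ 1) ℕ./ s

      μ-room : s ℕ.* μ ℕ.< k
      μ-room = ℕ.≤-<-trans (ℕ.≤-trans (ℕ.≤-reflexive (ℕ.*-comm s μ)) (m/n*n≤m (k ∸ 1) s))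
        (ℕ.≤-reflexive (ℕ.m+[n∸m]≡n 1≤k))

      ≤μ : ∀ x → s ℕ.* x ℕ.< k → x ℕ.≤ μ
      ≤μ x sx<k = ℕ.≤-trans (ℕ.≤-reflexive (sym (m*n/n≡m x s)))
        (/-monoˡ-≤ s (ℕ.≤-pred (ℕ.≤-trans (s≤s (ℕ.≤-reflexive (ℕ.*-comm x s)))
          (ℕ.≤-trans sx<k (ℕ.≤-reflexive (sym (ℕ.m+[n∸m]≡n 1≤k)))))))

      -- Cleared of denominators, a degree `x` above the threshold means s (2k + 1 - x) < k, and `μ`
      -- is the largest integer with s μ < k.
      missing≤μ : ∀ x → + 2 * (+ s * + k) - + k + + s < + x * + s → suc (k ℕ.+ k) ℕ.≤ x ℕ.+ μ
      missing≤μ x lt = ℕ.≤-trans (ℕ.m≤n+m∸n (suc (k ℕ.+ k)) x) (ℕ.+-monoʳ-≤ x (≤μ M sM<k))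
        where
        M = suc (k ℕ.+ k) ∸ x
        sM<k : s ℕ.* M ℕ.< k
        sM<k = by-cases (ℕ.≤-total x (suc (k ℕ.+ k)))
          where
          by-cases : x ℕ.≤ suc (k ℕ.+ k) ⊎ suc (k ℕ.+ k) ℕ.≤ x → s ℕ.* M ℕ.< k
          by-cases (inj₂ w≤x) = subst (ℕ._< k) (sym (trans (cong (s ℕ.*_) (ℕ.m≤n⇒m∸n≡0 w≤x)) (ℕ.*-zeroʳ s))) 1≤k
          by-cases (inj₁ x≤w) = ℤ.drop‿+<+ (ℤ.≤-<-trans (ℤ.≤-reflexive (trans (ℤ.pos-* s M)
              (cong (+ s *_) (sym (trans (ℤ.m-n≡m⊖n (suc (k ℕ.+ k)) x) (ℤ.⊖-≥ x≤w))))))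
            (ℤ.suc[i]≤j⇒i<j (≤-by (0≤-diff (ℤ.i<j⇒suc[i]≤j lt)) (identity (+ s) (+ k) (+ x)))))
            where
            identity : ∀ s k x → k ≡ 1ℤ + s * (1ℤ + (k + k) - x) + (x * s - (1ℤ + (+ 2 * (s * k) - k + s)))
            identity = solve-∀

    module _ {m} (H : Graph (suc m)) (H⊑C : H ⊑ CyclePower n k)
             (large : ∀ v → + 2 * (+ s * + k) - + k + + s < + degree H v * + s) where
      private
        f = proj₁ H⊑C
        G = image H f
        module HU = Unrolled (suc m)
        module GU = Unrolled n

        degree≤ : ∀ u → degree H u ℕ.≤ degree G (f u)
        degree≤ u = ℤ.drop‿+≤+ (begin
          + degree H u
            ≡⟨ cong (λ v → + degree H v) (HU.node-toℕ u) ⟨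
          + degree H (HU.node (toℕ u))
            ≡⟨ HU.degree-∑ H (toℕ u) ⟩
          ∑ (suc m) (HU.adj H (toℕ u))
            ≤⟨ degree-image H f (proj₁ (proj₂ H⊑C)) (toℕ u) ⟩
          ∑ n (GU.adj G (toℕ (f (HU.node (toℕ u)))))
            ≡⟨ GU.degree-∑ G (toℕ (f (HU.node (toℕ u)))) ⟨
          + degree G (GU.node (toℕ (f (HU.node (toℕ u)))))
            ≡⟨ cong (λ x → + degree G x) (trans (GU.node-toℕ (f (HU.node (toℕ u)))) (cong f (HU.node-toℕ u))) ⟩
          + degree G (f u) ∎)
          where open ℤ.≤-Reasoning

        degree≥ : ∀ {x y} → Adj G x y → suc (k ℕ.+ k) ℕ.≤ degree G x ℕ.+ μ
        degree≥ (u , _ , refl , _) = ℕ.≤-trans (missing≤μ (degree H u) (large u)) (ℕ.+-monoˡ-≤ μ (degree≤ u))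

        -- The clique grows from an edge, so one is needed. An isolated vertex would miss all 2k + 1
        -- positions, but `μ` is less than k.
        neighbour : ∃[ v ] Adj H Fin.zero v
        neighbour = from-dec (Fin.any? (adj? H Fin.zero))
          where
          from-dec : Dec (∃[ v ] Adj H Fin.zero v) → ∃[ v ] Adj H Fin.zero v
          from-dec (yes found) = found
          from-dec (no none)   = ⊥-elim (ℕ.<-irrefl refl (ℕ.<-≤-trans window (ℕ.≤-trans
            (missing≤μ (degree H Fin.zero) (large Fin.zero)) (ℕ.≤-reflexive (cong (ℕ._+ μ) isolated)))))
            where
            isolated : degree H Fin.zero ≡ 0
            isolated = ℤ.+-injective (trans (cong (λ v → + degree H v) (sym (HU.node-toℕ Fin.zero)))
              (trans (HU.degree-∑ H 0) (trans (∑-cong′ (suc m) λ y → 𝟙-no (adj? H (HU.node 0) (HU.node y))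
                λ a → none (HU.node y , subst (λ v → Adj H v (HU.node y)) (HU.node-toℕ Fin.zero) a))
                (trans (∑-const (suc m) 0ℤ) (ℤ.*-zeroʳ (+ suc m))))))
            window : μ ℕ.< suc (k ℕ.+ k)
            window = s≤s (ℕ.≤-trans (ℕ.≤-trans (ℕ.m≤n*m μ s) (ℕ.<⇒≤ μ-room)) (ℕ.m≤m+n k k))

      minimum-degree-clique : K (suc (suc s)) ⊑ H
      minimum-degree-clique = K-image H f (proj₁ (proj₂ H⊑C))
        (large-degree-clique n k G (image-sub H (CyclePower n k) H⊑C) μ degree≥ s′
          (image-adj H f (proj₁ (proj₂ H⊑C)) Fin.zero (proj₁ neighbour) (proj₂ neighbour)) μ-room)

open import Data.Rational using (_≤_; _<_; _+_; _-_; _*_)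
open Surds
open Densities

surd≤πcyc-K : ∀ t → 3 ℕ.≤ t → ⟦ fromℕ (t ∸ 1) ⟧ -ᶜ √ ((t ∸ 2) ^ 2 ℕ.+ 1) ≤ᶜ πcyc (K t)
surd≤πcyc-K (suc (suc (suc i))) _ = surd≤πcyc {suc i} (s≤s z≤n)
surd≤πcyc-K (suc (suc zero)) (s≤s (s≤s ()))
surd≤πcyc-K (suc zero) (s≤s ())

surd-expansion : ∀ t → 3 ℕ.≤ t →
  let s = t ∸ 2
      x = ⟦ fromℕ (t ∸ 1) ⟧ -ᶜ √ (s ^ 2 ℕ.+ 1)
      y = 1ℚ - 1 ÷ (2 ℕ.* s) + 1 ÷ (8 ℕ.* s ^ 3)
  in ⟦ y - 1ℚ * (1 ÷ s ^ 5) ⟧ ≤ᶜ x × x ≤ᶜ ⟦ y ⟧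
surd-expansion (suc (suc (suc i))) _ = surd-lower-expansion i , surd-upper-expansion i
surd-expansion (suc (suc zero)) (s≤s (s≤s ()))
surd-expansion (suc zero) (s≤s ())

minimum-degree-threshold : ∀ t → 3 ℕ.≤ t → ∃[ k₀ ] ∀ k → k₀ ℕ.≤ k → ∃[ n₀ ] ∀ n → n₀ ℕ.≤ n →
  (∃[ m ] Σ[ H ∈ Graph m ] H ⊑ CyclePower n k × ¬ (K t ⊑ H) × threshold (t ∸ 2) k < averageDegree H)
  × (∀ m (H : Graph (ℕ.suc m)) → H ⊑ CyclePower n k →
       (∀ v → threshold (t ∸ 2) k < fromℕ (degree H v)) → K t ⊑ H)
minimum-degree-threshold (suc (suc zero)) (s≤s (s≤s ()))
minimum-degree-threshold (suc zero) (s≤s ())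
minimum-degree-threshold (suc (suc (suc i))) _ = k₀ i , λ k k₀≤k → from-dense k k₀≤k (eventually-dense i k k₀≤k)
  where
  from-dense : ∀ k → k₀ i ℕ.≤ k → (∃[ n₀ ] ∀ n → n₀ ℕ.≤ n → Dense (suc i) k n) → ∃[ n₀ ] ∀ n → n₀ ℕ.≤ n →
    (∃[ m ] Σ[ H ∈ Graph m ] H ⊑ CyclePower n k × ¬ (K (suc (suc (suc i))) ⊑ H) × threshold (suc i) k < averageDegree H)
    × (∀ m (H : Graph (ℕ.suc m)) → H ⊑ CyclePower n k →
         (∀ v → threshold (suc i) k < fromℕ (degree H v)) → K (suc (suc (suc i))) ⊑ H)
  -- The successor makes `n` positive, as residues modulo `n` require.
  from-dense k k₀≤k (n₀ , dense) = suc n₀ , λ n n₀<n →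
    (let open Dense (dense n (ℕ.<⇒≤ n₀<n)) in m , H , host , free , average) ,
    λ m H H⊑C large → minimum-degree-clique i k n {{ℕ.>-nonZero (ℕ.≤-trans (s≤s z≤n) n₀<n)}}
      (ℕ.≤-trans (s≤s z≤n) k₀≤k) H H⊑C (λ v → threshold<degree i k (degree H v) (large v))

proposition1p7 :
    (⟦ fromℕ 2 ⟧ -ᶜ √ 2 ≤ᶜ πcyc (K 3) × πcyc (K 3) ≤ᶜ ⟦ 3 ÷ 5 ⟧)
    × (∀ t → 3 ℕ.≤ t →
         ⟦ fromℕ (t ∸ 1) ⟧ -ᶜ √ ((t ∸ 2) ^ 2 ℕ.+ 1) ≤ᶜ πcyc (K t))
    × (∃[ C ] 0ℚ ≤ C × (∀ t → 3 ℕ.≤ t →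
         let s = t ∸ 2
             x = ⟦ fromℕ (t ∸ 1) ⟧ -ᶜ √ (s ^ 2 ℕ.+ 1)
             y = 1ℚ - 1 ÷ (2 ℕ.* s) + 1 ÷ (8 ℕ.* s ^ 3)
         in ⟦ y - C * (1 ÷ s ^ 5) ⟧ ≤ᶜ x × x ≤ᶜ ⟦ y ⟧))
    × (∀ t → 3 ℕ.≤ t → ∃[ k₀ ] ∀ k → k₀ ℕ.≤ k → ∃[ n₀ ] ∀ n → n₀ ℕ.≤ n →
         let threshold = (fromℕ 2 - 1 ÷ (t ∸ 2)) * fromℕ k + 1ℚ
         in (∃[ m ] Σ[ H ∈ Graph m ]
               H ⊑ CyclePower n k × ¬ (K t ⊑ H) × threshold < averageDegree H)
            × (∀ m (H : Graph (ℕ.suc m)) → H ⊑ CyclePower n k →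
                 (∀ v → threshold < fromℕ (degree H v)) → K t ⊑ H))
proposition1p7 = (surd≤πcyc-K 3 (s≤s (s≤s (s≤s z≤n))) , πcyc-K₃≤3/5) , surd≤πcyc-K ,
  (1ℚ , 0≤ι 1 , surd-expansion) , minimum-degree-threshold
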